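{- The number of consecutive equi-$n$-squares (the number of elements of $\Sigma_n$) is $$\left(\sum_{i=1}^{n}(-2)^{i+1}\binom{n}{i}\frac{(n^2-in)!}{((n-i)!)^{n}}\right)-\frac{4n\,(n^2-2n+1)!}{(n-1)!\,((n-2)!)^{n-1}}+\frac{8\lfloor n/2\rfloor\,(n^2-3n+2)!}{((n-2)!)^2\,((n-3)!)^{n-2}}-\frac{2\lfloor n/2\rfloor\,(n^2-4n+4)!}{((n-2)!)^2\,((n-4)!)^{n-2}},$$ and $$|\Sigma_n|\sim\frac{4n\,(n^2-n)!}{((n-1)!)^{n}}.$$
   Context: An equi-$n$-square is an $n\times n$ array with entries in $\{1,\dots,n\}$ in which each symbol $1,\dots,n$ occurs exactly $n$ times in the whole array. A row (read left to right) or column (read top to bottom) is called consecutive if it equals $(1,2,\dots,n)$ or $(n,n-1,\dots,1)$. An equi-$n$-square is called consecutive if at least one of its rows or columns is consecutive; $\Sigma_n$ is the set of all consecutive equi-$n$-squares. The symbol $\sim$ denotes asymptotic equivalence as $n\to\infty$ (the ratio of the two sides tends to $1$).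
   Formalization: The exact formula is stated for n ≥ 2, with 1/(negative)! read as 0 (relevant only for n = 2, 3); n = 1 is excluded because (n−2)! is then undefined and the formula would give 0 although there is one consecutive equi-1-square. -}

module Defs where

open import Data.Nat.Base as ℕ using (ℕ; zero; suc; _!)
open import Data.Nat.Properties as ℕₚ using (_!≢0)
open import Data.Integer.Base as ℤ using (ℤ; +_; -[1+_])
open import Data.Rational.Base as ℚ using (ℚ; 0ℚ; 1ℚ; _/_; _÷_; _-_; ∣_∣; _<_)
open import Data.Rational.Properties using (+-*-commutativeRing)
open import Algebra.Bundles using (CommutativeRing)
open import Data.Fin.Base using (Fin)
import Data.Fin.Properties as Fin
open import Data.List.Base as List using (List; []; _∷_; cartesianProductWith; filter; length)
open import Data.List.Membership.Propositional using (_∈_)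
open import Data.List.Membership.Propositional.Properties using (∈-allFin; ∈-cartesianProductWith⁺; ∈-filter⁺; ∈-filter⁻)
open import Data.List.Relation.Unary.Any using (here)
open import Data.List.Relation.Unary.All using ([])
open import Data.List.Relation.Unary.AllPairs using ([]; _∷_)
open import Data.List.Relation.Unary.Unique.Propositional using (Unique)
import Data.List.Relation.Unary.Unique.Propositional.Properties as Unique
open import Data.Product.Base using (Σ-syntax; ∃-syntax; _×_; _,_; proj₂)
open import Data.Sum.Base using (_⊎_)
open import Data.Vec.Base as Vec using (Vec; []; _∷_; allFin; reverse; transpose; concat; count)
open import Data.Vec.Properties using (≡-dec; ∷-injective)
open import Data.Vec.Relation.Unary.Any as Any using (Any)
open import Function.Bundles using (_⇔_; mk⇔)
open import Relation.Binary.PropositionalEquality using (_≡_; refl)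
open import Relation.Nullary.Decidable using (_×-dec_; _⊎-dec_)
open import Relation.Unary using (Decidable)

open import Algebra.Properties.Semiring.Exp (CommutativeRing.semiring +-*-commutativeRing) public
  using (_^_)
open import Algebra.Properties.Semiring.Sum (CommutativeRing.semiring +-*-commutativeRing) public
  using (sum; sum-syntax)

-- An n × n array is the vector of its rows. The symbol k ∈ {1,…,n} is
-- represented by the element of Fin n whose value is k - 1.

Array : ℕ → Set
Array n = Vec (Vec (Fin n) n) n

EquiSquare : ∀ {n} → Array n → Set
EquiSquare {n} a = ∀ (k : Fin n) → count (Fin._≟ k) (concat a) ≡ n

Consecutive : ∀ {n} → Vec (Fin n) n → Set
Consecutive {n} v = v ≡ allFin n ⊎ v ≡ reverse (allFin n)

ConsecutiveEquiSquare : ∀ n → Array n → Set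
ConsecutiveEquiSquare n a =
  EquiSquare a × (Any Consecutive a ⊎ Any Consecutive (transpose a))

consecutive? : ∀ {n} → Decidable (Consecutive {n})
consecutive? v = ≡-dec Fin._≟_ v _ ⊎-dec ≡-dec Fin._≟_ v _

consecutiveEquiSquare? : ∀ n → Decidable (ConsecutiveEquiSquare n)
consecutiveEquiSquare? n a =
  Fin.all? (λ k → count (Fin._≟ k) (concat a) ℕₚ.≟ n)
  ×-dec (Any.any? consecutive? a ⊎-dec Any.any? consecutive? (transpose a))

vectors : ∀ {A : Set} n → List A → List (Vec A n)
vectors zero    xs = [] ∷ []
vectors (suc n) xs = cartesianProductWith _∷_ xs (vectors n xs)

arrays : ∀ n → List (Array n)
arrays n = vectors n (vectors n (List.allFin n))

Σₙ : ∀ n → List (Array n)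
Σₙ n = filter (consecutiveEquiSquare? n) (arrays n)

∣Σ∣ : ℕ → ℕ
∣Σ∣ n = length (Σₙ n)

-- Σₙ n lists each consecutive equi-n-square exactly once (∈-Σₙ and
-- Σₙ-unique), so its length is the cardinality of the set of these squares.

∈-vectors : ∀ {A : Set} n {xs : List A} → (∀ x → x ∈ xs) → ∀ v → v ∈ vectors n xs
∈-vectors zero    p []      = here refl
∈-vectors (suc n) p (x ∷ v) = ∈-cartesianProductWith⁺ _∷_ (p x) (∈-vectors n p v)

vectors-unique : ∀ {A : Set} n {xs : List A} → Unique xs → Unique (vectors n xs)
vectors-unique zero    u = [] ∷ []
vectors-unique (suc n) u =
  Unique.cartesianProductWith⁺ _∷_ ∷-injective u (vectors-unique n u)

∈-Σₙ : ∀ n a → a ∈ Σₙ n ⇔ ConsecutiveEquiSquare n a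
∈-Σₙ n a = mk⇔
  (λ a∈ → proj₂ (∈-filter⁻ (consecutiveEquiSquare? n) {xs = arrays n} a∈))
  (∈-filter⁺ (consecutiveEquiSquare? n) (∈-vectors n (∈-vectors n ∈-allFin) a))

Σₙ-unique : ∀ n → Unique (Σₙ n)
Σₙ-unique n = Unique.filter⁺ (consecutiveEquiSquare? n)
  (vectors-unique n (vectors-unique n (Unique.allFin⁺ n)))

fromℕ : ℕ → ℚ
fromℕ k = + k / 1

-- The reciprocal 1/z!, with the usual convention that it is 0 for z < 0.
-- The convention is only relevant to the counts for n = 2 and n = 3, where
-- (n - 3)! or (n - 4)! is the factorial of a negative number.

1/_! : ℤ → ℚ
1/ (+ k)    ! = (+ 1 / (k !)) {{k !≢0}}
1/ -[1+ _ ] ! = 0ℚ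

infix 9 1/_!

infix 4 _∼_

_∼_ : (ℕ → ℚ) → (ℕ → ℚ) → Set
f ∼ g = ∀ (ε : ℚ) → 0ℚ < ε → ∃[ N ] ∀ n → N ℕ.≤ n →
  Σ[ g≢0 ∈ ℚ.NonZero (g n) ] ∣ (f n ÷ g n) {{g≢0}} - 1ℚ ∣ < ε

{-# OPTIONS --safe #-}

-- Distinct rows never conflict, nor do distinct columns, while an ascending row m
-- and a descending row n+1-m are compatible with exactly the same columns: the
-- ascending column m and the descending column n+1-m. Hence
--   [some row] * [some column] = Σₘ [row m↑ or row (n+1-m)↓] * [column m↑ or column (n+1-m)↓],
-- which leaves nine kinds of crossings for each m, and the rows alone are handled by
-- inclusion-exclusion over the partial choices of a direction for every row. The number
-- of equi-n-squares that agree with a compatible set of lines is a multinomial coefficient,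
-- because multinomial coefficients satisfy Pascal's recurrence, filling one cell at a time.
-- For the asymptotics, Bonferroni's inequalities bound the number of squares with a
-- consecutive row (or column), and k = n-1 satisfies k^(k+1) (k²)! ≤ (k²+k)!, so that
-- every correction is at most 1/k times the main term.

module Submission where

open import Defs
open import Data.Nat.Base as ℕ using (ℕ; zero; suc; _!; ⌊_/2⌋; z≤n; s≤s)
open import Data.Nat.Combinatorics using (_C_; nCk+nC[k+1]≡[n+1]C[k+1]; nC1≡n)
import Data.Nat.Properties as ℕₚ
import Data.Nat.Tactic.RingSolver as ℕ-Solver
open import Data.Integer.Base as ℤ using (ℤ; +_; -[1+_]; 0ℤ; 1ℤ; ∣_∣)
import Data.Integer.Properties as ℤₚ
import Data.Integer.Tactic.RingSolver as ℤ-Solver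
open import Data.Rational.Base as ℚ using (ℚ; 0ℚ; 1ℚ; _/_; _+_; _-_; _*_; -_)
import Data.Rational.Properties as ℚₚ
open import Data.Rational.Unnormalised.Base as ℚᵘ using (mkℚᵘ; *≡*; *≤*)
import Data.Rational.Unnormalised.Properties as ℚᵘₚ
open import Algebra.Bundles using (CommutativeRing)
open import Algebra.Properties.CommutativeMonoid.Sum ℚₚ.*-1-commutativeMonoid
  using () renaming (sum to ∏; sum-cong-≗ to ∏-cong; sum-remove to ∏-remove)
open import Algebra.Properties.Semiring.Sum (CommutativeRing.semiring ℚₚ.+-*-commutativeRing)
  using (*-distribˡ-sum; *-distribʳ-sum; ∑-distrib-+; sum-cong-≗)
import Algebra.Properties.Semiring.Sum (CommutativeRing.semiring ℤₚ.+-*-commutativeRing) as Σℤ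
open import Data.Bool.Base using (true; false; if_then_else_)
open import Data.Fin.Base using (Fin; zero; suc; toℕ; fromℕ<; inject₁; opposite; punchIn; punchOut)
import Data.Fin.Base as Fin using (fromℕ)
import Data.Fin.Properties as Fin
open import Data.List.Base as List using (List; []; _∷_)
open import Data.Maybe.Base using (Maybe; just; nothing)
import Data.Maybe.Relation.Unary.All as Maybe
open import Data.Product.Base using (_×_; _,_; proj₁; proj₂; ∃; ∃-syntax; Σ-syntax)
open import Data.Sum.Base as Sum using (_⊎_; inj₁; inj₂)
open import Data.Vec.Base as Vec using (Vec; []; _∷_; lookup; concat; count; transpose; reverse; allFin; _∷ʳ_)
import Data.Vec.Properties as Vec
open import Data.Vec.Relation.Unary.Any using (Any; here; there)
open import Function.Base using (_∘_; id)
open import Function.Bundles using (_⇔_; mk⇔; Equivalence)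
open import Level using (0ℓ)
open import Relation.Binary.PropositionalEquality
open import Relation.Nullary.Decidable
  using (Dec; does; yes; no; _×-dec_; _⊎-dec_; ¬?; does-⇔; dec-true; dec-false; dec⇒maybe)
open import Relation.Nullary.Negation using (¬_; contradiction)
open import Tactic.RingSolver using (solve-∀)
import Tactic.RingSolver.Core.AlmostCommutativeRing as ACR

open Equivalence using (to; from)

-- The obstacle is that a partial filling may demand more copies of a symbol than are left.
-- Multiplicities are therefore integers, and a reciprocal factorial of a negative integer is 0.
-- With this convention an impossible demand contributes 0 by itself, and Pascal's recurrence holds
-- without a case distinction on exhausted symbols.
--
-- The same convention absorbs the condition of being an equi-square. In a full array the deficits n
-- - (number of occurrences) sum to 0, so either all vanish and their multinomial coefficient is 1,
-- or one is negative and it is 0. Hence the indicator of an equi-square is itself a multinomial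
-- coefficient, and the sum over all arrays collapses cell by cell from there.
--
-- Two degenerate situations leave a trace. For n = 1 the two directions coincide, so the exact
-- count assumes n at least 2, where no line has both. For odd n the middle index is its own mirror
-- image; there the pair of an ascending line m and a descending line n+1-m does not exist, which is
-- why the last two terms of the formula carry the even number 2⌊n/2⌋ in place of n.

ℚ-ring : ACR.AlmostCommutativeRing 0ℓ 0ℓ
ℚ-ring = ACR.fromCommutativeRing ℚₚ.+-*-commutativeRing (λ q → dec⇒maybe (0ℚ ℚₚ.≟ q))

private variable
  A B : Set
  P Q : Set
  k n : ℕ

-- Generic in the ring because it is used twice: over ℚ for counting arrays, and over ℤ for the
-- multiplicities of symbols, where subtraction must stay exact.
module Indicator (R : CommutativeRing 0ℓ 0ℓ) where
  open CommutativeRing R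
    renaming (Carrier to C; refl to ≈-refl; sym to ≈-sym; trans to ≈-trans; _+_ to _⊕_; _*_ to _⊗_)
  open import Algebra.Properties.Semiring.Sum semiring using () renaming (sum to ∑; sum-cong-≋ to ∑-cong; sum-replicate-zero to ∑-zero)

  ⟦_⟧ : Dec P → C
  ⟦ p? ⟧ = if does p? then 1# else 0#

  ⟦⟧-true : (p? : Dec P) → P → ⟦ p? ⟧ ≡ 1#
  ⟦⟧-true p? p = cong (if_then 1# else 0#) (dec-true p? p)

  ⟦⟧-false : (p? : Dec P) → ¬ P → ⟦ p? ⟧ ≡ 0#
  ⟦⟧-false p? ¬p = cong (if_then 1# else 0#) (dec-false p? ¬p)

  ⟦⟧-unique : ∀ {x} (p? : Dec P) → (P → x ≡ 1#) → (¬ P → x ≡ 0#) → ⟦ p? ⟧ ≡ x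
  ⟦⟧-unique (yes p) x≡1 x≡0 = sym (x≡1 p)
  ⟦⟧-unique (no ¬p) x≡1 x≡0 = sym (x≡0 ¬p)

  ⟦⟧-cong : P ⇔ Q → (p? : Dec P) (q? : Dec Q) → ⟦ p? ⟧ ≡ ⟦ q? ⟧
  ⟦⟧-cong P⇔Q p? q? = cong (if_then 1# else 0#) (does-⇔ P⇔Q p? q?)

  ⟦⟧-× : (p? : Dec P) (q? : Dec Q) → ⟦ p? ×-dec q? ⟧ ≈ ⟦ p? ⟧ ⊗ ⟦ q? ⟧
  ⟦⟧-× p? q? with does p?
  ... | true  = ≈-sym (*-identityˡ _)
  ... | false = ≈-sym (zeroˡ _)

  sum-δ : (t : Fin n) (f : Fin n → C) → ∑ (λ i → ⟦ i Fin.≟ t ⟧ ⊗ f i) ≈ f t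
  sum-δ {suc n} zero f = ≈-trans
    (+-cong (*-identityˡ _) (≈-trans (∑-cong (λ i → zeroˡ (f (suc i)))) (∑-zero n)))
    (+-identityʳ _)
  sum-δ (suc t) f = ≈-trans (+-cong (zeroˡ _) (sum-δ t (f ∘ suc))) (+-identityˡ _)

  sum-δ₁ : (t : Fin n) → ∑ (λ i → ⟦ i Fin.≟ t ⟧) ≈ 1#
  sum-δ₁ t = ≈-trans (∑-cong (λ i → ≈-sym (*-identityʳ ⟦ i Fin.≟ t ⟧))) (sum-δ t (λ _ → 1#))

open Indicator ℚₚ.+-*-commutativeRing
module δℤ = Indicator ℤₚ.+-*-commutativeRing

sum-zero : {f : Fin n → ℚ} → (∀ i → f i ≡ 0ℚ) → sum f ≡ 0ℚ
sum-zero {zero}  f≡0 = refl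
sum-zero {suc n} f≡0 = cong₂ _+_ (f≡0 zero) (sum-zero (f≡0 ∘ suc))

-- The embedding of the integers in ℚ

ι : ℤ → ℚ
ι z = z / 1

ιᵘ : ∀ z → ℚ.toℚᵘ (ι z) ℚᵘ.≃ mkℚᵘ z 0
ιᵘ z = ℚₚ.toℚᵘ-fromℚᵘ (mkℚᵘ z 0)

ι-+ : ∀ a b → ι (a ℤ.+ b) ≡ ι a + ι b
ι-+ a b = ℚₚ.toℚᵘ-injective (begin
  ℚ.toℚᵘ (ι (a ℤ.+ b))             ≈⟨ ιᵘ (a ℤ.+ b) ⟩
  mkℚᵘ (a ℤ.+ b) 0                 ≈⟨ *≡* (ℤ-identity a b) ⟩
  mkℚᵘ a 0 ℚᵘ.+ mkℚᵘ b 0           ≈⟨ ℚᵘₚ.+-cong (ιᵘ a) (ιᵘ b) ⟨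
  ℚ.toℚᵘ (ι a) ℚᵘ.+ ℚ.toℚᵘ (ι b)   ≈⟨ ℚₚ.toℚᵘ-homo-+ (ι a) (ι b) ⟨
  ℚ.toℚᵘ (ι a + ι b)               ∎)
  where
  open ℚᵘₚ.≃-Reasoning
  ℤ-identity : ∀ a b → (a ℤ.+ b) ℤ.* (1ℤ ℤ.* 1ℤ) ≡ (a ℤ.* 1ℤ ℤ.+ b ℤ.* 1ℤ) ℤ.* 1ℤ
  ℤ-identity = ℤ-Solver.solve-∀

ι-* : ∀ a b → ι (a ℤ.* b) ≡ ι a * ι b
ι-* a b = ℚₚ.toℚᵘ-injective (begin
  ℚ.toℚᵘ (ι (a ℤ.* b))             ≈⟨ ιᵘ (a ℤ.* b) ⟩
  mkℚᵘ (a ℤ.* b) 0                 ≈⟨ ℚᵘₚ.≃-refl ⟩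
  mkℚᵘ a 0 ℚᵘ.* mkℚᵘ b 0           ≈⟨ ℚᵘₚ.*-cong (ιᵘ a) (ιᵘ b) ⟨
  ℚ.toℚᵘ (ι a) ℚᵘ.* ℚ.toℚᵘ (ι b)   ≈⟨ ℚₚ.toℚᵘ-homo-* (ι a) (ι b) ⟨
  ℚ.toℚᵘ (ι a * ι b)               ∎)
  where open ℚᵘₚ.≃-Reasoning

ι-sum : (f : Fin n → ℤ) → ι (Σℤ.sum f) ≡ sum (ι ∘ f)
ι-sum {zero}  f = refl
ι-sum {suc n} f = trans (ι-+ (f zero) (Σℤ.sum (f ∘ suc))) (cong (ι (f zero) ℚ.+_) (ι-sum (f ∘ suc)))

fromℕ-* : ∀ a b → fromℕ (a ℕ.* b) ≡ fromℕ a * fromℕ b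
fromℕ-* a b = trans (cong ι (ℤₚ.pos-* a b)) (ι-* (+ a) (+ b))

fromℕ-+ : ∀ a b → fromℕ (a ℕ.+ b) ≡ fromℕ a + fromℕ b
fromℕ-+ a b = ι-+ (+ a) (+ b)

fromℕ-*-recip : ∀ m .{{_ : ℕ.NonZero m}} → fromℕ m * (+ 1 / m) ≡ 1ℚ
fromℕ-*-recip (suc m) = ℚₚ.toℚᵘ-injective (begin
  ℚ.toℚᵘ (fromℕ (suc m) * (+ 1 / suc m))
    ≈⟨ ℚₚ.toℚᵘ-homo-* (fromℕ (suc m)) (+ 1 / suc m) ⟩
  ℚ.toℚᵘ (fromℕ (suc m)) ℚᵘ.* ℚ.toℚᵘ (+ 1 / suc m)
    ≈⟨ ℚᵘₚ.*-cong (ιᵘ (+ suc m)) (ℚₚ.toℚᵘ-fromℚᵘ (mkℚᵘ (+ 1) m)) ⟩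
  mkℚᵘ (+ suc m) 0 ℚᵘ.* mkℚᵘ (+ 1) m
    ≈⟨ *≡* (ℤ-identity (+ suc m)) ⟩
  ℚᵘ.1ℚᵘ ∎)
  where
  open ℚᵘₚ.≃-Reasoning
  ℤ-identity : ∀ a → (a ℤ.* 1ℤ) ℤ.* 1ℤ ≡ 1ℤ ℤ.* (1ℤ ℤ.* a)
  ℤ-identity = ℤ-Solver.solve-∀

-- The convention 1/z! = 0 for z < 0 makes this hold for every integer z.
recip-factorial-pred : ∀ z → 1/ (z ℤ.- 1ℤ) ! ≡ ι z * 1/ z !
recip-factorial-pred -[1+ z ]  = sym (ℚₚ.*-zeroʳ (ι -[1+ z ]))
recip-factorial-pred (+ zero)  = refl
recip-factorial-pred (+ suc k) = begin
  r                                ≡⟨ ℚₚ.*-identityʳ r ⟨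
  r * 1ℚ                           ≡⟨ cong (r *_) (fromℕ-*-recip (suc k !) {{suc k ℕₚ.!≢0}}) ⟨
  r * (fromℕ (suc k !) * r′)       ≡⟨ cong (λ x → r * (x * r′)) (fromℕ-* (suc k) (k !)) ⟩
  r * (s * fromℕ (k !) * r′)       ≡⟨ rearrange r s (fromℕ (k !)) r′ ⟩
  fromℕ (k !) * r * (s * r′)       ≡⟨ cong (_* (s * r′)) (fromℕ-*-recip (k !) {{k ℕₚ.!≢0}}) ⟩
  1ℚ * (s * r′)                    ≡⟨ ℚₚ.*-identityˡ (s * r′) ⟩
  s * r′                           ∎
  where
  open ≡-Reasoning
  s = fromℕ (suc k)
  r = 1/ (+ k) !
  r′ = 1/ (+ suc k) !
  rearrange : ∀ a b c d → a * (b * c * d) ≡ c * a * (b * d)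
  rearrange = solve-∀ ℚ-ring

-- Sums over lists

∑ₗ : List A → (A → ℚ) → ℚ
∑ₗ []       f = 0ℚ
∑ₗ (x ∷ xs) f = f x + ∑ₗ xs f

∑ₗ-cong : (xs : List A) {f g : A → ℚ} → (∀ x → f x ≡ g x) → ∑ₗ xs f ≡ ∑ₗ xs g
∑ₗ-cong []       f≗g = refl
∑ₗ-cong (x ∷ xs) f≗g = cong₂ _+_ (f≗g x) (∑ₗ-cong xs f≗g)

∑ₗ-0 : (xs : List A) → ∑ₗ xs (λ _ → 0ℚ) ≡ 0ℚ
∑ₗ-0 []       = refl
∑ₗ-0 (x ∷ xs) = trans (ℚₚ.+-identityˡ _) (∑ₗ-0 xs)

∑ₗ-+ : (xs : List A) (f g : A → ℚ) → ∑ₗ xs (λ x → f x + g x) ≡ ∑ₗ xs f + ∑ₗ xs g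
∑ₗ-+ []       f g = refl
∑ₗ-+ (x ∷ xs) f g = trans (cong (f x + g x ℚ.+_) (∑ₗ-+ xs f g)) (interchange (f x) (g x) (∑ₗ xs f) (∑ₗ xs g))
  where
  interchange : ∀ a b c d → a + b + (c + d) ≡ a + c + (b + d)
  interchange = solve-∀ ℚ-ring

∑ₗ-*ˡ : (xs : List A) (c : ℚ) (f : A → ℚ) → ∑ₗ xs (λ x → c * f x) ≡ c * ∑ₗ xs f
∑ₗ-*ˡ []       c f = sym (ℚₚ.*-zeroʳ c)
∑ₗ-*ˡ (x ∷ xs) c f = trans (cong (c * f x ℚ.+_) (∑ₗ-*ˡ xs c f)) (sym (ℚₚ.*-distribˡ-+ c (f x) (∑ₗ xs f)))

∑ₗ-neg : (xs : List A) (f : A → ℚ) → ∑ₗ xs (λ x → - f x) ≡ - ∑ₗ xs f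
∑ₗ-neg []       f = refl
∑ₗ-neg (x ∷ xs) f = trans (cong (- f x ℚ.+_) (∑ₗ-neg xs f)) (sym (ℚₚ.neg-distrib-+ (f x) (∑ₗ xs f)))

∑ₗ-- : (xs : List A) (f g : A → ℚ) → ∑ₗ xs (λ x → f x - g x) ≡ ∑ₗ xs f - ∑ₗ xs g
∑ₗ-- xs f g = trans (∑ₗ-+ xs f (-_ ∘ g)) (cong (∑ₗ xs f ℚ.+_) (∑ₗ-neg xs g))

∑ₗ-mono : (xs : List A) {f g : A → ℚ} → (∀ x → f x ℚ.≤ g x) → ∑ₗ xs f ℚ.≤ ∑ₗ xs g
∑ₗ-mono []       f≤g = ℚₚ.≤-refl
∑ₗ-mono (x ∷ xs) f≤g = ℚₚ.+-mono-≤ (f≤g x) (∑ₗ-mono xs f≤g)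

∑ₗ-comm : (xs : List A) (ys : List B) (f : A → B → ℚ) →
          ∑ₗ xs (λ x → ∑ₗ ys (f x)) ≡ ∑ₗ ys (λ y → ∑ₗ xs (λ x → f x y))
∑ₗ-comm []       ys f = sym (∑ₗ-0 ys)
∑ₗ-comm (x ∷ xs) ys f = trans (cong (∑ₗ ys (f x) ℚ.+_) (∑ₗ-comm xs ys f)) (sym (∑ₗ-+ ys (f x) _))

∑ₗ-++ : (xs ys : List A) (f : A → ℚ) → ∑ₗ (xs List.++ ys) f ≡ ∑ₗ xs f + ∑ₗ ys f
∑ₗ-++ []       ys f = sym (ℚₚ.+-identityˡ _)
∑ₗ-++ (x ∷ xs) ys f = trans (cong (f x ℚ.+_) (∑ₗ-++ xs ys f)) (sym (ℚₚ.+-assoc (f x) _ _))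

∑ₗ-map : (g : A → B) (xs : List A) (f : B → ℚ) → ∑ₗ (List.map g xs) f ≡ ∑ₗ xs (f ∘ g)
∑ₗ-map g []       f = refl
∑ₗ-map g (x ∷ xs) f = cong (f (g x) ℚ.+_) (∑ₗ-map g xs f)

∑ₗ-tabulate : (g : Fin n → A) (f : A → ℚ) → ∑ₗ (List.tabulate g) f ≡ sum (f ∘ g)
∑ₗ-tabulate {zero}  g f = refl
∑ₗ-tabulate {suc n} g f = cong (f (g zero) ℚ.+_) (∑ₗ-tabulate (g ∘ suc) f)

∑ₗ-allFin : (f : Fin n → ℚ) → ∑ₗ (List.allFin n) f ≡ sum f
∑ₗ-allFin = ∑ₗ-tabulate id

∑ₗ-vectors-suc : ∀ k (xs : List A) (f : Vec A (suc k) → ℚ) →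
                 ∑ₗ (vectors (suc k) xs) f ≡ ∑ₗ xs (λ x → ∑ₗ (vectors k xs) (λ v → f (x ∷ v)))
∑ₗ-vectors-suc k xs f = go xs
  where
  go : ∀ ys → ∑ₗ (List.cartesianProductWith _∷_ ys (vectors k xs)) f
            ≡ ∑ₗ ys (λ x → ∑ₗ (vectors k xs) (λ v → f (x ∷ v)))
  go []       = refl
  go (y ∷ ys) = trans (∑ₗ-++ (List.map (y ∷_) (vectors k xs)) _ f)
    (cong₂ _+_ (∑ₗ-map (y ∷_) (vectors k xs) f) (go ys))

length-filter : {P : A → Set} (P? : ∀ x → Dec (P x)) (xs : List A) →
                fromℕ (List.length (List.filter P? xs)) ≡ ∑ₗ xs (λ x → ⟦ P? x ⟧)
length-filter P? []       = refl
length-filter P? (x ∷ xs) with does (P? x)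
... | true  = trans (fromℕ-+ 1 (List.length (List.filter P? xs))) (cong (1ℚ ℚ.+_) (length-filter P? xs))
... | false = trans (length-filter P? xs) (sym (ℚₚ.+-identityˡ _))

-- Finite products and integer sums

∏-scale : {f g : Fin n → ℚ} {a : ℚ} (t : Fin n) → f t ≡ a * g t →
          (∀ s → t ≢ s → f s ≡ g s) → ∏ f ≡ a * ∏ g
∏-scale {suc n} {f} {g} {a} t ft≡ f≗g = begin
  ∏ f                             ≡⟨ ∏-remove {i = t} f ⟩
  f t * ∏ (f ∘ punchIn t)         ≡⟨ cong₂ _*_ ft≡ (∏-cong λ s → f≗g (punchIn t s) (Fin.punchInᵢ≢i t s ∘ sym)) ⟩
  a * g t * ∏ (g ∘ punchIn t)     ≡⟨ ℚₚ.*-assoc a (g t) (∏ (g ∘ punchIn t)) ⟩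
  a * (g t * ∏ (g ∘ punchIn t))   ≡⟨ cong (a *_) (∏-remove {i = t} g) ⟨
  a * ∏ g                         ∎
  where open ≡-Reasoning

∏-const : ∀ n (a : ℚ) → ∏ {n} (λ _ → a) ≡ a ^ n
∏-const zero    a = refl
∏-const (suc n) a = cong (a *_) (∏-const n a)

∏-zero : (f : Fin n → ℚ) (t : Fin n) → f t ≡ 0ℚ → ∏ f ≡ 0ℚ
∏-zero {suc n} f t ft≡0 =
  trans (∏-remove {i = t} f) (trans (cong (_* ∏ (f ∘ punchIn t)) ft≡0) (ℚₚ.*-zeroˡ (∏ (f ∘ punchIn t))))

Σ-- : (f g : Fin n → ℤ) → Σℤ.sum (λ s → f s ℤ.- g s) ≡ Σℤ.sum f ℤ.- Σℤ.sum g
Σ-- {zero}  f g = refl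
Σ-- {suc n} f g = trans (cong (λ z → f zero ℤ.- g zero ℤ.+ z) (Σ-- (f ∘ suc) (g ∘ suc)))
  (interchange (f zero) (g zero) (Σℤ.sum (f ∘ suc)) (Σℤ.sum (g ∘ suc)))
  where
  interchange : ∀ a b c d → a ℤ.- b ℤ.+ (c ℤ.- d) ≡ a ℤ.+ c ℤ.- (b ℤ.+ d)
  interchange = ℤ-Solver.solve-∀

Σ-const : ∀ n z → Σℤ.sum {n} (λ _ → z) ≡ + n ℤ.* z
Σ-const zero    z = refl
Σ-const (suc n) z = trans (cong (λ x → z ℤ.+ x) (Σ-const n z)) (sym (ℤₚ.suc-* (+ n) z))

Σ-zero : (f : Fin n → ℤ) → (∀ s → f s ≡ 0ℤ) → Σℤ.sum f ≡ 0ℤ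
Σ-zero {zero}  f f≡0 = refl
Σ-zero {suc n} f f≡0 = cong₂ ℤ._+_ (f≡0 zero) (Σ-zero (f ∘ suc) (f≡0 ∘ suc))

-- Multiplicities and multinomial coefficients

δ : Fin n → Fin n → ℤ
δ x s = δℤ.⟦ x Fin.≟ s ⟧

δ-refl : (x : Fin n) → δ x x ≡ 1ℤ
δ-refl x = δℤ.⟦⟧-true (x Fin.≟ x) refl

δ-≢ : {x s : Fin n} → x ≢ s → δ x s ≡ 0ℤ
δ-≢ {x = x} {s} = δℤ.⟦⟧-false (x Fin.≟ s)

Σ-δ : (x : Fin n) → Σℤ.sum (δ x) ≡ 1ℤ
Σ-δ x = trans (Σℤ.sum-cong-≗ λ s → δℤ.⟦⟧-cong (mk⇔ sym sym) (x Fin.≟ s) (s Fin.≟ x)) (δℤ.sum-δ₁ x)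

-- The coefficient (Σν)! / ∏ ν(s)!, extended to integer multiplicities. The absolute value is
-- harmless: a negative sum forces a negative entry, and then the product is already 0.
multinomial : (Fin n → ℤ) → ℚ
multinomial ν = fromℕ (∣ Σℤ.sum ν ∣ !) * ∏ (λ s → 1/ (ν s) !)

multinomial-cong : {ν μ : Fin n → ℤ} → (∀ s → ν s ≡ μ s) → multinomial ν ≡ multinomial μ
multinomial-cong ν≗μ =
  cong₂ _*_ (cong (λ z → fromℕ (∣ z ∣ !)) (Σℤ.sum-cong-≗ ν≗μ)) (∏-cong λ s → cong 1/_! (ν≗μ s))

∏-recip-factorial-pred : (ν : Fin n → ℤ) (x : Fin n) →
  ∏ (λ s → 1/ (ν s ℤ.- δ x s) !) ≡ ι (ν x) * ∏ (λ s → 1/ (ν s) !)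
∏-recip-factorial-pred ν x = ∏-scale {a = ι (ν x)} x
  (trans (cong (λ d → 1/ (ν x ℤ.- d) !) (δ-refl x)) (recip-factorial-pred (ν x)))
  (λ s x≢s → cong 1/_! (trans (cong (λ d → ν s ℤ.- d) (δ-≢ x≢s)) (ℤₚ.+-identityʳ (ν s))))

-- Lowering ν(x) by one multiplies the product π of reciprocal factorials by ν(x), also when ν(x) is
-- zero or negative. Summing over x collects Σν = q + 1, which turns q! into (q + 1)!.
multinomial-pascal : ∀ {q} (ν : Fin n → ℤ) → Σℤ.sum ν ≡ + suc q →
  sum (λ x → multinomial (λ s → ν s ℤ.- δ x s)) ≡ multinomial ν
multinomial-pascal {q = q} ν Σν = begin
  sum (λ x → multinomial (λ s → ν s ℤ.- δ x s))
    ≡⟨ sum-cong-≗ (λ x → cong₂ _*_ (cong (λ z → fromℕ (∣ z ∣ !)) (Σν-δ x)) (∏-recip-factorial-pred ν x)) ⟩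
  sum (λ x → fromℕ (q !) * (ι (ν x) * π))
    ≡⟨ *-distribˡ-sum (fromℕ (q !)) (λ x → ι (ν x) * π) ⟨
  fromℕ (q !) * sum (λ x → ι (ν x) * π)
    ≡⟨ cong (fromℕ (q !) *_) (*-distribʳ-sum π (ι ∘ ν)) ⟨
  fromℕ (q !) * (sum (ι ∘ ν) * π)
    ≡⟨ cong (λ z → fromℕ (q !) * (z * π)) (trans (sym (ι-sum ν)) (cong ι Σν)) ⟩
  fromℕ (q !) * (fromℕ (suc q) * π)
    ≡⟨ rearrange (fromℕ (q !)) (fromℕ (suc q)) π ⟩
  fromℕ (suc q) * fromℕ (q !) * π
    ≡⟨ cong (_* π) (fromℕ-* (suc q) (q !)) ⟨
  fromℕ (suc q !) * π
    ≡⟨ cong (λ z → fromℕ (∣ z ∣ !) * π) Σν ⟨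
  multinomial ν ∎
  where
  open ≡-Reasoning
  π = ∏ (λ s → 1/ (ν s) !)
  Σν-δ : ∀ x → Σℤ.sum (λ s → ν s ℤ.- δ x s) ≡ + q
  Σν-δ x = trans (Σ-- ν (δ x)) (cong₂ ℤ._-_ Σν (Σ-δ x))
  rearrange : ∀ a b c → a * (b * c) ≡ b * a * c
  rearrange = solve-∀ ℚ-ring

-- Words with prescribed letters

content : Vec (Fin n) k → Fin n → ℤ
content v s = + count (Fin._≟ s) v

content-∷ : (x : Fin n) (v : Vec (Fin n) k) → ∀ s → content (x ∷ v) s ≡ δ x s ℤ.+ content v s
content-∷ x v s with does (x Fin.≟ s)
... | true  = refl
... | false = refl

content-++ : ∀ {l} (v : Vec (Fin n) k) (w : Vec (Fin n) l) →
             ∀ s → content (v Vec.++ w) s ≡ content v s ℤ.+ content w s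
content-++ []      w s = refl
content-++ (x ∷ v) w s = trans (content-∷ x (v Vec.++ w) s)
  (trans (cong (λ z → δ x s ℤ.+ z) (content-++ v w s))
  (trans (sym (ℤₚ.+-assoc (δ x s) _ _)) (cong (ℤ._+ content w s) (sym (content-∷ x v s)))))

Σ-content : (v : Vec (Fin n) k) → Σℤ.sum (content v) ≡ + k
Σ-content {n} []  = Σℤ.sum-replicate-zero n
Σ-content (x ∷ v) = trans (Σℤ.sum-cong-≗ (content-∷ x v))
  (trans (Σℤ.∑-distrib-+ (δ x) (content v)) (cong₂ ℤ._+_ (Σ-δ x) (Σ-content v)))

Agrees : Maybe (Fin n) → Fin n → Set
Agrees c x = Maybe.All (x ≡_) c

agrees? : (c : Maybe (Fin n)) (x : Fin n) → Dec (Agrees c x)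
agrees? c x = Maybe.dec (x Fin.≟_) c

Matches : (Fin k → Maybe (Fin n)) → Vec (Fin n) k → Set
Matches p v = ∀ j → Agrees (p j) (lookup v j)

matches? : (p : Fin k → Maybe (Fin n)) (v : Vec (Fin n) k) → Dec (Matches p v)
matches? p v = Fin.all? (λ j → agrees? (p j) (lookup v j))

matches-∷ : (p : Fin (suc k) → Maybe (Fin n)) (x : Fin n) (v : Vec (Fin n) k) →
            ⟦ matches? p (x ∷ v) ⟧ ≡ ⟦ agrees? (p zero) x ⟧ * ⟦ matches? (p ∘ suc) v ⟧
matches-∷ p x v = ⟦⟧-× (agrees? (p zero) x) (matches? (p ∘ suc) v)

cellContent : Maybe (Fin n) → Fin n → ℤ
cellContent nothing  s = 0ℤ
cellContent (just t) s = δ t s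

patternContent : (Fin k → Maybe (Fin n)) → Fin n → ℤ
patternContent p s = Σℤ.sum (λ j → cellContent (p j) s)

-- The witness r is the number of free cells. It guarantees that the supply left after removing the
-- prescribed letters has a natural number as its total, as Pascal's recurrence requires.
Σ-patternContent : (p : Fin k → Maybe (Fin n)) → ∃[ r ] Σℤ.sum (patternContent p) ≡ + k ℤ.- + r
Σ-patternContent {zero}  {n} p = 0 , Σℤ.sum-replicate-zero n
Σ-patternContent {suc k} {n} p with p zero | Σ-patternContent (p ∘ suc)
... | nothing | r , Σp = suc r , trans (Σℤ.∑-distrib-+ (λ _ → 0ℤ) (patternContent (p ∘ suc)))
  (trans (cong₂ ℤ._+_ (Σℤ.sum-replicate-zero n) Σp) (shift (+ k) (+ r)))
  where
  shift : ∀ a b → 0ℤ ℤ.+ (a ℤ.- b) ≡ 1ℤ ℤ.+ a ℤ.- (1ℤ ℤ.+ b)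
  shift = ℤ-Solver.solve-∀
... | just t  | r , Σp = r , trans (Σℤ.∑-distrib-+ (δ t) (patternContent (p ∘ suc)))
  (trans (cong₂ ℤ._+_ (Σ-δ t) Σp) (sym (ℤₚ.+-assoc 1ℤ (+ k) (ℤ.- + r))))

-- The weight of a word v counts the ways to continue v by q further letters so that ν is used up.
-- Induction on the word: a prescribed letter selects one summand, and the sum over a free letter is
-- Pascal's recurrence. Free cells thus merge with the q cells still to come.
sum-matching-words : ∀ {q} (p : Fin k → Maybe (Fin n)) (ν : Fin n → ℤ) → Σℤ.sum ν ≡ + k ℤ.+ + q →
  ∑ₗ (vectors k (List.allFin n)) (λ v → ⟦ matches? p v ⟧ * multinomial (λ s → ν s ℤ.- content v s))
    ≡ multinomial (λ s → ν s ℤ.- patternContent p s)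
sum-matching-words {zero} p ν Σν =
  trans (ℚₚ.+-identityʳ (1ℚ * M)) (ℚₚ.*-identityˡ M)
  where M = multinomial (λ s → ν s ℤ.- 0ℤ)
sum-matching-words {suc k} {n} {q} p ν Σν = begin
  ∑ₗ (vectors (suc k) (List.allFin n)) (λ v → ⟦ matches? p v ⟧ * multinomial (λ s → ν s ℤ.- content v s))
    ≡⟨ ∑ₗ-vectors-suc k (List.allFin n) (λ v → ⟦ matches? p v ⟧ * multinomial (λ s → ν s ℤ.- content v s)) ⟩
  ∑ₗ (List.allFin n) (λ x → ∑ₗ (vectors k (List.allFin n)) (λ v →
      ⟦ matches? p (x ∷ v) ⟧ * multinomial (λ s → ν s ℤ.- content (x ∷ v) s)))
    ≡⟨ ∑ₗ-cong (List.allFin n) (λ x → trans (∑ₗ-cong (vectors k (List.allFin n)) (term x))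
         (∑ₗ-*ˡ (vectors k (List.allFin n)) ⟦ agrees? (p zero) x ⟧ (rest x))) ⟩
  ∑ₗ (List.allFin n) (λ x → ⟦ agrees? (p zero) x ⟧ * ∑ₗ (vectors k (List.allFin n)) (rest x))
    ≡⟨ ∑ₗ-cong (List.allFin n) (λ x → cong (⟦ agrees? (p zero) x ⟧ *_)
         (sum-matching-words (p ∘ suc) (λ s → ν s ℤ.- δ x s) (Σν-δ x))) ⟩
  ∑ₗ (List.allFin n) (λ x → ⟦ agrees? (p zero) x ⟧ * multinomial (λ s → ν s ℤ.- δ x s ℤ.- c s))
    ≡⟨ ∑ₗ-allFin (λ x → ⟦ agrees? (p zero) x ⟧ * multinomial (λ s → ν s ℤ.- δ x s ℤ.- c s)) ⟩
  sum (λ x → ⟦ agrees? (p zero) x ⟧ * multinomial (λ s → ν s ℤ.- δ x s ℤ.- c s))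
    ≡⟨ sum-first-letter (p zero) ⟩
  multinomial (λ s → ν s ℤ.- patternContent p s) ∎
  where
  open ≡-Reasoning
  c = patternContent (p ∘ suc)
  r = proj₁ (Σ-patternContent (p ∘ suc))
  assoc : ∀ a b c → a ℤ.- (b ℤ.+ c) ≡ a ℤ.- b ℤ.- c
  assoc = ℤ-Solver.solve-∀
  swap : ∀ a b c → a ℤ.- b ℤ.- c ≡ a ℤ.- c ℤ.- b
  swap = ℤ-Solver.solve-∀
  rest : Fin n → Vec (Fin n) k → ℚ
  rest x v = ⟦ matches? (p ∘ suc) v ⟧ * multinomial (λ s → ν s ℤ.- δ x s ℤ.- content v s)
  term : ∀ x v → ⟦ matches? p (x ∷ v) ⟧ * multinomial (λ s → ν s ℤ.- content (x ∷ v) s)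
       ≡ ⟦ agrees? (p zero) x ⟧ * rest x v
  term x v = trans (cong₂ _*_
    (matches-∷ p x v)
    (multinomial-cong (λ s → trans (cong (λ z → ν s ℤ.- z) (content-∷ x v s)) (assoc (ν s) (δ x s) (content v s)))))
    (ℚₚ.*-assoc ⟦ agrees? (p zero) x ⟧ ⟦ matches? (p ∘ suc) v ⟧ (multinomial (λ s → ν s ℤ.- δ x s ℤ.- content v s)))
  Σν-δ : ∀ x → Σℤ.sum (λ s → ν s ℤ.- δ x s) ≡ + k ℤ.+ + q
  Σν-δ x = trans (Σ-- ν (δ x)) (trans (cong₂ ℤ._-_ Σν (Σ-δ x)) (cancel (+ k) (+ q)))
    where
    cancel : ∀ a b → 1ℤ ℤ.+ a ℤ.+ b ℤ.- 1ℤ ≡ a ℤ.+ b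
    cancel = ℤ-Solver.solve-∀
  -- The supply for the q later cells, for the r free cells of the tail, and for the first cell
  -- itself; the extra one makes the total positive, so that the recurrence applies when this cell
  -- is free.
  Σν-c : Σℤ.sum (λ s → ν s ℤ.- c s) ≡ + suc (q ℕ.+ r)
  Σν-c = trans (Σ-- ν c) (trans (cong₂ ℤ._-_ Σν (proj₂ (Σ-patternContent (p ∘ suc)))) (cancel (+ k) (+ q) (+ r)))
    where
    cancel : ∀ a b d → 1ℤ ℤ.+ a ℤ.+ b ℤ.- (a ℤ.- d) ≡ 1ℤ ℤ.+ (b ℤ.+ d)
    cancel = ℤ-Solver.solve-∀
  sum-first-letter : ∀ m → sum (λ x → ⟦ agrees? m x ⟧ * multinomial (λ s → ν s ℤ.- δ x s ℤ.- c s))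
                         ≡ multinomial (λ s → ν s ℤ.- (cellContent m s ℤ.+ c s))
  sum-first-letter (just t) = trans
    (sum-δ t (λ x → multinomial (λ s → ν s ℤ.- δ x s ℤ.- c s)))
    (multinomial-cong (λ s → sym (assoc (ν s) (δ t s) (c s))))
  sum-first-letter nothing  = begin
    sum (λ x → 1ℚ * multinomial (λ s → ν s ℤ.- δ x s ℤ.- c s))
      ≡⟨ sum-cong-≗ (λ x → trans (ℚₚ.*-identityˡ (multinomial (λ s → ν s ℤ.- δ x s ℤ.- c s)))
           (multinomial-cong (λ s → swap (ν s) (δ x s) (c s)))) ⟩
    sum (λ x → multinomial (λ s → ν s ℤ.- c s ℤ.- δ x s))
      ≡⟨ multinomial-pascal (λ s → ν s ℤ.- c s) Σν-c ⟩
    multinomial (λ s → ν s ℤ.- c s)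
      ≡⟨ multinomial-cong (λ s → cong (λ z → ν s ℤ.- z) (sym (ℤₚ.+-identityˡ (c s)))) ⟩
    multinomial (λ s → ν s ℤ.- (0ℤ ℤ.+ c s)) ∎

-- Arrays with prescribed cells

Matches₂ : ∀ {m} → (Fin m → Fin k → Maybe (Fin n)) → Vec (Vec (Fin n) k) m → Set
Matches₂ p a = ∀ i → Matches (p i) (lookup a i)

matches₂? : ∀ {m} (p : Fin m → Fin k → Maybe (Fin n)) (a : Vec (Vec (Fin n) k) m) → Dec (Matches₂ p a)
matches₂? p a = Fin.all? (λ i → matches? (p i) (lookup a i))

patternContent₂ : ∀ {m} → (Fin m → Fin k → Maybe (Fin n)) → Fin n → ℤ
patternContent₂ p s = Σℤ.sum (λ i → patternContent (p i) s)

Σ-patternContent₂ : ∀ {m} (p : Fin m → Fin k → Maybe (Fin n)) →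
  ∃[ r ] Σℤ.sum (patternContent₂ p) ≡ + (m ℕ.* k) ℤ.- + r
Σ-patternContent₂ {k} {n} {zero}  p = 0 , Σℤ.sum-replicate-zero n
Σ-patternContent₂ {k} {n} {suc m} p with Σ-patternContent (p zero) | Σ-patternContent₂ (p ∘ suc)
... | r , Σp | r′ , Σp′ = r ℕ.+ r′ ,
  trans (Σℤ.∑-distrib-+ (patternContent (p zero)) (patternContent₂ (p ∘ suc)))
  (trans (cong₂ ℤ._+_ Σp Σp′) (interchange (+ k) (+ r) (+ (m ℕ.* k)) (+ r′)))
  where
  interchange : ∀ a b c d → a ℤ.- b ℤ.+ (c ℤ.- d) ≡ a ℤ.+ c ℤ.- (b ℤ.+ d)
  interchange = ℤ-Solver.solve-∀

-- For a fixed first row the rows below are summed by induction, which merely removes their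
-- prescribed letters from the supply. After swapping the two subtractions the first row is an
-- instance of `sum-matching-words`, with the free cells below counted among the cells to come.
sum-matching-arrays : ∀ {m q} (p : Fin m → Fin k → Maybe (Fin n)) (ν : Fin n → ℤ) →
  Σℤ.sum ν ≡ + (m ℕ.* k) ℤ.+ + q →
  ∑ₗ (vectors m (vectors k (List.allFin n)))
     (λ a → ⟦ matches₂? p a ⟧ * multinomial (λ s → ν s ℤ.- content (concat a) s))
    ≡ multinomial (λ s → ν s ℤ.- patternContent₂ p s)
sum-matching-arrays {m = zero} p ν Σν =
  trans (ℚₚ.+-identityʳ (1ℚ * M)) (ℚₚ.*-identityˡ M)
  where M = multinomial (λ s → ν s ℤ.- 0ℤ)
sum-matching-arrays {k} {n} {suc m} {q} p ν Σν = begin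
  ∑ₗ (vectors (suc m) words) (λ a → ⟦ matches₂? p a ⟧ * multinomial (λ s → ν s ℤ.- content (concat a) s))
    ≡⟨ ∑ₗ-vectors-suc m words (λ a → ⟦ matches₂? p a ⟧ * multinomial (λ s → ν s ℤ.- content (concat a) s)) ⟩
  ∑ₗ words (λ v → ∑ₗ (vectors m words) (λ a →
      ⟦ matches₂? p (v ∷ a) ⟧ * multinomial (λ s → ν s ℤ.- content (v Vec.++ concat a) s)))
    ≡⟨ ∑ₗ-cong words (λ v → trans (∑ₗ-cong (vectors m words) (term v))
         (∑ₗ-*ˡ (vectors m words) ⟦ matches? (p zero) v ⟧ (rest v))) ⟩
  ∑ₗ words (λ v → ⟦ matches? (p zero) v ⟧ * ∑ₗ (vectors m words) (rest v))
    ≡⟨ ∑ₗ-cong words (λ v → cong (⟦ matches? (p zero) v ⟧ *_) (trans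
         (sum-matching-arrays (p ∘ suc) (λ s → ν s ℤ.- content v s) (Σν-v v))
         (multinomial-cong (λ s → swap (ν s) (content v s) (c s))))) ⟩
  ∑ₗ words (λ v → ⟦ matches? (p zero) v ⟧ * multinomial (λ s → ν s ℤ.- c s ℤ.- content v s))
    ≡⟨ sum-matching-words (p zero) (λ s → ν s ℤ.- c s) Σν-c ⟩
  multinomial (λ s → ν s ℤ.- c s ℤ.- patternContent (p zero) s)
    ≡⟨ multinomial-cong (λ s → assoc (ν s) (c s) (patternContent (p zero) s)) ⟩
  multinomial (λ s → ν s ℤ.- patternContent₂ p s) ∎
  where
  open ≡-Reasoning
  words = vectors k (List.allFin n)
  c = patternContent₂ (p ∘ suc)
  r = proj₁ (Σ-patternContent₂ (p ∘ suc))
  assoc : ∀ a b c → a ℤ.- b ℤ.- c ≡ a ℤ.- (c ℤ.+ b)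
  assoc = ℤ-Solver.solve-∀
  swap : ∀ a b c → a ℤ.- b ℤ.- c ≡ a ℤ.- c ℤ.- b
  swap = ℤ-Solver.solve-∀
  rest : Vec (Fin n) k → Vec (Vec (Fin n) k) m → ℚ
  rest v a = ⟦ matches₂? (p ∘ suc) a ⟧ * multinomial (λ s → ν s ℤ.- content v s ℤ.- content (concat a) s)
  term : ∀ v a → ⟦ matches₂? p (v ∷ a) ⟧ * multinomial (λ s → ν s ℤ.- content (v Vec.++ concat a) s)
       ≡ ⟦ matches? (p zero) v ⟧ * rest v a
  term v a = trans (cong₂ _*_
    (⟦⟧-× (matches? (p zero) v) (matches₂? (p ∘ suc) a))
    (multinomial-cong (λ s → trans (cong (λ z → ν s ℤ.- z) (content-++ v (concat a) s))
      (split (ν s) (content v s) (content (concat a) s)))))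
    (ℚₚ.*-assoc ⟦ matches? (p zero) v ⟧ ⟦ matches₂? (p ∘ suc) a ⟧
      (multinomial (λ s → ν s ℤ.- content v s ℤ.- content (concat a) s)))
    where
    split : ∀ a b c → a ℤ.- (b ℤ.+ c) ≡ a ℤ.- b ℤ.- c
    split = ℤ-Solver.solve-∀
  Σν-v : ∀ v → Σℤ.sum (λ s → ν s ℤ.- content v s) ≡ + (m ℕ.* k) ℤ.+ + q
  Σν-v v = trans (Σ-- ν (content v)) (trans (cong₂ ℤ._-_ Σν (Σ-content v)) (cancel (+ k) (+ (m ℕ.* k)) (+ q)))
    where
    cancel : ∀ a b c → a ℤ.+ b ℤ.+ c ℤ.- a ≡ b ℤ.+ c
    cancel = ℤ-Solver.solve-∀
  Σν-c : Σℤ.sum (λ s → ν s ℤ.- c s) ≡ + k ℤ.+ + (q ℕ.+ r)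
  Σν-c = trans (Σ-- ν c) (trans (cong₂ ℤ._-_ Σν (proj₂ (Σ-patternContent₂ (p ∘ suc))))
    (cancel (+ k) (+ (m ℕ.* k)) (+ q) (+ r)))
    where
    cancel : ∀ a b c d → a ℤ.+ b ℤ.+ c ℤ.- (b ℤ.- d) ≡ a ℤ.+ (c ℤ.+ d)
    cancel = ℤ-Solver.solve-∀

Σ-nonNeg : (ν : Fin n → ℤ) → (∀ s → 0ℤ ℤ.≤ ν s) → 0ℤ ℤ.≤ Σℤ.sum ν
Σ-nonNeg {zero}  ν 0≤ν = ℤₚ.≤-refl
Σ-nonNeg {suc n} ν 0≤ν = ℤₚ.+-mono-≤ (0≤ν zero) (Σ-nonNeg (ν ∘ suc) (0≤ν ∘ suc))

Σ≡0⇒≡0 : (ν : Fin n → ℤ) → (∀ s → 0ℤ ℤ.≤ ν s) → Σℤ.sum ν ≡ 0ℤ → ∀ s → ν s ≡ 0ℤ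
Σ≡0⇒≡0 {suc n} ν 0≤ν Σν s = ℤₚ.≤-antisym (bound s) (0≤ν s)
  where
  bound : ∀ s → ν s ℤ.≤ 0ℤ
  bound zero    = subst (ν zero ℤ.≤_) Σν (subst (ℤ._≤ Σℤ.sum ν) (ℤₚ.+-identityʳ (ν zero))
    (ℤₚ.+-monoʳ-≤ (ν zero) (Σ-nonNeg (ν ∘ suc) (0≤ν ∘ suc))))
  bound (suc s) = ℤₚ.≤-reflexive (Σ≡0⇒≡0 (ν ∘ suc) (0≤ν ∘ suc) Σ-tail s)
    where
    Σ-tail : Σℤ.sum (ν ∘ suc) ≡ 0ℤ
    Σ-tail = ℤₚ.≤-antisym
      (subst (Σℤ.sum (ν ∘ suc) ℤ.≤_) Σν (subst (ℤ._≤ Σℤ.sum ν) (ℤₚ.+-identityˡ (Σℤ.sum (ν ∘ suc)))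
        (ℤₚ.+-monoˡ-≤ (Σℤ.sum (ν ∘ suc)) (0≤ν zero))))
      (Σ-nonNeg (ν ∘ suc) (0≤ν ∘ suc))

recip-factorial-neg : ∀ z → ¬ 0ℤ ℤ.≤ z → 1/ z ! ≡ 0ℚ
recip-factorial-neg (+ k)    0≰z = contradiction (ℤ.+≤+ z≤n) 0≰z
recip-factorial-neg -[1+ k ] 0≰z = refl

multinomial-0 : (ν : Fin n → ℤ) → (∀ s → ν s ≡ 0ℤ) → multinomial ν ≡ 1ℚ
multinomial-0 {n} ν ν≡0 = begin
  multinomial ν                                    ≡⟨ multinomial-cong ν≡0 ⟩
  fromℕ (∣ Σℤ.sum {n} (λ _ → 0ℤ) ∣ !) * ∏ {n} (λ _ → 1ℚ)
    ≡⟨ cong₂ _*_ (cong (λ z → fromℕ (∣ z ∣ !)) (Σℤ.sum-replicate-zero n)) (∏-1 n) ⟩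
  1ℚ                                               ∎
  where
  open ≡-Reasoning
  ∏-1 : ∀ n → ∏ {n} (λ _ → 1ℚ) ≡ 1ℚ
  ∏-1 zero    = refl
  ∏-1 (suc n) = trans (ℚₚ.*-identityˡ _) (∏-1 n)

-- Nonnegative entries with sum 0 would all be 0, so some entry is negative and its reciprocal
-- factorial kills the product.
multinomial-vanishes : (ν : Fin n → ℤ) → Σℤ.sum ν ≡ 0ℤ → ¬ (∀ s → ν s ≡ 0ℤ) → multinomial ν ≡ 0ℚ
multinomial-vanishes {n} ν Σν ν≢0
  with Fin.¬∀⟶∃¬ n (λ s → 0ℤ ℤ.≤ ν s) (λ s → 0ℤ ℤₚ.≤? ν s) (λ 0≤ν → ν≢0 (Σ≡0⇒≡0 ν 0≤ν Σν))
... | s , 0≰νs = trans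
  (cong (fromℕ (∣ Σℤ.sum ν ∣ !) *_) (∏-zero (λ s → 1/ (ν s) !) s (recip-factorial-neg (ν s) 0≰νs)))
  (ℚₚ.*-zeroʳ (fromℕ (∣ Σℤ.sum ν ∣ !)))

equiSquare? : (a : Array n) → Dec (EquiSquare a)
equiSquare? {n} a = Fin.all? (λ k → count (Fin._≟ k) (concat a) ℕₚ.≟ n)

-- A full array leaves a supply of total 0. This rewrites the global condition on symbols as the
-- weight that `sum-matching-arrays` can sum, with q = 0.
⟦equiSquare⟧ : (a : Array n) → ⟦ equiSquare? a ⟧ ≡ multinomial (λ s → + n ℤ.- content (concat a) s)
⟦equiSquare⟧ {n} a = ⟦⟧-unique (equiSquare? a)
  (λ equi → multinomial-0 ν (λ s → ℤₚ.i≡j⇒i-j≡0 (cong +_ (sym (equi s)))))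
  (λ ¬equi → multinomial-vanishes ν Σν
    (λ ≡0 → ¬equi (λ s → ℤₚ.+-injective (sym (ℤₚ.i-j≡0⇒i≡j (+ n) (content (concat a) s) (≡0 s))))))
  where
  ν = λ s → + n ℤ.- content (concat a) s
  Σν : Σℤ.sum ν ≡ 0ℤ
  Σν = trans (Σ-- (λ _ → + n) (content (concat a)))
    (ℤₚ.i≡j⇒i-j≡0 (trans (Σ-const n (+ n)) (trans (sym (ℤₚ.pos-* n n)) (sym (Σ-content (concat a))))))

count-matching-equiSquares : (p : Fin n → Fin n → Maybe (Fin n)) →
  ∑ₗ (arrays n) (λ a → ⟦ equiSquare? a ⟧ * ⟦ matches₂? p a ⟧)
    ≡ multinomial (λ s → + n ℤ.- patternContent₂ p s)
count-matching-equiSquares {n} p = trans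
  (∑ₗ-cong (arrays n) (λ a → trans (cong (_* ⟦ matches₂? p a ⟧) (⟦equiSquare⟧ a)) (ℚₚ.*-comm (multinomial (λ s → + n ℤ.- content (concat a) s)) ⟦ matches₂? p a ⟧)))
  (sum-matching-arrays {q = 0} p (λ _ → + n)
    (trans (Σ-const n (+ n)) (trans (sym (ℤₚ.pos-* n n)) (sym (ℤₚ.+-identityʳ (+ (n ℕ.* n)))))))

-- Lines and the patterns they prescribe

data Direction : Set where
  ascending descending : Direction

entry : Direction → Fin n → Fin n
entry ascending  j = j
entry descending j = opposite j

entry-involutive : ∀ d (j : Fin n) → entry d (entry d j) ≡ j
entry-involutive ascending  j = refl
entry-involutive descending j = Fin.opposite-involutive j

RowIs ColIs : Array n → Fin n → Direction → Set
RowIs a i d = ∀ j → lookup (lookup a i) j ≡ entry d j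
ColIs a j d = ∀ i → lookup (lookup a i) j ≡ entry d i

rowIs? : (a : Array n) → ∀ i d → Dec (RowIs a i d)
rowIs? a i d = Fin.all? (λ j → lookup (lookup a i) j Fin.≟ entry d j)

colIs? : (a : Array n) → ∀ j d → Dec (ColIs a j d)
colIs? a j d = Fin.all? (λ i → lookup (lookup a i) j Fin.≟ entry d i)

-- A set of rows (or of columns), each with a direction.
Lines : ℕ → Set
Lines n = Fin n → Maybe Direction

Fits : (Fin n → Direction → Set) → Lines n → Set
Fits Q e = ∀ i → Maybe.All (Q i) (e i)

fits? : {Q : Fin n → Direction → Set} → (∀ i d → Dec (Q i d)) → ∀ e → Dec (Fits Q e)
fits? Q? e = Fin.all? (λ i → Maybe.dec (Q? i) (e i))

-- Where a row and a column cross, the entry of the row is recorded; for compatible lines the column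
-- prescribes the same symbol, so the choice does not matter.
lineCell : Maybe Direction → Maybe Direction → Fin n → Fin n → Maybe (Fin n)
lineCell (just d) _         i j = just (entry d j)
lineCell nothing  (just d′) i j = just (entry d′ i)
lineCell nothing  nothing   i j = nothing

linePattern : Lines n → Lines n → Fin n → Fin n → Maybe (Fin n)
linePattern e e′ i j = lineCell (e i) (e′ j) i j

CompatibleAt : Maybe Direction → Maybe Direction → Fin n → Fin n → Set
CompatibleAt m m′ i j = Maybe.All (λ d → Maybe.All (λ d′ → entry d j ≡ entry d′ i) m′) m

Compatible : Lines n → Lines n → Set
Compatible e e′ = ∀ i j → CompatibleAt (e i) (e′ j) i j

module _ {e e′ : Lines n} (compatible : Compatible e e′) (a : Array n) where

  matches⇒rows : Matches₂ (linePattern e e′) a → Fits (RowIs a) e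
  matches⇒rows matches i with e i | matches i
  ... | nothing | _  = Maybe.nothing
  ... | just d  | aᵢ = Maybe.just (λ j → Maybe.drop-just (aᵢ j))

  matches⇒cols : Matches₂ (linePattern e e′) a → Fits (ColIs a) e′
  matches⇒cols matches j with e′ j | (λ i → matches i j) | (λ i → compatible i j)
  ... | nothing | _  | _ = Maybe.nothing
  ... | just d′ | aⱼ | c = Maybe.just (λ i → cell i (e i) (aⱼ i) (c i))
    where
    cell : ∀ i m {x} → Agrees (lineCell m (just d′) i j) x → CompatibleAt m (just d′) i j → x ≡ entry d′ i
    cell i nothing  (Maybe.just x≡) _                         = x≡
    cell i (just d) (Maybe.just x≡) (Maybe.just (Maybe.just c)) = trans x≡ c

  rows∧cols⇒matches : Fits (RowIs a) e → Fits (ColIs a) e′ → Matches₂ (linePattern e e′) a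
  rows∧cols⇒matches rows cols i j = cell (e i) (e′ j) (rows i) (cols j)
    where
    cell : ∀ m m′ → Maybe.All (RowIs a i) m → Maybe.All (ColIs a j) m′ →
           Agrees (lineCell m m′ i j) (lookup (lookup a i) j)
    cell (just d) _         (Maybe.just row) _ = Maybe.just (row j)
    cell nothing  (just d′) _ (Maybe.just col) = Maybe.just (col i)
    cell nothing  nothing   _ _                = Maybe.nothing

  ⟦matches-lines⟧ : ⟦ matches₂? (linePattern e e′) a ⟧ ≡ ⟦ fits? (rowIs? a) e ⟧ * ⟦ fits? (colIs? a) e′ ⟧
  ⟦matches-lines⟧ = trans
    (⟦⟧-cong (mk⇔ (λ m → matches⇒rows m , matches⇒cols m) (λ (r , c) → rows∧cols⇒matches r c))
      (matches₂? (linePattern e e′) a) (fits? (rowIs? a) e ×-dec fits? (colIs? a) e′))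
    (⟦⟧-× (fits? (rowIs? a) e) (fits? (colIs? a) e′))

isLine : Maybe Direction → ℤ
isLine nothing  = 0ℤ
isLine (just _) = 1ℤ

lineCount : Lines n → ℤ
lineCount e = Σℤ.sum (λ i → isLine (e i))

lineContent : Maybe Direction → Fin n → Fin n → ℤ
lineContent nothing  j s = 0ℤ
lineContent (just d) j s = δ (entry d j) s

-- A cell on both a row and a column is counted by each of the two lines but uses up only one copy
-- of its symbol. This is the correction for the double count.
shared : Maybe Direction → Maybe Direction → Fin n → Fin n → ℤ
shared nothing  _        j s = 0ℤ
shared (just d) nothing  j s = 0ℤ
shared (just d) (just _) j s = δ (entry d j) s

overlaps : Lines n → Lines n → Fin n → ℤ
overlaps e e′ s = Σℤ.sum (λ i → Σℤ.sum (λ j → shared (e i) (e′ j) j s))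

cellContent-lineCell : ∀ m m′ (i j s : Fin n) → CompatibleAt m m′ i j →
  cellContent (lineCell m m′ i j) s ≡ lineContent m j s ℤ.+ lineContent m′ i s ℤ.- shared m m′ j s
cellContent-lineCell nothing  nothing   i j s _ = refl
cellContent-lineCell nothing  (just d′) i j s _ = identity (δ (entry d′ i) s)
  where
  identity : ∀ x → x ≡ 0ℤ ℤ.+ x ℤ.- 0ℤ
  identity = ℤ-Solver.solve-∀
cellContent-lineCell (just d) nothing   i j s _ = identity (δ (entry d j) s)
  where
  identity : ∀ x → x ≡ x ℤ.+ 0ℤ ℤ.- 0ℤ
  identity = ℤ-Solver.solve-∀
cellContent-lineCell (just d) (just d′) i j s (Maybe.just (Maybe.just c)) rewrite c = identity (δ (entry d′ i) s)
  where
  identity : ∀ x → x ≡ x ℤ.+ x ℤ.- x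
  identity = ℤ-Solver.solve-∀

-- A line contains each symbol exactly once, because `entry d` is an involution: the symbol s stands
-- at position `entry d s` and nowhere else.
Σ-lineContent : ∀ m (s : Fin n) → Σℤ.sum (λ j → lineContent m j s) ≡ isLine m
Σ-lineContent {n} nothing  s = Σℤ.sum-replicate-zero n
Σ-lineContent     (just d) s = trans
  (Σℤ.sum-cong-≗ (λ j → δℤ.⟦⟧-cong
    (mk⇔ (λ { refl → sym (entry-involutive d j) }) (λ { refl → entry-involutive d s }))
    (entry d j Fin.≟ s) (j Fin.≟ entry d s)))
  (δℤ.sum-δ₁ (entry d s))

linePattern-content : (e e′ : Lines n) → Compatible e e′ → ∀ s →
  patternContent₂ (linePattern e e′) s ≡ lineCount e ℤ.+ lineCount e′ ℤ.- overlaps e e′ s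
linePattern-content {n} e e′ compatible s = begin
  Σℤ.sum (λ i → Σℤ.sum (λ j → cellContent (linePattern e e′ i j) s))
    ≡⟨ Σℤ.sum-cong-≗ (λ i → Σℤ.sum-cong-≗ (λ j → cellContent-lineCell (e i) (e′ j) i j s (compatible i j))) ⟩
  Σℤ.sum (λ i → Σℤ.sum (λ j → r i j ℤ.+ c i j ℤ.- o i j))
    ≡⟨ Σℤ.sum-cong-≗ (λ i → trans (Σ-- (λ j → r i j ℤ.+ c i j) (o i))
         (cong (ℤ._- Σℤ.sum (o i)) (Σℤ.∑-distrib-+ (r i) (c i)))) ⟩
  Σℤ.sum (λ i → Σℤ.sum (r i) ℤ.+ Σℤ.sum (c i) ℤ.- Σℤ.sum (o i))
    ≡⟨ trans (Σ-- (λ i → Σℤ.sum (r i) ℤ.+ Σℤ.sum (c i)) (λ i → Σℤ.sum (o i)))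
         (cong (ℤ._- overlaps e e′ s) (Σℤ.∑-distrib-+ (λ i → Σℤ.sum (r i)) (λ i → Σℤ.sum (c i)))) ⟩
  Σℤ.sum (λ i → Σℤ.sum (r i)) ℤ.+ Σℤ.sum (λ i → Σℤ.sum (c i)) ℤ.- overlaps e e′ s
    ≡⟨ cong₂ (λ x y → x ℤ.+ y ℤ.- overlaps e e′ s)
         (Σℤ.sum-cong-≗ (λ i → Σ-lineContent (e i) s))
         (trans (Σℤ.∑-comm c) (Σℤ.sum-cong-≗ (λ j → Σ-lineContent (e′ j) s))) ⟩
  lineCount e ℤ.+ lineCount e′ ℤ.- overlaps e e′ s ∎
  where
  open ≡-Reasoning
  r c o : Fin n → Fin n → ℤ
  r i j = lineContent (e i) j s
  c i j = lineContent (e′ j) i s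
  o i j = shared (e i) (e′ j) j s

count-lines : (e e′ : Lines n) → Compatible e e′ →
  ∑ₗ (arrays n) (λ a → ⟦ equiSquare? a ⟧ * (⟦ fits? (rowIs? a) e ⟧ * ⟦ fits? (colIs? a) e′ ⟧))
    ≡ multinomial (λ s → + n ℤ.- (lineCount e ℤ.+ lineCount e′ ℤ.- overlaps e e′ s))
count-lines {n} e e′ compatible = trans
  (∑ₗ-cong (arrays n) (λ a → cong (⟦ equiSquare? a ⟧ *_) (sym (⟦matches-lines⟧ compatible a))))
  (trans (count-matching-equiSquares (linePattern e e′))
    (multinomial-cong (λ s → cong (λ z → + n ℤ.- z) (linePattern-content e e′ compatible s))))

-- Single lines and mirror pairs

noLines : Lines n
noLines _ = nothing

singleLine : Fin n → Direction → Lines n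
singleLine m d i = if does (i Fin.≟ m) then just d else nothing

-- The two lines of one kind that can cross the same lines of the other kind. If m is its own mirror
-- image only the ascending line remains, so the evaluations below assume `m ≢ opposite m`.
mirrorLines : Fin n → Lines n
mirrorLines m i =
  if does (i Fin.≟ m) then just ascending
  else if does (i Fin.≟ opposite m) then just descending else nothing

-- One evaluation for every additive statistic h of a set of lines. It is instantiated with `isLine`
-- for the number of lines, with `shared` for the crossings along one line, and with `lineOverlaps`
-- for all crossings.
module _ (h : Fin n → Maybe Direction → ℤ) (h-nothing : ∀ i → h i nothing ≡ 0ℤ) where

  Σ-singleLine : ∀ m d → Σℤ.sum (λ i → h i (singleLine m d i)) ≡ h m (just d)
  Σ-singleLine m d = trans (Σℤ.sum-cong-≗ term) (δℤ.sum-δ m (λ i → h i (just d)))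
    where
    term : ∀ i → h i (singleLine m d i) ≡ δℤ.⟦ i Fin.≟ m ⟧ ℤ.* h i (just d)
    term i with does (i Fin.≟ m)
    ... | true  = sym (ℤₚ.*-identityˡ (h i (just d)))
    ... | false = h-nothing i

  Σ-mirrorLines : ∀ m → m ≢ opposite m →
    Σℤ.sum (λ i → h i (mirrorLines m i)) ≡ h m (just ascending) ℤ.+ h (opposite m) (just descending)
  Σ-mirrorLines m m≢m′ = trans (Σℤ.sum-cong-≗ term)
    (trans (Σℤ.∑-distrib-+ (λ i → δℤ.⟦ i Fin.≟ m ⟧ ℤ.* h i (just ascending)) _)
      (cong₂ ℤ._+_ (δℤ.sum-δ m (λ i → h i (just ascending))) (δℤ.sum-δ (opposite m) (λ i → h i (just descending)))))
    where
    term : ∀ i → h i (mirrorLines m i) ≡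
      δℤ.⟦ i Fin.≟ m ⟧ ℤ.* h i (just ascending) ℤ.+ δℤ.⟦ i Fin.≟ opposite m ⟧ ℤ.* h i (just descending)
    term i with i Fin.≟ m | i Fin.≟ opposite m
    ... | yes i≡m | yes i≡m′ = contradiction (trans (sym i≡m) i≡m′) m≢m′
    ... | yes _   | no _     = identity (h i (just ascending)) (h i (just descending))
      where
      identity : ∀ x y → x ≡ 1ℤ ℤ.* x ℤ.+ 0ℤ ℤ.* y
      identity = ℤ-Solver.solve-∀
    ... | no _    | yes _    = identity (h i (just ascending)) (h i (just descending))
      where
      identity : ∀ x y → y ≡ 0ℤ ℤ.* x ℤ.+ 1ℤ ℤ.* y
      identity = ℤ-Solver.solve-∀
    ... | no _    | no _     = h-nothing i

lineCount-singleLine : (m : Fin n) (d : Direction) → lineCount (singleLine m d) ≡ 1ℤ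
lineCount-singleLine = Σ-singleLine (λ _ → isLine) (λ _ → refl)

lineCount-mirrorLines : (m : Fin n) → m ≢ opposite m → lineCount (mirrorLines m) ≡ + 2
lineCount-mirrorLines = Σ-mirrorLines (λ _ → isLine) (λ _ → refl)

shared-nothing : ∀ m (j s : Fin n) → shared m nothing j s ≡ 0ℤ
shared-nothing nothing  j s = refl
shared-nothing (just d) j s = refl

lineOverlaps : Maybe Direction → Lines n → Fin n → ℤ
lineOverlaps m e′ s = Σℤ.sum (λ j → shared m (e′ j) j s)

lineOverlaps-nothing : (e′ : Lines n) → ∀ s → lineOverlaps nothing e′ s ≡ 0ℤ
lineOverlaps-nothing {n} e′ s = Σℤ.sum-replicate-zero n

lineOverlaps-single : ∀ m (j : Fin n) d′ s → lineOverlaps m (singleLine j d′) s ≡ shared m (just d′) j s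
lineOverlaps-single m j d′ s = Σ-singleLine (λ j m′ → shared m m′ j s) (λ j → shared-nothing m j s) j d′

lineOverlaps-mirror : ∀ m (j : Fin n) → j ≢ opposite j → ∀ s →
  lineOverlaps m (mirrorLines j) s ≡ shared m (just ascending) j s ℤ.+ shared m (just descending) (opposite j) s
lineOverlaps-mirror m j j≢j′ s = Σ-mirrorLines (λ j m′ → shared m m′ j s) (λ j → shared-nothing m j s) j j≢j′

overlaps-single : (i : Fin n) (d : Direction) (e′ : Lines n) → ∀ s →
  overlaps (singleLine i d) e′ s ≡ lineOverlaps (just d) e′ s
overlaps-single i d e′ s = Σ-singleLine (λ _ m → lineOverlaps m e′ s) (λ _ → lineOverlaps-nothing e′ s) i d

overlaps-mirror : (i : Fin n) → i ≢ opposite i → (e′ : Lines n) → ∀ s →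
  overlaps (mirrorLines i) e′ s ≡ lineOverlaps (just ascending) e′ s ℤ.+ lineOverlaps (just descending) e′ s
overlaps-mirror i i≢i′ e′ s = Σ-mirrorLines (λ _ m → lineOverlaps m e′ s) (λ _ → lineOverlaps-nothing e′ s) i i≢i′

module _ {Q : Fin n → Direction → Set} where

  fits-single : ∀ {m d} → Q m d → Fits Q (singleLine m d)
  fits-single {m} q i with i Fin.≟ m
  ... | yes refl = Maybe.just q
  ... | no _     = Maybe.nothing

  fits-mirror : ∀ {m} → Q m ascending → Q (opposite m) descending → Fits Q (mirrorLines m)
  fits-mirror {m} q q′ i with i Fin.≟ m | i Fin.≟ opposite m
  ... | yes refl | _        = Maybe.just q
  ... | no _     | yes refl = Maybe.just q′
  ... | no _     | no _     = Maybe.nothing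

  single-fits : ∀ {m d} → Fits Q (singleLine m d) → Q m d
  single-fits {m} fits with m Fin.≟ m | fits m
  ... | yes _  | Maybe.just q = q
  ... | no m≢m | _            = contradiction refl m≢m

  mirror-fits : ∀ {m} → m ≢ opposite m → Fits Q (mirrorLines m) → Q m ascending × Q (opposite m) descending
  mirror-fits {m} m≢m′ fits = asc , desc
    where
    asc : Q m ascending
    asc with m Fin.≟ m | fits m
    ... | yes _  | Maybe.just q = q
    ... | no m≢m | _            = contradiction refl m≢m
    desc : Q (opposite m) descending
    desc with opposite m Fin.≟ m | opposite m Fin.≟ opposite m | fits (opposite m)
    ... | yes m′≡m | _         | _            = contradiction (sym m′≡m) m≢m′
    ... | no _     | yes _     | Maybe.just q = q
    ... | no _     | no m′≢m′  | _            = contradiction refl m′≢m′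

  ⟦fits-single⟧ : (Q? : ∀ i d → Dec (Q i d)) → ∀ m d → ⟦ fits? Q? (singleLine m d) ⟧ ≡ ⟦ Q? m d ⟧
  ⟦fits-single⟧ Q? m d = ⟦⟧-cong (mk⇔ single-fits fits-single) (fits? Q? (singleLine m d)) (Q? m d)

  ⟦fits-mirror⟧ : (Q? : ∀ i d → Dec (Q i d)) → ∀ m → m ≢ opposite m →
    ⟦ fits? Q? (mirrorLines m) ⟧ ≡ ⟦ Q? m ascending ⟧ * ⟦ Q? (opposite m) descending ⟧
  ⟦fits-mirror⟧ Q? m m≢m′ = trans
    (⟦⟧-cong (mk⇔ (mirror-fits m≢m′) (λ (q , q′) → fits-mirror q q′))
      (fits? Q? (mirrorLines m)) (Q? m ascending ×-dec Q? (opposite m) descending))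
    (⟦⟧-× (Q? m ascending) (Q? (opposite m) descending))

-- Equi-squares containing given lines

equiSum : (Array n → ℚ) → ℚ
equiSum {n} f = ∑ₗ (arrays n) (λ a → ⟦ equiSquare? a ⟧ * f a)

equiSum-cong : {f g : Array n → ℚ} → (∀ a → f a ≡ g a) → equiSum f ≡ equiSum g
equiSum-cong {n} f≗g = ∑ₗ-cong (arrays n) (λ a → cong (⟦ equiSquare? a ⟧ *_) (f≗g a))

equiSum-+ : (f g : Array n → ℚ) → equiSum (λ a → f a + g a) ≡ equiSum f + equiSum g
equiSum-+ {n} f g = trans
  (∑ₗ-cong (arrays n) (λ a → ℚₚ.*-distribˡ-+ ⟦ equiSquare? a ⟧ (f a) (g a)))
  (∑ₗ-+ (arrays n) (λ a → ⟦ equiSquare? a ⟧ * f a) (λ a → ⟦ equiSquare? a ⟧ * g a))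

equiSum-*ˡ : (c : ℚ) (f : Array n → ℚ) → equiSum (λ a → c * f a) ≡ c * equiSum f
equiSum-*ˡ {n} c f = trans
  (∑ₗ-cong (arrays n) (λ a → swap ⟦ equiSquare? a ⟧ c (f a)))
  (∑ₗ-*ˡ (arrays n) c (λ a → ⟦ equiSquare? a ⟧ * f a))
  where
  swap : ∀ a b c → a * (b * c) ≡ b * (a * c)
  swap = solve-∀ ℚ-ring

equiSum-- : (f g : Array n → ℚ) → equiSum (λ a → f a - g a) ≡ equiSum f - equiSum g
equiSum-- {n} f g = trans
  (∑ₗ-cong (arrays n) (λ a → distrib ⟦ equiSquare? a ⟧ (f a) (g a)))
  (∑ₗ-- (arrays n) (λ a → ⟦ equiSquare? a ⟧ * f a) (λ a → ⟦ equiSquare? a ⟧ * g a))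
  where
  distrib : ∀ a b c → a * (b - c) ≡ a * b - a * c
  distrib = solve-∀ ℚ-ring

equiSum-0 : equiSum {n} (λ _ → 0ℚ) ≡ 0ℚ
equiSum-0 {n} = trans (∑ₗ-cong (arrays n) (λ a → ℚₚ.*-zeroʳ ⟦ equiSquare? a ⟧)) (∑ₗ-0 (arrays n))

equiSum-∑ₗ : (xs : List A) (f : A → Array n → ℚ) →
             equiSum (λ a → ∑ₗ xs (λ x → f x a)) ≡ ∑ₗ xs (λ x → equiSum (f x))
equiSum-∑ₗ {n = n} xs f = trans
  (∑ₗ-cong (arrays n) (λ a → sym (∑ₗ-*ˡ xs ⟦ equiSquare? a ⟧ (λ x → f x a))))
  (∑ₗ-comm (arrays n) xs (λ a x → ⟦ equiSquare? a ⟧ * f x a))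

⟦⟧-nonNeg : {P : Set} (p? : Dec P) → ℚ.NonNegative ⟦ p? ⟧
⟦⟧-nonNeg p? with does p?
... | true  = _
... | false = _

equiSum-mono : {f g : Array n → ℚ} → (∀ a → f a ℚ.≤ g a) → equiSum f ℚ.≤ equiSum g
equiSum-mono {n} f≤g = ∑ₗ-mono (arrays n)
  (λ a → ℚₚ.*-monoˡ-≤-nonNeg ⟦ equiSquare? a ⟧ {{⟦⟧-nonNeg (equiSquare? a)}} (f≤g a))

-- Closed forms of the multinomial coefficients

∣m-n∣≡m∸n : ∀ {a b} → b ℕ.≤ a → ∣ + a ℤ.- + b ∣ ≡ a ℕ.∸ b
∣m-n∣≡m∸n {a} {b} b≤a = cong ∣_∣ (trans (ℤₚ.m-n≡m⊖n a b) (ℤₚ.⊖-≥ b≤a))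

∏-one-off : {f : Fin n → ℚ} {x y : ℚ} (t : Fin n) → f t ≡ x →
            (∀ s → t ≢ s → f s ≡ y) → ∏ f ≡ x * y ^ (n ℕ.∸ 1)
∏-one-off {suc n} {f} {x} {y} t ft f≗y = trans (∏-remove {i = t} f)
  (cong₂ _*_ ft (trans (∏-cong (λ s → f≗y (punchIn t s) (Fin.punchInᵢ≢i t s ∘ sym))) (∏-const n y)))

∏-two-off : {f : Fin n → ℚ} {x y : ℚ} (t t′ : Fin n) → t ≢ t′ → f t ≡ x → f t′ ≡ x →
            (∀ s → t ≢ s → t′ ≢ s → f s ≡ y) → ∏ f ≡ x ^ 2 * y ^ (n ℕ.∸ 2)
∏-two-off {suc n} {f} {x} {y} t t′ t≢t′ ft ft′ f≗y = begin
  ∏ f                         ≡⟨ ∏-remove {i = t} f ⟩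
  f t * ∏ (f ∘ punchIn t)     ≡⟨ cong₂ _*_ ft (∏-one-off {x = x} {y} (punchOut t≢t′)
                                   (trans (cong f (Fin.punchIn-punchOut t≢t′)) ft′)
                                   (λ s u≢s → f≗y (punchIn t s) (Fin.punchInᵢ≢i t s ∘ sym) (u≢s ∘ punchOut-unique s))) ⟩
  x * (x * y ^ (n ℕ.∸ 1))     ≡⟨ regroup x (y ^ (n ℕ.∸ 1)) ⟩
  x ^ 2 * y ^ (n ℕ.∸ 1)       ∎
  where
  open ≡-Reasoning
  regroup : ∀ a b → a * (a * b) ≡ (a * (a * 1ℚ)) * b
  regroup = solve-∀ ℚ-ring
  punchOut-unique : ∀ s → t′ ≡ punchIn t s → punchOut t≢t′ ≡ s
  punchOut-unique s refl = Fin.punchOut-punchIn t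

-- The supply is computed in ℤ, whereas the formula to be proved has truncated subtraction inside
-- its factorials; `b ≤ a` is what makes the two agree.
multinomial≡ : ∀ {z} {x : ℚ} a b (ν : Fin n → ℤ) → z ≡ + a ℤ.- + b → b ℕ.≤ a →
  Σℤ.sum ν ≡ z → ∏ (λ s → 1/ (ν s) !) ≡ x → multinomial ν ≡ fromℕ ((a ℕ.∸ b) !) * x
multinomial≡ a b ν z≡ b≤a Σν ∏≡ =
  cong₂ _*_ (cong (λ k → fromℕ (k !)) (trans (cong ∣_∣ (trans Σν z≡)) (∣m-n∣≡m∸n b≤a))) ∏≡

rowCount : ℕ → ℕ → ℚ
rowCount n i = fromℕ ((n ℕ.* n ℕ.∸ i ℕ.* n) !) * 1/ (+ n ℤ.- + i) ! ^ n

-- The subscripts are the numbers of lines of the two kinds, in either order. There are 1, 2 and 4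
-- crossing cells respectively, whence the summands 1, 2 and 4. One symbol is shared in the first
-- case and two in the others; in the last case each of the two occupies two crossing cells, so that
-- n - 2 copies of it remain.
crossCount₁₁ crossCount₁₂ crossCount₂₂ : ℕ → ℚ
crossCount₁₁ n = fromℕ ((n ℕ.* n ℕ.+ 1 ℕ.∸ 2 ℕ.* n) !) * (1/ (+ n ℤ.- + 1) ! * 1/ (+ n ℤ.- + 2) ! ^ (n ℕ.∸ 1))
crossCount₁₂ n = fromℕ ((n ℕ.* n ℕ.+ 2 ℕ.∸ 3 ℕ.* n) !) * (1/ (+ n ℤ.- + 2) ! ^ 2 * 1/ (+ n ℤ.- + 3) ! ^ (n ℕ.∸ 2))
crossCount₂₂ n = fromℕ ((n ℕ.* n ℕ.+ 4 ℕ.∸ 4 ℕ.* n) !) * (1/ (+ n ℤ.- + 2) ! ^ 2 * 1/ (+ n ℤ.- + 4) ! ^ (n ℕ.∸ 2))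

multinomial-rows : ∀ {n i} → i ℕ.≤ n → multinomial {n} (λ _ → + n ℤ.- + i) ≡ rowCount n i
multinomial-rows {n} {i} i≤n = multinomial≡ {n} {x = 1/ (+ n ℤ.- + i) ! ^ n} (n ℕ.* n) (i ℕ.* n) (λ _ → + n ℤ.- + i)
  (trans (distrib (+ n) (+ i)) (cong₂ ℤ._-_ (sym (ℤₚ.pos-* n n)) (sym (ℤₚ.pos-* i n))))
  (ℕₚ.*-monoˡ-≤ n i≤n)
  (Σ-const n (+ n ℤ.- + i))
  (∏-const n (1/ (+ n ℤ.- + i) !))
  where
  distrib : ∀ a b → a ℤ.* (a ℤ.- b) ≡ a ℤ.* a ℤ.- b ℤ.* a
  distrib = ℤ-Solver.solve-∀

Σ-linear : ∀ n c (o : Fin n → ℤ) →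
  Σℤ.sum (λ s → + n ℤ.- (c ℤ.- o s)) ≡ + n ℤ.* + n ℤ.- (+ n ℤ.* c ℤ.- Σℤ.sum o)
Σ-linear n c o = trans (Σ-- (λ _ → + n) (λ s → c ℤ.- o s))
  (cong₂ ℤ._-_ (Σ-const n (+ n)) (trans (Σ-- (λ _ → c) o) (cong (ℤ._- Σℤ.sum o) (Σ-const n c))))

Σ-linear-ℕ : ∀ n c k {o : Fin n → ℤ} → Σℤ.sum o ≡ + k →
  + n ℤ.* + n ℤ.- (+ n ℤ.* + c ℤ.- Σℤ.sum o) ≡ + (n ℕ.* n ℕ.+ k) ℤ.- + (c ℕ.* n)
Σ-linear-ℕ n c k Σo rewrite Σo = trans (regroup (+ n) (+ c) (+ k))
  (cong₂ (λ x y → x ℤ.+ + k ℤ.- y) (sym (ℤₚ.pos-* n n)) (sym (ℤₚ.pos-* c n)))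
  where
  regroup : ∀ a b d → a ℤ.* a ℤ.- (a ℤ.* b ℤ.- d) ≡ a ℤ.* a ℤ.+ d ℤ.- b ℤ.* a
  regroup = ℤ-Solver.solve-∀

Σ-δδ : (t t′ : Fin n) → Σℤ.sum (λ s → δ t s ℤ.+ δ t′ s) ≡ + 2
Σ-δδ t t′ = trans (Σℤ.∑-distrib-+ (δ t) (δ t′)) (cong₂ ℤ._+_ (Σ-δ t) (Σ-δ t′))

m≡n+o⇒n≤m : ∀ {a b} c → a ≡ b ℕ.+ c → b ℕ.≤ a
m≡n+o⇒n≤m {b = b} c refl = ℕₚ.m≤m+n b c

-- In this and the next two inequalities the difference of the sides is (n-1)², (n-1)(n-2) and
-- (n-2)²: the numbers of cells left empty by the three kinds of crossings.
2n≤n²+1 : ∀ n → 2 ℕ.* n ℕ.≤ n ℕ.* n ℕ.+ 1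
2n≤n²+1 zero    = z≤n
2n≤n²+1 (suc m) = m≡n+o⇒n≤m (m ℕ.* m) (identity m)
  where
  identity : ∀ m → suc m ℕ.* suc m ℕ.+ 1 ≡ 2 ℕ.* suc m ℕ.+ m ℕ.* m
  identity = ℕ-Solver.solve-∀

3n≤n²+2 : ∀ n → 3 ℕ.* n ℕ.≤ n ℕ.* n ℕ.+ 2
3n≤n²+2 zero          = z≤n
3n≤n²+2 (suc zero)    = ℕₚ.≤-refl
3n≤n²+2 (suc (suc m)) = m≡n+o⇒n≤m (m ℕ.* m ℕ.+ m) (identity m)
  where
  identity : ∀ m → (2 ℕ.+ m) ℕ.* (2 ℕ.+ m) ℕ.+ 2 ≡ 3 ℕ.* (2 ℕ.+ m) ℕ.+ (m ℕ.* m ℕ.+ m)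
  identity = ℕ-Solver.solve-∀

4n≤n²+4 : ∀ n → 4 ℕ.* n ℕ.≤ n ℕ.* n ℕ.+ 4
4n≤n²+4 zero          = z≤n
4n≤n²+4 (suc zero)    = ℕₚ.n≤1+n 4
4n≤n²+4 (suc (suc m)) = m≡n+o⇒n≤m (m ℕ.* m) (identity m)
  where
  identity : ∀ m → (2 ℕ.+ m) ℕ.* (2 ℕ.+ m) ℕ.+ 4 ≡ 4 ℕ.* (2 ℕ.+ m) ℕ.+ m ℕ.* m
  identity = ℕ-Solver.solve-∀

-- With c lines, a symbol has n - (c - o) occurrences left, where
-- o counts its occurrences in cells shared by a row and a column.
module _ {n : ℕ} where

  private
    recip : (c o : ℤ) → ℚ
    recip c o = 1/ (+ n ℤ.- (c ℤ.- o)) !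

    recip-cong : ∀ c {o o′} → o ≡ o′ → recip c o ≡ recip c o′
    recip-cong c = cong (recip c)

  multinomial₁₁ : (t : Fin n) → multinomial (λ s → + n ℤ.- (+ 2 ℤ.- δ t s)) ≡ crossCount₁₁ n
  multinomial₁₁ t = multinomial≡ (n ℕ.* n ℕ.+ 1) (2 ℕ.* n) (λ s → + n ℤ.- (+ 2 ℤ.- δ t s))
    (Σ-linear-ℕ n 2 1 (Σ-δ t)) (2n≤n²+1 n) (Σ-linear n (+ 2) (δ t))
    (∏-one-off t (recip-cong (+ 2) (δ-refl t)) (λ s t≢s → recip-cong (+ 2) (δ-≢ t≢s)))

  multinomial₁₂ : (t t′ : Fin n) → t ≢ t′ →
    multinomial (λ s → + n ℤ.- (+ 3 ℤ.- (δ t s ℤ.+ δ t′ s))) ≡ crossCount₁₂ n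
  multinomial₁₂ t t′ t≢t′ = multinomial≡ (n ℕ.* n ℕ.+ 2) (3 ℕ.* n) (λ s → + n ℤ.- (+ 3 ℤ.- o s))
    (Σ-linear-ℕ n 3 2 (Σ-δδ t t′)) (3n≤n²+2 n) (Σ-linear n (+ 3) o)
    (∏-two-off t t′ t≢t′
      (recip-cong (+ 3) (cong₂ ℤ._+_ (δ-refl t) (δ-≢ (t≢t′ ∘ sym))))
      (recip-cong (+ 3) (cong₂ ℤ._+_ (δ-≢ t≢t′) (δ-refl t′)))
      (λ s t≢s t′≢s → recip-cong (+ 3) (cong₂ ℤ._+_ (δ-≢ t≢s) (δ-≢ t′≢s))))
    where
    o : Fin n → ℤ
    o s = δ t s ℤ.+ δ t′ s

  multinomial₂₂ : (t t′ : Fin n) → t ≢ t′ →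
    multinomial (λ s → + n ℤ.- (+ 4 ℤ.- (δ t s ℤ.+ δ t′ s ℤ.+ (δ t s ℤ.+ δ t′ s)))) ≡ crossCount₂₂ n
  multinomial₂₂ t t′ t≢t′ = multinomial≡ (n ℕ.* n ℕ.+ 4) (4 ℕ.* n) (λ s → + n ℤ.- (+ 4 ℤ.- (o s ℤ.+ o s)))
    (Σ-linear-ℕ n 4 4 {λ s → o s ℤ.+ o s} (trans (Σℤ.∑-distrib-+ o o) (cong₂ ℤ._+_ (Σ-δδ t t′) (Σ-δδ t t′))))
    (4n≤n²+4 n) (Σ-linear n (+ 4) (λ s → o s ℤ.+ o s))
    (∏-two-off t t′ t≢t′
      (recip-cong (+ 4) (cong (λ x → x ℤ.+ x) (cong₂ ℤ._+_ (δ-refl t) (δ-≢ (t≢t′ ∘ sym)))))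
      (recip-cong (+ 4) (cong (λ x → x ℤ.+ x) (cong₂ ℤ._+_ (δ-≢ t≢t′) (δ-refl t′))))
      (λ s t≢s t′≢s → recip-cong (+ 4) (cong (λ x → x ℤ.+ x) (cong₂ ℤ._+_ (δ-≢ t≢s) (δ-≢ t′≢s)))))
    where
    o : Fin n → ℤ
    o s = δ t s ℤ.+ δ t′ s

-- Compatibility as two nested uses of `Fits`, so that `fits-single` and `fits-mirror` reduce it to
-- one equation per crossing cell.
compatible : {e e′ : Lines n} → Fits (λ i d → Fits (λ j d′ → entry d j ≡ entry d′ i) e′) e → Compatible e e′
compatible fits i j = Maybe.map (λ f → f j) (fits i)

⟦fits-noLines⟧ : {Q : Fin n → Direction → Set} (Q? : ∀ i d → Dec (Q i d)) → ⟦ fits? Q? noLines ⟧ ≡ 1ℚ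
⟦fits-noLines⟧ Q? = ⟦⟧-true (fits? Q? noLines) (λ i → Maybe.nothing)

lineCount-noLines : ∀ n → lineCount {n} noLines ≡ 0ℤ
lineCount-noLines = Σℤ.sum-replicate-zero

module _ {n : ℕ} where

  equiSum-rows : (e : Lines n) {i : ℕ} → lineCount e ≡ + i → i ℕ.≤ n →
    equiSum (λ a → ⟦ fits? (rowIs? a) e ⟧) ≡ rowCount n i
  equiSum-rows e {i} lines i≤n = begin
    equiSum (λ a → ⟦ fits? (rowIs? a) e ⟧)
      ≡⟨ equiSum-cong (λ a → trans (sym (ℚₚ.*-identityʳ ⟦ fits? (rowIs? a) e ⟧))
           (cong (⟦ fits? (rowIs? a) e ⟧ *_) (sym (⟦fits-noLines⟧ (colIs? a))))) ⟩
    equiSum (λ a → ⟦ fits? (rowIs? a) e ⟧ * ⟦ fits? (colIs? a) noLines ⟧)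
      ≡⟨ count-lines e noLines (compatible (λ i → Maybe.universal (λ d j → Maybe.nothing) (e i))) ⟩
    multinomial (λ s → + n ℤ.- (lineCount e ℤ.+ lineCount {n} noLines ℤ.- overlaps e noLines s))
      ≡⟨ multinomial-cong {n = n} (λ s → cong (λ z → + n ℤ.- z)
           (trans (cong₂ (λ x y → x ℤ.- y)
             (trans (cong₂ ℤ._+_ lines (lineCount-noLines n)) (ℤₚ.+-identityʳ (+ i)))
             (Σ-zero {n} (λ i → lineOverlaps (e i) noLines s)
               (λ i → Σ-zero {n} (λ j → shared (e i) nothing j s) (λ j → shared-nothing (e i) j s))))
             (ℤₚ.+-identityʳ (+ i)))) ⟩
    multinomial {n} (λ s → + n ℤ.- + i)
      ≡⟨ multinomial-rows {n} {i} i≤n ⟩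
    rowCount n i ∎
    where open ≡-Reasoning

  equiSum-cols : (e : Lines n) {i : ℕ} → lineCount e ≡ + i → i ℕ.≤ n →
    equiSum (λ a → ⟦ fits? (colIs? a) e ⟧) ≡ rowCount n i
  equiSum-cols e {i} lines i≤n = begin
    equiSum (λ a → ⟦ fits? (colIs? a) e ⟧)
      ≡⟨ equiSum-cong (λ a → trans (sym (ℚₚ.*-identityˡ ⟦ fits? (colIs? a) e ⟧))
           (cong (_* ⟦ fits? (colIs? a) e ⟧) (sym (⟦fits-noLines⟧ (rowIs? a))))) ⟩
    equiSum (λ a → ⟦ fits? (rowIs? a) noLines ⟧ * ⟦ fits? (colIs? a) e ⟧)
      ≡⟨ count-lines noLines e (λ i j → Maybe.nothing) ⟩
    multinomial (λ s → + n ℤ.- (lineCount {n} noLines ℤ.+ lineCount e ℤ.- overlaps noLines e s))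
      ≡⟨ multinomial-cong {n = n} (λ s → cong (λ z → + n ℤ.- z)
           (trans (cong₂ (λ x y → x ℤ.- y)
             (trans (cong₂ ℤ._+_ (lineCount-noLines n) lines) (ℤₚ.+-identityˡ (+ i)))
             (Σ-zero {n} (λ _ → lineOverlaps nothing e s) (λ _ → lineOverlaps-nothing e s)))
             (ℤₚ.+-identityʳ (+ i)))) ⟩
    multinomial {n} (λ s → + n ℤ.- + i)
      ≡⟨ multinomial-rows {n} {i} i≤n ⟩
    rowCount n i ∎
    where open ≡-Reasoning

  equiSum₁₁ : ∀ i d j d′ → entry d j ≡ entry d′ i →
    equiSum {n} (λ a → ⟦ rowIs? a i d ⟧ * ⟦ colIs? a j d′ ⟧) ≡ crossCount₁₁ n
  equiSum₁₁ i d j d′ c = begin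
    equiSum (λ a → ⟦ rowIs? a i d ⟧ * ⟦ colIs? a j d′ ⟧)
      ≡⟨ equiSum-cong (λ a → cong₂ _*_ (⟦fits-single⟧ (rowIs? a) i d) (⟦fits-single⟧ (colIs? a) j d′)) ⟨
    equiSum (λ a → ⟦ fits? (rowIs? a) e ⟧ * ⟦ fits? (colIs? a) e′ ⟧)
      ≡⟨ count-lines e e′ (compatible (fits-single (fits-single c))) ⟩
    multinomial (λ s → + n ℤ.- (lineCount e ℤ.+ lineCount e′ ℤ.- overlaps e e′ s))
      ≡⟨ multinomial-cong (λ s → cong (λ z → + n ℤ.- z) (cong₂ ℤ._-_
           (cong₂ ℤ._+_ (lineCount-singleLine i d) (lineCount-singleLine j d′))
           (trans (overlaps-single i d e′ s) (lineOverlaps-single (just d) j d′ s)))) ⟩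
    multinomial (λ s → + n ℤ.- (+ 2 ℤ.- δ (entry d j) s))
      ≡⟨ multinomial₁₁ (entry d j) ⟩
    crossCount₁₁ n ∎
    where
    open ≡-Reasoning
    e  = singleLine i d
    e′ = singleLine j d′

  -- The column meets the ascending row in the symbol j and the descending row in `opposite j`; the
  -- last two hypotheses say that the column prescribes the same. As these symbols differ, each of
  -- them is shared once.
  equiSum₂₁ : ∀ m j d′ → m ≢ opposite m → j ≢ opposite j →
    j ≡ entry d′ m → opposite j ≡ entry d′ (opposite m) →
    equiSum {n} (λ a → ⟦ rowIs? a m ascending ⟧ * ⟦ rowIs? a (opposite m) descending ⟧ * ⟦ colIs? a j d′ ⟧)
      ≡ crossCount₁₂ n
  equiSum₂₁ m j d′ m≢m′ j≢j′ c c′ = begin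
    equiSum (λ a → ⟦ rowIs? a m ascending ⟧ * ⟦ rowIs? a (opposite m) descending ⟧ * ⟦ colIs? a j d′ ⟧)
      ≡⟨ equiSum-cong (λ a → cong₂ _*_ (⟦fits-mirror⟧ (rowIs? a) m m≢m′) (⟦fits-single⟧ (colIs? a) j d′)) ⟨
    equiSum (λ a → ⟦ fits? (rowIs? a) e ⟧ * ⟦ fits? (colIs? a) e′ ⟧)
      ≡⟨ count-lines e e′ (compatible (fits-mirror (fits-single c) (fits-single c′))) ⟩
    multinomial (λ s → + n ℤ.- (lineCount e ℤ.+ lineCount e′ ℤ.- overlaps e e′ s))
      ≡⟨ multinomial-cong (λ s → cong (λ z → + n ℤ.- z) (cong₂ ℤ._-_
           (cong₂ ℤ._+_ (lineCount-mirrorLines m m≢m′) (lineCount-singleLine j d′))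
           (trans (overlaps-mirror m m≢m′ e′ s)
             (cong₂ ℤ._+_ (lineOverlaps-single (just ascending) j d′ s) (lineOverlaps-single (just descending) j d′ s))))) ⟩
    multinomial (λ s → + n ℤ.- (+ 3 ℤ.- (δ j s ℤ.+ δ (opposite j) s)))
      ≡⟨ multinomial₁₂ j (opposite j) j≢j′ ⟩
    crossCount₁₂ n ∎
    where
    open ≡-Reasoning
    e  = mirrorLines m
    e′ = singleLine j d′

  equiSum₁₂ : ∀ i d m → m ≢ opposite m → entry d m ≢ entry d (opposite m) →
    entry d m ≡ i → entry d (opposite m) ≡ opposite i →
    equiSum {n} (λ a → ⟦ rowIs? a i d ⟧ * (⟦ colIs? a m ascending ⟧ * ⟦ colIs? a (opposite m) descending ⟧))
      ≡ crossCount₁₂ n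
  equiSum₁₂ i d m m≢m′ t≢t′ c c′ = begin
    equiSum (λ a → ⟦ rowIs? a i d ⟧ * (⟦ colIs? a m ascending ⟧ * ⟦ colIs? a (opposite m) descending ⟧))
      ≡⟨ equiSum-cong (λ a → cong₂ _*_ (⟦fits-single⟧ (rowIs? a) i d) (⟦fits-mirror⟧ (colIs? a) m m≢m′)) ⟨
    equiSum (λ a → ⟦ fits? (rowIs? a) e ⟧ * ⟦ fits? (colIs? a) e′ ⟧)
      ≡⟨ count-lines e e′ (compatible (fits-single (fits-mirror c c′))) ⟩
    multinomial (λ s → + n ℤ.- (lineCount e ℤ.+ lineCount e′ ℤ.- overlaps e e′ s))
      ≡⟨ multinomial-cong (λ s → cong (λ z → + n ℤ.- z) (cong₂ ℤ._-_
           (cong₂ ℤ._+_ (lineCount-singleLine i d) (lineCount-mirrorLines m m≢m′))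
           (trans (overlaps-single i d e′ s) (lineOverlaps-mirror (just d) m m≢m′ s)))) ⟩
    multinomial (λ s → + n ℤ.- (+ 3 ℤ.- (δ (entry d m) s ℤ.+ δ (entry d (opposite m)) s)))
      ≡⟨ multinomial₁₂ (entry d m) (entry d (opposite m)) t≢t′ ⟩
    crossCount₁₂ n ∎
    where
    open ≡-Reasoning
    e  = singleLine i d
    e′ = mirrorLines m

  equiSum₂₂ : ∀ m → m ≢ opposite m →
    equiSum {n} (λ a → ⟦ rowIs? a m ascending ⟧ * ⟦ rowIs? a (opposite m) descending ⟧
                     * (⟦ colIs? a m ascending ⟧ * ⟦ colIs? a (opposite m) descending ⟧))
      ≡ crossCount₂₂ n
  equiSum₂₂ m m≢m′ = begin
    equiSum (λ a → ⟦ rowIs? a m ascending ⟧ * ⟦ rowIs? a (opposite m) descending ⟧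
                 * (⟦ colIs? a m ascending ⟧ * ⟦ colIs? a (opposite m) descending ⟧))
      ≡⟨ equiSum-cong (λ a → cong₂ _*_ (⟦fits-mirror⟧ (rowIs? a) m m≢m′) (⟦fits-mirror⟧ (colIs? a) m m≢m′)) ⟨
    equiSum (λ a → ⟦ fits? (rowIs? a) e ⟧ * ⟦ fits? (colIs? a) e ⟧)
      ≡⟨ count-lines e e (compatible (fits-mirror (fits-mirror refl refl) (fits-mirror refl refl))) ⟩
    multinomial (λ s → + n ℤ.- (lineCount e ℤ.+ lineCount e ℤ.- overlaps e e s))
      ≡⟨ multinomial-cong (λ s → cong (λ z → + n ℤ.- z) (cong₂ ℤ._-_
           (cong₂ ℤ._+_ (lineCount-mirrorLines m m≢m′) (lineCount-mirrorLines m m≢m′))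
           (trans (overlaps-mirror m m≢m′ e s)
             (cong₂ ℤ._+_ (lineOverlaps-mirror (just ascending) m m≢m′ s) (reflected s))))) ⟩
    multinomial (λ s → + n ℤ.- (+ 4 ℤ.- (δ m s ℤ.+ δ (opposite m) s ℤ.+ (δ m s ℤ.+ δ (opposite m) s))))
      ≡⟨ multinomial₂₂ m (opposite m) m≢m′ ⟩
    crossCount₂₂ n ∎
    where
    open ≡-Reasoning
    e = mirrorLines m
    -- The descending row meets the two columns in the same two symbols as the ascending row, in the
    -- opposite order; hence each symbol occupies two of the four crossing cells.
    reflected : ∀ s → lineOverlaps (just descending) e s ≡ δ m s ℤ.+ δ (opposite m) s
    reflected s = trans (lineOverlaps-mirror (just descending) m m≢m′ s)
      (trans (cong (λ x → δ (opposite m) s ℤ.+ δ x s) (Fin.opposite-involutive m))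
        (ℤₚ.+-comm (δ (opposite m) s) (δ m s)))

-- Inclusion-exclusion over lines of one kind

⟦⟧-⊎ : {P Q : Set} (p? : Dec P) (q? : Dec Q) → ⟦ p? ⊎-dec q? ⟧ ≡ ⟦ p? ⟧ + ⟦ q? ⟧ - ⟦ p? ⟧ * ⟦ q? ⟧
⟦⟧-⊎ p? q? with does p? | does q?
... | true  | true  = refl
... | true  | false = refl
... | false | true  = refl
... | false | false = refl

⟦⟧-⊎-disjoint : {P Q : Set} (p? : Dec P) (q? : Dec Q) → ¬ (P × Q) → ⟦ p? ⊎-dec q? ⟧ ≡ ⟦ p? ⟧ + ⟦ q? ⟧
⟦⟧-⊎-disjoint p? q? ¬pq = trans (⟦⟧-⊎ p? q?) (trans
  (cong (λ x → ⟦ p? ⟧ + ⟦ q? ⟧ - x) (trans (sym (⟦⟧-× p? q?)) (⟦⟧-false (p? ×-dec q?) ¬pq)))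
  (ℚₚ.+-identityʳ (⟦ p? ⟧ + ⟦ q? ⟧)))

⟦⟧-0∨1 : {P : Set} (p? : Dec P) → ⟦ p? ⟧ ≡ 0ℚ ⊎ ⟦ p? ⟧ ≡ 1ℚ
⟦⟧-0∨1 p? with does p?
... | true  = inj₂ refl
... | false = inj₁ refl

choices : List (Maybe Direction)
choices = nothing ∷ just ascending ∷ just descending ∷ []

size : Vec (Maybe Direction) k → ℕ
size []            = 0
size (nothing ∷ e) = size e
size (just _ ∷ e)  = suc (size e)

size≤ : (e : Vec (Maybe Direction) k) → size e ℕ.≤ k
size≤ []            = z≤n
size≤ (nothing ∷ e) = ℕₚ.m≤n⇒m≤1+n (size≤ e)
size≤ (just _ ∷ e)  = s≤s (size≤ e)

lineCount-lookup : (e : Vec (Maybe Direction) k) → lineCount (lookup e) ≡ + size e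
lineCount-lookup []            = refl
lineCount-lookup (nothing ∷ e) = trans (ℤₚ.+-identityˡ (lineCount (lookup e))) (lineCount-lookup e)
lineCount-lookup (just _ ∷ e)  = cong (λ z → 1ℤ ℤ.+ z) (lineCount-lookup e)

module _ {Q : Fin k → Direction → Set} where

  Either : Fin k → Set
  Either i = Q i ascending ⊎ Q i descending

  either? : (∀ i d → Dec (Q i d)) → ∀ i → Dec (Either i)
  either? Q? i = Q? i ascending ⊎-dec Q? i descending

  someLine? : (∀ i d → Dec (Q i d)) → Dec (∃ Either)
  someLine? Q? = Fin.any? (either? Q?)

  -- Σᵢ w(i) Cᵢ, where Cᵢ is the number of sets of i lines, all satisfying Q, with at most one direction per index.
  weightedCount : (ℕ → ℚ) → (∀ i d → Dec (Q i d)) → ℚ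
  weightedCount w Q? = ∑ₗ (vectors k choices) (λ e → w (size e) * ⟦ fits? Q? (lookup e) ⟧)

  weightedCount-cong : {w w′ : ℕ → ℚ} (Q? : ∀ i d → Dec (Q i d)) → (∀ i → w i ≡ w′ i) →
                       weightedCount w Q? ≡ weightedCount w′ Q?
  weightedCount-cong Q? w≗w′ =
    ∑ₗ-cong (vectors k choices) (λ e → cong (_* ⟦ fits? Q? (lookup e) ⟧) (w≗w′ (size e)))

  weightedCount-neg : (w : ℕ → ℚ) (Q? : ∀ i d → Dec (Q i d)) →
                      weightedCount (λ i → - w i) Q? ≡ - weightedCount w Q?
  weightedCount-neg w Q? = trans
    (∑ₗ-cong (vectors k choices) (λ e → sym (ℚₚ.neg-distribˡ-* (w (size e)) ⟦ fits? Q? (lookup e) ⟧)))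
    (∑ₗ-neg (vectors k choices) (λ e → w (size e) * ⟦ fits? Q? (lookup e) ⟧))

-- Split on the choice at index 0. Both directions leave the same sum over the remaining indices,
-- and since they exclude each other their indicators add up to that of `Either`.
weightedCount-suc : {Q : Fin (suc k) → Direction → Set} (w : ℕ → ℚ) (Q? : ∀ i d → Dec (Q i d)) →
  ¬ (Q zero ascending × Q zero descending) →
  weightedCount w Q? ≡ weightedCount w (Q? ∘ suc) + ⟦ either? Q? zero ⟧ * weightedCount (w ∘ suc) (Q? ∘ suc)
weightedCount-suc {k} {Q} w Q? excl = begin
  weightedCount w Q?
    ≡⟨ ∑ₗ-vectors-suc k choices (λ e → w (size e) * ⟦ fits? Q? (lookup e) ⟧) ⟩
  ∑ₗ es (λ e → w (size e) * ⟦ fits? Q? (lookup (nothing ∷ e)) ⟧) + (line ascending + (line descending + 0ℚ))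
    ≡⟨ cong₂ _+_ (∑ₗ-cong es (λ e → cong (w (size e) *_) (⟦fits-∷⟧ nothing e)))
         (cong₂ (λ x y → x + (y + 0ℚ)) (line≡ ascending) (line≡ descending)) ⟩
  ∑ₗ es (λ e → w (size e) * (1ℚ * ⟦ fits? (Q? ∘ suc) (lookup e) ⟧))
    + (⟦ Q? zero ascending ⟧ * rest + (⟦ Q? zero descending ⟧ * rest + 0ℚ))
    ≡⟨ cong₂ _+_ (∑ₗ-cong es (λ e → cong (w (size e) *_) (ℚₚ.*-identityˡ ⟦ fits? (Q? ∘ suc) (lookup e) ⟧)))
         (factor ⟦ Q? zero ascending ⟧ ⟦ Q? zero descending ⟧ rest) ⟩
  weightedCount w (Q? ∘ suc) + (⟦ Q? zero ascending ⟧ + ⟦ Q? zero descending ⟧) * rest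
    ≡⟨ cong (λ x → weightedCount w (Q? ∘ suc) + x * rest)
         (⟦⟧-⊎-disjoint (Q? zero ascending) (Q? zero descending) excl) ⟨
  weightedCount w (Q? ∘ suc) + ⟦ either? Q? zero ⟧ * rest ∎
  where
  open ≡-Reasoning
  es = vectors k choices
  rest = weightedCount (w ∘ suc) (Q? ∘ suc)
  line : Direction → ℚ
  line d = ∑ₗ es (λ e → w (suc (size e)) * ⟦ fits? Q? (lookup (just d ∷ e)) ⟧)
  ⟦fits-∷⟧ : ∀ m e → ⟦ fits? Q? (lookup (m ∷ e)) ⟧ ≡ ⟦ Maybe.dec (Q? zero) m ⟧ * ⟦ fits? (Q? ∘ suc) (lookup e) ⟧
  ⟦fits-∷⟧ m e = ⟦⟧-× (Maybe.dec (Q? zero) m) (fits? (Q? ∘ suc) (lookup e))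
  swap : ∀ a b c → a * (b * c) ≡ b * (a * c)
  swap = solve-∀ ℚ-ring
  line≡ : ∀ d → line d ≡ ⟦ Q? zero d ⟧ * rest
  line≡ d = trans
    (∑ₗ-cong es (λ e → trans (cong (w (suc (size e)) *_) (⟦fits-∷⟧ (just d) e))
      (swap (w (suc (size e))) ⟦ Q? zero d ⟧ ⟦ fits? (Q? ∘ suc) (lookup e) ⟧)))
    (∑ₗ-*ˡ es ⟦ Q? zero d ⟧ (λ e → w (suc (size e)) * ⟦ fits? (Q? ∘ suc) (lookup e) ⟧))
  factor : ∀ a b c → a * c + (b * c + 0ℚ) ≡ (a + b) * c
  factor = solve-∀ ℚ-ring

signs : ℕ → ℚ
signs i = (- 1ℚ) ^ i

signs-suc : ∀ i → signs (suc i) ≡ - signs i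
signs-suc i = neg-one (signs i)
  where
  neg-one : ∀ a → - 1ℚ * a ≡ - a
  neg-one = solve-∀ ℚ-ring

-- The alternating signs cut off at sets of fewer than j lines, as needed for Bonferroni's
-- inequalities. The recursion on both arguments makes the shifted weight the negative of the next
-- shorter cutoff by definition, which is the hypothesis of `weightedCount-negShift`.
signs< : ℕ → ℕ → ℚ
signs< zero    i       = 0ℚ
signs< (suc j) zero    = 1ℚ
signs< (suc j) (suc i) = - signs< j i

Exclusive : (Fin k → Direction → Set) → Set
Exclusive Q = ∀ i → ¬ (Q i ascending × Q i descending)

weightedCount-negShift : {Q : Fin (suc k) → Direction → Set} (Q? : ∀ i d → Dec (Q i d)) → Exclusive Q →
  (w w′ : ℕ → ℚ) → (∀ i → w (suc i) ≡ - w′ i) →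
  weightedCount w Q? ≡ weightedCount w (Q? ∘ suc) - ⟦ either? Q? zero ⟧ * weightedCount w′ (Q? ∘ suc)
weightedCount-negShift Q? excl w w′ w-suc = begin
  weightedCount w Q?
    ≡⟨ weightedCount-suc w Q? (excl zero) ⟩
  weightedCount w (Q? ∘ suc) + x * weightedCount (w ∘ suc) (Q? ∘ suc)
    ≡⟨ cong (λ y → weightedCount w (Q? ∘ suc) + x * y)
         (trans (weightedCount-cong (Q? ∘ suc) w-suc) (weightedCount-neg w′ (Q? ∘ suc))) ⟩
  weightedCount w (Q? ∘ suc) + x * - weightedCount w′ (Q? ∘ suc)
    ≡⟨ cong (weightedCount w (Q? ∘ suc) ℚ.+_) (ℚₚ.neg-distribʳ-* x (weightedCount w′ (Q? ∘ suc))) ⟨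
  weightedCount w (Q? ∘ suc) - x * weightedCount w′ (Q? ∘ suc) ∎
  where
  open ≡-Reasoning
  x = ⟦ either? Q? zero ⟧

-- Inclusion-exclusion: both sides are ∏ᵢ (1 - [Either i]).
weightedCount-signs : {Q : Fin k → Direction → Set} (Q? : ∀ i d → Dec (Q i d)) → Exclusive Q →
                      weightedCount signs Q? ≡ 1ℚ - ⟦ someLine? Q? ⟧
weightedCount-signs {zero}  Q? excl = refl
weightedCount-signs {suc k} Q? excl = begin
  weightedCount signs Q?
    ≡⟨ weightedCount-negShift Q? excl signs signs signs-suc ⟩
  weightedCount signs (Q? ∘ suc) - x * weightedCount signs (Q? ∘ suc)
    ≡⟨ cong (λ t → t - x * t) (weightedCount-signs (Q? ∘ suc) (excl ∘ suc)) ⟩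
  (1ℚ - y) - x * (1ℚ - y)
    ≡⟨ complement x y ⟩
  1ℚ - (x + y - x * y)
    ≡⟨ cong (λ z → 1ℚ - z) (⟦⟧-⊎ (either? Q? zero) (someLine? (Q? ∘ suc))) ⟨
  1ℚ - ⟦ someLine? Q? ⟧ ∎
  where
  open ≡-Reasoning
  x = ⟦ either? Q? zero ⟧
  y = ⟦ someLine? (Q? ∘ suc) ⟧
  complement : ∀ a b → (1ℚ - b) - a * (1ℚ - b) ≡ 1ℚ - (a + b - a * b)
  complement = solve-∀ ℚ-ring

weightedCount-signs<0 : {Q : Fin k → Direction → Set} (Q? : ∀ i d → Dec (Q i d)) → weightedCount (signs< 0) Q? ≡ 0ℚ
weightedCount-signs<0 {k} Q? = trans
  (∑ₗ-cong (vectors k choices) (λ e → ℚₚ.*-zeroˡ ⟦ fits? Q? (lookup e) ⟧)) (∑ₗ-0 (vectors k choices))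

weightedCount-signs<1 : {Q : Fin k → Direction → Set} (Q? : ∀ i d → Dec (Q i d)) → Exclusive Q →
                        weightedCount (signs< 1) Q? ≡ 1ℚ
weightedCount-signs<1 {zero}  Q? excl = refl
weightedCount-signs<1 {suc k} Q? excl = trans
  (weightedCount-negShift Q? excl (signs< 1) (signs< 0) (λ i → refl))
  (trans (cong₂ (λ x y → x - ⟦ either? Q? zero ⟧ * y)
    (weightedCount-signs<1 (Q? ∘ suc) (excl ∘ suc)) (weightedCount-signs<0 (Q? ∘ suc)))
  (drop-zero 1ℚ ⟦ either? Q? zero ⟧))
  where
  drop-zero : ∀ a b → a - b * 0ℚ ≡ a
  drop-zero = solve-∀ ℚ-ring

-- Both sides are affine in x, and x is an indicator, so it suffices to compare them at 0 and at 1.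
recurrence-mono : ∀ {a b c d} x → x ≡ 0ℚ ⊎ x ≡ 1ℚ → a ℚ.≤ c → a - b ℚ.≤ c - d → a - x * b ℚ.≤ c - x * d
recurrence-mono {a} {b} {c} {d} _ (inj₁ refl) a≤c _ = subst₂ ℚ._≤_ (drop-zero a b) (drop-zero c d) a≤c
  where
  drop-zero : ∀ a b → a ≡ a - 0ℚ * b
  drop-zero = solve-∀ ℚ-ring
recurrence-mono {a} {b} {c} {d} _ (inj₂ refl) _   ≤ = subst₂ ℚ._≤_ (drop-one a b) (drop-one c d) ≤
  where
  drop-one : ∀ a b → a - b ≡ a - 1ℚ * b
  drop-one = solve-∀ ℚ-ring

p≤q⇒p-q≤0 : ∀ {p q} → p ℚ.≤ q → p - q ℚ.≤ 0ℚ
p≤q⇒p-q≤0 {p} {q} p≤q = subst (p - q ℚ.≤_) (ℚₚ.+-inverseʳ q) (ℚₚ.+-monoˡ-≤ (- q) p≤q)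

p≤q⇒0≤q-p : ∀ {p q} → p ℚ.≤ q → 0ℚ ℚ.≤ q - p
p≤q⇒0≤q-p {p} {q} p≤q = subst (ℚ._≤ q - p) (ℚₚ.+-inverseʳ p) (ℚₚ.+-monoˡ-≤ (- p) p≤q)

weightedCount-signs≤1 : {Q : Fin k → Direction → Set} (Q? : ∀ i d → Dec (Q i d)) → Exclusive Q →
                        weightedCount signs Q? ℚ.≤ 1ℚ
weightedCount-signs≤1 Q? excl = subst (ℚ._≤ 1ℚ) (sym (weightedCount-signs Q? excl))
  (bound ⟦ someLine? Q? ⟧ (⟦⟧-0∨1 (someLine? Q?)))
  where
  bound : ∀ x → x ≡ 0ℚ ⊎ x ≡ 1ℚ → 1ℚ - x ℚ.≤ 1ℚ
  bound _ (inj₁ refl) = ℚₚ.≤-refl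
  bound _ (inj₂ refl) = ℚₚ.<⇒≤ (ℚₚ.positive⁻¹ 1ℚ)

-- Induction on the number of indices. If index 0 carries a line, the full alternating sum becomes t
-- - t = 0 while the truncated one becomes t₂ - 1, and t₂ ≤ t ≤ 1. Otherwise the induction
-- hypothesis is the claim.
bonferroni-2 : {Q : Fin k → Direction → Set} (Q? : ∀ i d → Dec (Q i d)) → Exclusive Q →
               weightedCount (signs< 2) Q? ℚ.≤ weightedCount signs Q?
bonferroni-2 {zero}  Q? excl = ℚₚ.≤-refl
bonferroni-2 {suc k} Q? excl = subst₂ ℚ._≤_
  (sym (weightedCount-negShift Q? excl (signs< 2) (signs< 1) (λ i → refl)))
  (sym (weightedCount-negShift Q? excl signs signs signs-suc))
  (recurrence-mono ⟦ either? Q? zero ⟧ (⟦⟧-0∨1 (either? Q? zero)) ih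
    (subst₂ (λ x z → t₂ - x ℚ.≤ z) (sym (weightedCount-signs<1 (Q? ∘ suc) (excl ∘ suc))) (sym (ℚₚ.+-inverseʳ t))
      (p≤q⇒p-q≤0 (ℚₚ.≤-trans ih (weightedCount-signs≤1 (Q? ∘ suc) (excl ∘ suc))))))
  where
  t₂ = weightedCount (signs< 2) (Q? ∘ suc)
  t  = weightedCount signs (Q? ∘ suc)
  ih : t₂ ℚ.≤ t
  ih = bonferroni-2 (Q? ∘ suc) (excl ∘ suc)

-- If index 0 carries a line, the claim becomes 0 ≤ t₃ - t₂, and t lies between t₂ and t₃ by the
-- previous inequality and the induction hypothesis.
bonferroni-3 : {Q : Fin k → Direction → Set} (Q? : ∀ i d → Dec (Q i d)) → Exclusive Q →
               weightedCount signs Q? ℚ.≤ weightedCount (signs< 3) Q?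
bonferroni-3 {zero}  Q? excl = ℚₚ.≤-refl
bonferroni-3 {suc k} Q? excl = subst₂ ℚ._≤_
  (sym (weightedCount-negShift Q? excl signs signs signs-suc))
  (sym (weightedCount-negShift Q? excl (signs< 3) (signs< 2) (λ i → refl)))
  (recurrence-mono ⟦ either? Q? zero ⟧ (⟦⟧-0∨1 (either? Q? zero)) ih
    (subst (ℚ._≤ t₃ - t₂) (sym (ℚₚ.+-inverseʳ t))
      (p≤q⇒0≤q-p (ℚₚ.≤-trans (bonferroni-2 (Q? ∘ suc) (excl ∘ suc)) ih))))
  where
  t₂ = weightedCount (signs< 2) (Q? ∘ suc)
  t₃ = weightedCount (signs< 3) (Q? ∘ suc)
  t  = weightedCount signs (Q? ∘ suc)
  ih : t ℚ.≤ t₃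
  ih = bonferroni-3 (Q? ∘ suc) (excl ∘ suc)

∑ₗ-choices : ∀ k (f : ℕ → ℚ) → ∑ₗ (vectors (suc k) choices) (f ∘ size)
  ≡ ∑ₗ (vectors k choices) (f ∘ size) + fromℕ 2 * ∑ₗ (vectors k choices) (f ∘ suc ∘ size)
∑ₗ-choices k f = trans (∑ₗ-vectors-suc k choices (f ∘ size))
  (double (∑ₗ (vectors k choices) (f ∘ size)) (∑ₗ (vectors k choices) (f ∘ suc ∘ size)))
  where
  double : ∀ a b → a + (b + (b + 0ℚ)) ≡ a + (1ℚ + 1ℚ) * b
  double = solve-∀ ℚ-ring

binomialTerm : ℕ → (ℕ → ℚ) → ℕ → ℚ
binomialTerm k f i = fromℕ (k C i) * (fromℕ 2 ^ i * f i)

-- There are 2^i C(k,i) ways to choose i lines with directions. The upper limit m is kept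
-- independent of k because the induction uses the hypothesis with two different limits; the surplus
-- terms have binomial coefficient 0.
∑ₗ-size : ∀ k m → k ℕ.≤ m → (f : ℕ → ℚ) →
  ∑ₗ (vectors k choices) (f ∘ size) ≡ ∑[ i < suc m ] binomialTerm k f (toℕ i)
∑ₗ-size zero    m       _         f = cong₂ _+_ (first (f 0)) (sym (rest m))
  where
  first : ∀ a → a ≡ 1ℚ * (1ℚ * a)
  first = solve-∀ ℚ-ring
  rest : ∀ m → ∑[ i < m ] binomialTerm 0 f (suc (toℕ i)) ≡ 0ℚ
  rest m = sum-zero (λ (i : Fin m) → ℚₚ.*-zeroˡ (fromℕ 2 ^ suc (toℕ i) * f (suc (toℕ i))))
∑ₗ-size (suc k) (suc m) (s≤s k≤m) f = begin
  ∑ₗ (vectors (suc k) choices) (f ∘ size)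
    ≡⟨ ∑ₗ-choices k f ⟩
  ∑ₗ (vectors k choices) (f ∘ size) + fromℕ 2 * ∑ₗ (vectors k choices) (f ∘ suc ∘ size)
    ≡⟨ cong₂ (λ x y → x + fromℕ 2 * y) (∑ₗ-size k (suc m) (ℕₚ.m≤n⇒m≤1+n k≤m) f) (∑ₗ-size k m k≤m (f ∘ suc)) ⟩
  binomialTerm k f 0 + S + fromℕ 2 * sum b
    ≡⟨ cong (binomialTerm k f 0 + S ℚ.+_) (*-distribˡ-sum (fromℕ 2) b) ⟩
  binomialTerm k f 0 + S + sum (λ i → fromℕ 2 * b i)
    ≡⟨ ℚₚ.+-assoc (binomialTerm k f 0) S (sum (λ i → fromℕ 2 * b i)) ⟩
  binomialTerm k f 0 + (S + sum (λ i → fromℕ 2 * b i))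
    ≡⟨ cong (binomialTerm k f 0 ℚ.+_) (∑-distrib-+ a (λ i → fromℕ 2 * b i)) ⟨
  binomialTerm k f 0 + sum (λ i → a i + fromℕ 2 * b i)
    ≡⟨ cong (binomialTerm k f 0 ℚ.+_) (sum-cong-≗ (λ (i : Fin (suc m)) → pascal (toℕ i))) ⟩
  ∑[ i < suc (suc m) ] binomialTerm (suc k) f (toℕ i) ∎
  where
  open ≡-Reasoning
  a b : Fin (suc m) → ℚ
  a i = binomialTerm k f (suc (toℕ i))
  b i = binomialTerm k (f ∘ suc) (toℕ i)
  S = sum a
  regroup : ∀ a b c d e → a * (b * c * d) + b * (e * (c * d)) ≡ (e + a) * (b * c * d)
  regroup = solve-∀ ℚ-ring
  pascal : ∀ i → binomialTerm k f (suc i) + fromℕ 2 * binomialTerm k (f ∘ suc) i ≡ binomialTerm (suc k) f (suc i)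
  pascal i = trans
    (regroup (fromℕ (k C suc i)) (fromℕ 2) (fromℕ 2 ^ i) (f (suc i)) (fromℕ (k C i)))
    (cong (_* (fromℕ 2 ^ suc i * f (suc i)))
      (trans (sym (fromℕ-+ (k C i) (k C suc i))) (cong fromℕ (nCk+nC[k+1]≡[n+1]C[k+1] k i))))

equiSum-weightedCount : {Q : Array n → Fin n → Direction → Set} (Q? : ∀ a i d → Dec (Q a i d)) →
  (∀ (e : Lines n) {i} → lineCount e ≡ + i → i ℕ.≤ n → equiSum (λ a → ⟦ fits? (Q? a) e ⟧) ≡ rowCount n i) →
  ∀ w → equiSum (λ a → weightedCount w (Q? a)) ≡ ∑[ i < suc n ] binomialTerm n (λ i → w i * rowCount n i) (toℕ i)
equiSum-weightedCount {n} Q? equiSum-lines w = begin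
  equiSum (λ a → weightedCount w (Q? a))
    ≡⟨ equiSum-∑ₗ (vectors n choices) (λ e a → w (size e) * ⟦ fits? (Q? a) (lookup e) ⟧) ⟩
  ∑ₗ (vectors n choices) (λ e → equiSum (λ a → w (size e) * ⟦ fits? (Q? a) (lookup e) ⟧))
    ≡⟨ ∑ₗ-cong (vectors n choices) (λ e → trans
         (equiSum-*ˡ (w (size e)) (λ a → ⟦ fits? (Q? a) (lookup e) ⟧))
         (cong (w (size e) *_) (equiSum-lines (lookup e) (lineCount-lookup e) (size≤ e)))) ⟩
  ∑ₗ (vectors n choices) (λ e → w (size e) * rowCount n (size e))
    ≡⟨ ∑ₗ-size n n ℕₚ.≤-refl (λ i → w i * rowCount n i) ⟩
  ∑[ i < suc n ] binomialTerm n (λ i → w i * rowCount n i) (toℕ i) ∎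
  where open ≡-Reasoning

-- Crossing lines

lookup-∷ʳ-last : (xs : Vec A n) (x : A) → lookup (xs ∷ʳ x) (Fin.fromℕ n) ≡ x
lookup-∷ʳ-last []       x = refl
lookup-∷ʳ-last (_ ∷ xs) x = lookup-∷ʳ-last xs x

lookup-∷ʳ-inject₁ : (xs : Vec A n) (x : A) → ∀ i → lookup (xs ∷ʳ x) (inject₁ i) ≡ lookup xs i
lookup-∷ʳ-inject₁ (_ ∷ xs) x zero    = refl
lookup-∷ʳ-inject₁ (_ ∷ xs) x (suc i) = lookup-∷ʳ-inject₁ xs x i

lookup-reverse : (xs : Vec A n) → ∀ i → lookup (reverse xs) (opposite i) ≡ lookup xs i
lookup-reverse {n = suc n} (x ∷ xs) zero    =
  trans (cong (λ ys → lookup ys (Fin.fromℕ n)) (Vec.reverse-∷ x xs)) (lookup-∷ʳ-last (reverse xs) x)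
lookup-reverse (x ∷ xs) (suc i) =
  trans (cong (λ ys → lookup ys (inject₁ (opposite i))) (Vec.reverse-∷ x xs))
  (trans (lookup-∷ʳ-inject₁ (reverse xs) x (opposite i)) (lookup-reverse xs i))

lookup-transpose : ∀ {m} (a : Vec (Vec A n) m) → ∀ j i → lookup (lookup (transpose a) j) i ≡ lookup (lookup a i) j
lookup-transpose {A} {n} {suc m} (r ∷ a) j i = trans (cong (λ v → lookup v i) step) (cell i)
  where
  cons : A → Vec A m → Vec A (suc m)
  cons = _∷_
  step : lookup (transpose (r ∷ a)) j ≡ lookup r j ∷ lookup (transpose a) j
  step = trans (Vec.lookup-⊛ j (Vec.replicate n cons Vec.⊛ r) (transpose a))
    (cong (λ f → f (lookup (transpose a) j))
      (trans (Vec.lookup-⊛ j (Vec.replicate n cons) r) (cong (λ f → f (lookup r j)) (Vec.lookup-replicate j cons))))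
  cell : ∀ i → lookup (lookup r j ∷ lookup (transpose a) j) i ≡ lookup (lookup (r ∷ a) i) j
  cell zero    = refl
  cell (suc i) = lookup-transpose a j i

Any⇔∃ : {P : A → Set} {v : Vec A n} → Any P v ⇔ ∃ (λ i → P (lookup v i))
Any⇔∃ {P = P} = mk⇔ witness (λ (i , p) → any _ i p)
  where
  witness : ∀ {n} {v : Vec _ n} → Any P v → ∃ (λ i → P (lookup v i))
  witness (here p)  = zero , p
  witness (there p) = let i , q = witness p in suc i , q
  any : ∀ {n} (v : Vec _ n) i → P (lookup v i) → Any P v
  any (x ∷ v) zero    p = here p
  any (x ∷ v) (suc i) p = there (any v i p)

≡-lookup : {v w : Vec A n} → (∀ j → lookup v j ≡ lookup w j) → v ≡ w
≡-lookup {v = v} {w} v≗w =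
  trans (sym (Vec.tabulate∘lookup v)) (trans (Vec.tabulate-cong v≗w) (Vec.tabulate∘lookup w))

directed : Direction → Vec (Fin n) n
directed {n} ascending  = allFin n
directed {n} descending = reverse (allFin n)

lookup-directed : ∀ d (j : Fin n) → lookup (directed d) j ≡ entry d j
lookup-directed ascending  j = Vec.lookup∘tabulate id j
lookup-directed {n} descending j = trans
  (cong (lookup (reverse (allFin n))) (sym (Fin.opposite-involutive j)))
  (trans (lookup-reverse (allFin n) (opposite j)) (Vec.lookup∘tabulate id (opposite j)))

entries⇔directed : ∀ d {v : Vec (Fin n) n} → v ≡ directed d ⇔ (∀ j → lookup v j ≡ entry d j)
entries⇔directed d = mk⇔
  (λ { refl → lookup-directed d })
  (λ v≗ → ≡-lookup (λ j → trans (v≗ j) (sym (lookup-directed d j))))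

module _ (a : Array n) where

  consecutiveRow⇔ : Any Consecutive a ⇔ ∃ (Either {Q = RowIs a})
  consecutiveRow⇔ = mk⇔
    (λ any → let i , c = to Any⇔∃ any in
      i , Sum.map (to (entries⇔directed ascending)) (to (entries⇔directed descending)) c)
    (λ (i , c) → from Any⇔∃
      (i , Sum.map (from (entries⇔directed ascending)) (from (entries⇔directed descending)) c))

  consecutiveCol⇔ : Any Consecutive (transpose a) ⇔ ∃ (Either {Q = ColIs a})
  consecutiveCol⇔ = mk⇔
    (λ any → let j , c = to Any⇔∃ any in
      j , Sum.map (toCol j ∘ to (entries⇔directed ascending)) (toCol j ∘ to (entries⇔directed descending)) c)
    (λ (j , c) → from Any⇔∃
      (j , Sum.map (from (entries⇔directed ascending) ∘ fromCol j) (from (entries⇔directed descending) ∘ fromCol j) c))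
    where
    toCol : ∀ j {f : Fin n → Fin n} → (∀ i → lookup (lookup (transpose a) j) i ≡ f i) →
            (∀ i → lookup (lookup a i) j ≡ f i)
    toCol j h i = trans (sym (lookup-transpose a j i)) (h i)
    fromCol : ∀ j {f : Fin n → Fin n} → (∀ i → lookup (lookup a i) j ≡ f i) →
              (∀ i → lookup (lookup (transpose a) j) i ≡ f i)
    fromCol j h i = trans (lookup-transpose a j i) (h i)

  someRow someCol : ℚ
  someRow = ⟦ someLine? (rowIs? a) ⟧
  someCol = ⟦ someLine? (colIs? a) ⟧

  ⟦consecutiveEquiSquare⟧ : ⟦ consecutiveEquiSquare? n a ⟧ ≡ ⟦ equiSquare? a ⟧ * (someRow + someCol - someRow * someCol)
  ⟦consecutiveEquiSquare⟧ = trans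
    (⟦⟧-cong (mk⇔
      (λ (e , c) → e , Sum.map (to consecutiveRow⇔) (to consecutiveCol⇔) c)
      (λ (e , c) → e , Sum.map (from consecutiveRow⇔) (from consecutiveCol⇔) c))
      (consecutiveEquiSquare? n a) (equiSquare? a ×-dec (someLine? (rowIs? a) ⊎-dec someLine? (colIs? a))))
    (trans (⟦⟧-× (equiSquare? a) (someLine? (rowIs? a) ⊎-dec someLine? (colIs? a)))
      (cong (⟦ equiSquare? a ⟧ *_) (⟦⟧-⊎ (someLine? (rowIs? a)) (someLine? (colIs? a)))))

∣Σ∣≡ : ∀ n → fromℕ (∣Σ∣ n) ≡ equiSum {n} someRow + equiSum {n} someCol - equiSum {n} (λ a → someRow a * someCol a)
∣Σ∣≡ n = begin
  fromℕ (∣Σ∣ n)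
    ≡⟨ length-filter (consecutiveEquiSquare? n) (arrays n) ⟩
  ∑ₗ (arrays n) (λ a → ⟦ consecutiveEquiSquare? n a ⟧)
    ≡⟨ ∑ₗ-cong (arrays n) ⟦consecutiveEquiSquare⟧ ⟩
  equiSum {n} (λ a → someRow a + someCol a - someRow a * someCol a)
    ≡⟨ equiSum-- {n} (λ a → someRow a + someCol a) (λ a → someRow a * someCol a) ⟩
  equiSum {n} (λ a → someRow a + someCol a) - equiSum {n} (λ a → someRow a * someCol a)
    ≡⟨ cong (_- equiSum {n} (λ a → someRow a * someCol a)) (equiSum-+ {n} someRow someCol) ⟩
  equiSum {n} someRow + equiSum {n} someCol - equiSum {n} (λ a → someRow a * someCol a) ∎
  where open ≡-Reasoning

opposite-injective : {i j : Fin n} → opposite i ≡ opposite j → i ≡ j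
opposite-injective {i = i} {j} eq =
  trans (sym (Fin.opposite-involutive i)) (trans (cong opposite eq) (Fin.opposite-involutive j))

-- The source of the assumption `2 ≤ n`: index 0 is then different from its mirror image, so the
-- ascending and the descending word differ.
not-all-mirrored : 2 ℕ.≤ n → ¬ (∀ (j : Fin n) → j ≡ opposite j)
not-all-mirrored (s≤s (s≤s _)) h with h zero
... | ()

rows-exclusive : 2 ℕ.≤ n → (a : Array n) → Exclusive (RowIs a)
rows-exclusive 2≤n a i (asc , desc) = not-all-mirrored 2≤n (λ j → trans (sym (asc j)) (desc j))

cols-exclusive : 2 ℕ.≤ n → (a : Array n) → Exclusive (ColIs a)
cols-exclusive 2≤n a j (asc , desc) = not-all-mirrored 2≤n (λ i → trans (sym (asc i)) (desc i))

module _ {n : ℕ} where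

  -- A regrouping of all lines of one kind into classes, chosen so that a row of class m can cross a
  -- column only of the same class.
  CrossLine : (Fin n → Direction → Set) → Fin n → Set
  CrossLine Q m = Q m ascending ⊎ Q (opposite m) descending

  crossLine? : {Q : Fin n → Direction → Set} → (∀ i d → Dec (Q i d)) → ∀ m → Dec (CrossLine Q m)
  crossLine? Q? m = Q? m ascending ⊎-dec Q? (opposite m) descending

  someLine⇔crossLine : (Q : Fin n → Direction → Set) → ∃ (Either {Q = Q}) ⇔ ∃ (CrossLine Q)
  someLine⇔crossLine Q = mk⇔
    (λ { (i , inj₁ q) → i , inj₁ q
       ; (i , inj₂ q) → opposite i , inj₂ (subst (λ j → Q j descending) (sym (Fin.opposite-involutive i)) q) })
    (λ { (m , inj₁ q) → m , inj₁ q
       ; (m , inj₂ q) → opposite m , inj₂ q })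

  module _ (a : Array n) where

    -- Read the cell where the two lines meet: along the row it shows k and along the column m, or
    -- the mirror images of both.
    crossing-lines : ∀ m k → CrossLine (RowIs a) m → CrossLine (ColIs a) k → m ≡ k
    crossing-lines m k (inj₁ row) (inj₁ col) = trans (sym (col m)) (row k)
    crossing-lines m k (inj₁ row) (inj₂ col) =
      opposite-injective (trans (sym (col m)) (row (opposite k)))
    crossing-lines m k (inj₂ row) (inj₁ col) =
      opposite-injective (trans (sym (col (opposite m))) (row k))
    crossing-lines m k (inj₂ row) (inj₂ col) =
      opposite-injective (opposite-injective (trans (sym (col (opposite m))) (row (opposite k))))

    crossing : Fin n → ℚ
    crossing m = ⟦ crossLine? (rowIs? a) m ⟧ * ⟦ crossLine? (colIs? a) m ⟧

    both? : ∀ m → Dec (CrossLine (RowIs a) m × CrossLine (ColIs a) m)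
    both? m = crossLine? (rowIs? a) m ×-dec crossLine? (colIs? a) m

    -- If rows and columns both occur, every occurring row class equals every occurring column
    -- class. Hence a single class m contributes to the sum, and no inclusion-exclusion over m is
    -- required.
    someRow*someCol : someRow a * someCol a ≡ ∑ₗ (List.allFin n) crossing
    someRow*someCol = trans (sym (⟦⟧-× (someLine? (rowIs? a)) (someLine? (colIs? a))))
      (⟦⟧-unique (someLine? (rowIs? a) ×-dec someLine? (colIs? a)) unique-crossing no-crossing)
      where
      ∑-both : ∑ₗ (List.allFin n) crossing ≡ sum (λ m → ⟦ both? m ⟧)
      ∑-both = trans (∑ₗ-allFin crossing)
        (sum-cong-≗ (λ m → sym (⟦⟧-× (crossLine? (rowIs? a) m) (crossLine? (colIs? a) m))))
      unique-crossing : ∃ (Either {Q = RowIs a}) × ∃ (Either {Q = ColIs a}) → ∑ₗ (List.allFin n) crossing ≡ 1ℚ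
      unique-crossing (r , c) with to (someLine⇔crossLine (RowIs a)) r | to (someLine⇔crossLine (ColIs a)) c
      ... | m , row | k , col with crossing-lines m k row col
      ... | refl = trans ∑-both (trans
        (sum-cong-≗ (λ x → ⟦⟧-cong (mk⇔ (λ (row′ , _) → crossing-lines x m row′ col) (λ { refl → row , col }))
          (both? x) (x Fin.≟ m)))
        (sum-δ₁ m))
      no-crossing : ¬ (∃ (Either {Q = RowIs a}) × ∃ (Either {Q = ColIs a})) → ∑ₗ (List.allFin n) crossing ≡ 0ℚ
      no-crossing ¬rc = trans ∑-both (sum-zero (λ m → ⟦⟧-false (both? m)
        (λ (row , col) → ¬rc (from (someLine⇔crossLine (RowIs a)) (m , row) , from (someLine⇔crossLine (ColIs a)) (m , col)))))

sum-neg : (f : Fin n → ℚ) → sum (λ i → - f i) ≡ - sum f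
sum-neg {zero}  f = refl
sum-neg {suc n} f = trans (cong (- f zero ℚ.+_) (sum-neg (f ∘ suc))) (sym (ℚₚ.neg-distrib-+ (f zero) (sum (f ∘ suc))))

sum-const : ∀ n c → sum {n} (λ _ → c) ≡ fromℕ n * c
sum-const zero    c = sym (ℚₚ.*-zeroˡ c)
sum-const (suc n) c = trans (cong (c ℚ.+_) (sum-const n c))
  (trans (factor c (fromℕ n)) (cong (_* c) (sym (fromℕ-+ 1 n))))
  where
  factor : ∀ a b → a + b * a ≡ (1ℚ + b) * a
  factor = solve-∀ ℚ-ring

-- Indices fixed or moved by reflection

halves : ∀ n → n ≡ 2 ℕ.* ⌊ n /2⌋ ⊎ n ≡ suc (2 ℕ.* ⌊ n /2⌋)
halves zero          = inj₁ refl
halves (suc zero)    = inj₂ refl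
halves (suc (suc n)) = Sum.map
  (λ even → trans (cong (2 ℕ.+_) even) (sym (ℕₚ.*-suc 2 ⌊ n /2⌋)))
  (λ odd → trans (cong (2 ℕ.+_) odd) (cong ℕ.suc (sym (ℕₚ.*-suc 2 ⌊ n /2⌋))))
  (halves n)

mirrored⇔middle : (m : Fin n) → m ≡ opposite m ⇔ suc (2 ℕ.* toℕ m) ≡ n
mirrored⇔middle {n} m = mk⇔
  (λ m≡m′ → trans (double (toℕ m)) (trans
    (cong (ℕ._+ suc (toℕ m)) (trans (cong toℕ m≡m′) (Fin.opposite-prop m))) (ℕₚ.m∸n+n≡m (Fin.toℕ<n m))))
  (λ eq → Fin.toℕ-injective (trans (sym (ℕₚ.m+n∸n≡m (toℕ m) (suc (toℕ m))))
    (trans (cong (ℕ._∸ suc (toℕ m)) (trans (sym (double (toℕ m))) eq)) (sym (Fin.opposite-prop m)))))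
  where
  double : ∀ k → suc (2 ℕ.* k) ≡ k ℕ.+ suc k
  double = ℕ-Solver.solve-∀

-- Marks the indices that have a mirror image distinct from themselves. All indices qualify for even
-- n, and all but the middle one for odd n.
mirrored : Fin n → ℚ
mirrored m = ⟦ ¬? (m Fin.≟ opposite m) ⟧

sum-mirrored : ∀ n → sum (mirrored {n}) ≡ fromℕ (2 ℕ.* ⌊ n /2⌋)
sum-mirrored n = begin
  sum (mirrored {n})
    ≡⟨ sum-cong-≗ (λ (m : Fin n) → complement (m Fin.≟ opposite m)) ⟩
  sum (λ m → 1ℚ + - fixed m)
    ≡⟨ ∑-distrib-+ {n} (λ _ → 1ℚ) (λ m → - fixed m) ⟩
  sum {n} (λ _ → 1ℚ) + sum (λ m → - fixed m)
    ≡⟨ cong₂ _+_ (trans (sum-const n 1ℚ) (ℚₚ.*-identityʳ (fromℕ n))) (sum-neg fixed) ⟩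
  fromℕ n - sum fixed
    ≡⟨ parity (halves n) ⟩
  fromℕ (2 ℕ.* ⌊ n /2⌋) ∎
  where
  open ≡-Reasoning
  fixed : Fin n → ℚ
  fixed m = ⟦ m Fin.≟ opposite m ⟧
  complement : {P : Set} (p? : Dec P) → ⟦ ¬? p? ⟧ ≡ 1ℚ + - ⟦ p? ⟧
  complement p? with does p?
  ... | true  = refl
  ... | false = refl
  parity : n ≡ 2 ℕ.* ⌊ n /2⌋ ⊎ n ≡ suc (2 ℕ.* ⌊ n /2⌋) → fromℕ n - sum fixed ≡ fromℕ (2 ℕ.* ⌊ n /2⌋)
  parity (inj₁ even) = trans (cong (λ x → fromℕ n - x) (sum-zero (λ (m : Fin n) → ⟦⟧-false (m Fin.≟ opposite m)
      (λ eq → ℕₚ.even≢odd ⌊ n /2⌋ (toℕ m) (trans (sym even) (sym (to (mirrored⇔middle m) eq)))))))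
    (trans (ℚₚ.+-identityʳ (fromℕ n)) (cong fromℕ even))
  parity (inj₂ odd) = trans (cong₂ (λ x y → x - y) (trans (cong fromℕ odd) (fromℕ-+ 1 (2 ℕ.* ⌊ n /2⌋)))
      (trans (sum-cong-≗ (λ (m : Fin n) → ⟦⟧-cong (middle⇔ m) (m Fin.≟ opposite m) (m Fin.≟ mid))) (sum-δ₁ mid)))
    (cancel (fromℕ (2 ℕ.* ⌊ n /2⌋)))
    where
    mid : Fin n
    mid = fromℕ< {⌊ n /2⌋} (subst (⌊ n /2⌋ ℕ.<_) (sym odd) (s≤s (ℕₚ.m≤n*m ⌊ n /2⌋ 2)))
    middle⇔ : ∀ m → m ≡ opposite m ⇔ m ≡ mid
    middle⇔ m = mk⇔
      (λ eq → Fin.toℕ-injective (trans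
        (ℕₚ.*-cancelˡ-≡ (toℕ m) ⌊ n /2⌋ 2 (ℕₚ.suc-injective (trans (to (mirrored⇔middle m) eq) odd)))
        (sym (Fin.toℕ-fromℕ< _))))
      (λ eq → from (mirrored⇔middle m)
        (trans (cong (λ k → suc (2 ℕ.* k)) (trans (cong toℕ eq) (Fin.toℕ-fromℕ< _))) (sym odd)))
    cancel : ∀ a → 1ℚ + a - 1ℚ ≡ a
    cancel = solve-∀ ℚ-ring

-- The contribution of one class of crossings

module _ {n : ℕ} (2≤n : 2 ℕ.≤ n) (m : Fin n) where

  private
    u u′ v v′ : Array n → ℚ
    u  a = ⟦ rowIs? a m ascending ⟧
    u′ a = ⟦ rowIs? a (opposite m) descending ⟧
    v  a = ⟦ colIs? a m ascending ⟧
    v′ a = ⟦ colIs? a (opposite m) descending ⟧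

    -- The nine products in the expansion of the crossing indicator: `single` has the four with one
    -- row and one column, `double` the five with at least three lines, with the signs that make it
    -- a quantity to subtract.
    single double : Array n → ℚ
    single a = u a * v a + u a * v′ a + (u′ a * v a + u′ a * v′ a)
    double a = u a * u′ a * v a + u a * u′ a * v′ a + (u a * (v a * v′ a) + u′ a * (v a * v′ a))
             - u a * u′ a * (v a * v′ a)

    c₁₁ = crossCount₁₁ n
    c₁₂ = crossCount₁₂ n
    c₂₂ = crossCount₂₂ n

    crossing≡ : ∀ a → crossing a m ≡ single a - double a
    crossing≡ a = trans
      (cong₂ _*_ (⟦⟧-⊎ (rowIs? a m ascending) (rowIs? a (opposite m) descending))
                 (⟦⟧-⊎ (colIs? a m ascending) (colIs? a (opposite m) descending)))
      (expand (u a) (u′ a) (v a) (v′ a))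
      where
      expand : ∀ x x′ y y′ → (x + x′ - x * x′) * (y + y′ - y * y′)
        ≡ x * y + x * y′ + (x′ * y + x′ * y′)
          - (x * x′ * y + x * x′ * y′ + (x * (y * y′) + x′ * (y * y′)) - x * x′ * (y * y′))
      expand = solve-∀ ℚ-ring

  equiSum-single : equiSum single ≡ c₁₁ + c₁₁ + (c₁₁ + c₁₁)
  equiSum-single = trans (equiSum-+ (λ a → u a * v a + u a * v′ a) (λ a → u′ a * v a + u′ a * v′ a)) (cong₂ _+_
    (trans (equiSum-+ (λ a → u a * v a) (λ a → u a * v′ a))
      (cong₂ _+_ (equiSum₁₁ m ascending m ascending refl) (equiSum₁₁ m ascending (opposite m) descending refl)))
    (trans (equiSum-+ (λ a → u′ a * v a) (λ a → u′ a * v′ a))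
      (cong₂ _+_ (equiSum₁₁ (opposite m) descending m ascending refl)
                 (equiSum₁₁ (opposite m) descending (opposite m) descending refl))))

  equiSum-double-≢ : m ≢ opposite m → equiSum double ≡ c₁₂ + c₁₂ + (c₁₂ + c₁₂) - c₂₂
  equiSum-double-≢ m≢m′ = trans
    (equiSum-- (λ a → u a * u′ a * v a + u a * u′ a * v′ a + (u a * (v a * v′ a) + u′ a * (v a * v′ a)))
               (λ a → u a * u′ a * (v a * v′ a)))
    (cong₂ _-_
      (trans (equiSum-+ (λ a → u a * u′ a * v a + u a * u′ a * v′ a) (λ a → u a * (v a * v′ a) + u′ a * (v a * v′ a)))
        (cong₂ _+_
          (trans (equiSum-+ (λ a → u a * u′ a * v a) (λ a → u a * u′ a * v′ a)) (cong₂ _+_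
            (equiSum₂₁ m m ascending m≢m′ m≢m′ refl refl)
            (equiSum₂₁ m (opposite m) descending m≢m′ (m≢m′ ∘ opposite-injective) refl refl)))
          (trans (equiSum-+ (λ a → u a * (v a * v′ a)) (λ a → u′ a * (v a * v′ a))) (cong₂ _+_
            (equiSum₁₂ m ascending m m≢m′ m≢m′ refl refl)
            (equiSum₁₂ (opposite m) descending m m≢m′ (m≢m′ ∘ opposite-injective) refl refl)))))
      (equiSum₂₂ m m≢m′))

  -- Here both rows of the pair are the middle row, which cannot run in two directions; the same
  -- holds for the columns. Every product in `double` contains such a pair.
  equiSum-double-≡ : m ≡ opposite m → equiSum double ≡ 0ℚ
  equiSum-double-≡ m≡m′ = trans (equiSum-cong vanish) (equiSum-0 {n})
    where
    u*u′≡0 : ∀ a → u a * u′ a ≡ 0ℚ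
    u*u′≡0 a = trans (sym (⟦⟧-× (rowIs? a m ascending) (rowIs? a (opposite m) descending)))
      (⟦⟧-false (rowIs? a m ascending ×-dec rowIs? a (opposite m) descending)
        (λ (asc , desc) → rows-exclusive 2≤n a m (asc , subst (λ i → RowIs a i descending) (sym m≡m′) desc)))
    v*v′≡0 : ∀ a → v a * v′ a ≡ 0ℚ
    v*v′≡0 a = trans (sym (⟦⟧-× (colIs? a m ascending) (colIs? a (opposite m) descending)))
      (⟦⟧-false (colIs? a m ascending ×-dec colIs? a (opposite m) descending)
        (λ (asc , desc) → cols-exclusive 2≤n a m (asc , subst (λ j → ColIs a j descending) (sym m≡m′) desc)))
    zeros : ∀ x x′ y y′ → 0ℚ * y + 0ℚ * y′ + (x * 0ℚ + x′ * 0ℚ) - 0ℚ * 0ℚ ≡ 0ℚ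
    zeros = solve-∀ ℚ-ring
    vanish : ∀ a → double a ≡ 0ℚ
    vanish a = trans
      (cong₂ (λ p q → p * v a + p * v′ a + (u a * q + u′ a * q) - p * q) (u*u′≡0 a) (v*v′≡0 a))
      (zeros (u a) (u′ a) (v a) (v′ a))

  equiSum-double : equiSum double ≡ mirrored m * (c₁₂ + c₁₂ + (c₁₂ + c₁₂) - c₂₂)
  equiSum-double = go (m Fin.≟ opposite m)
    where
    go : (d : Dec (m ≡ opposite m)) → equiSum double ≡ ⟦ ¬? d ⟧ * (c₁₂ + c₁₂ + (c₁₂ + c₁₂) - c₂₂)
    go (yes m≡m′) = trans (equiSum-double-≡ m≡m′) (sym (ℚₚ.*-zeroˡ (c₁₂ + c₁₂ + (c₁₂ + c₁₂) - c₂₂)))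
    go (no m≢m′)  = trans (equiSum-double-≢ m≢m′) (sym (ℚₚ.*-identityˡ (c₁₂ + c₁₂ + (c₁₂ + c₁₂) - c₂₂)))

  equiSum-crossing : equiSum (λ a → crossing a m)
    ≡ c₁₁ + c₁₁ + (c₁₁ + c₁₁) - mirrored m * (c₁₂ + c₁₂ + (c₁₂ + c₁₂) - c₂₂)
  equiSum-crossing = trans (equiSum-cong crossing≡)
    (trans (equiSum-- single double) (cong₂ _-_ equiSum-single equiSum-double))

  -- A union bound in place of the exact value, so that the asymptotics require no estimate of
  -- `crossCount₁₂` and `crossCount₂₂`.
  equiSum-crossing≤ : equiSum (λ a → crossing a m) ℚ.≤ c₁₁ + c₁₁ + (c₁₁ + c₁₁)
  equiSum-crossing≤ = subst (equiSum (λ a → crossing a m) ℚ.≤_) equiSum-single (equiSum-mono crossing≤)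
    where
    union-bound : {P Q : Set} (p? : Dec P) (q? : Dec Q) → ⟦ p? ⊎-dec q? ⟧ ℚ.≤ ⟦ p? ⟧ + ⟦ q? ⟧
    union-bound p? q? with does p? | does q?
    ... | true  | true  = ℚₚ.≤ᵇ⇒≤ _
    ... | true  | false = ℚₚ.≤ᵇ⇒≤ _
    ... | false | true  = ℚₚ.≤ᵇ⇒≤ _
    ... | false | false = ℚₚ.≤ᵇ⇒≤ _
    distrib : ∀ x x′ y y′ → (x + x′) * (y + y′) ≡ x * y + x * y′ + (x′ * y + x′ * y′)
    distrib = solve-∀ ℚ-ring
    crossing≤ : ∀ a → crossing a m ℚ.≤ single a
    crossing≤ a = begin
      crossing a m
        ≤⟨ ℚₚ.*-monoʳ-≤-nonNeg ⟦ crossLine? (colIs? a) m ⟧ {{⟦⟧-nonNeg (crossLine? (colIs? a) m)}}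
             (union-bound (rowIs? a m ascending) (rowIs? a (opposite m) descending)) ⟩
      (u a + u′ a) * ⟦ crossLine? (colIs? a) m ⟧
        ≤⟨ ℚₚ.*-monoˡ-≤-nonNeg (u a + u′ a) {{u+u′-nonNeg}}
             (union-bound (colIs? a m ascending) (colIs? a (opposite m) descending)) ⟩
      (u a + u′ a) * (v a + v′ a)
        ≡⟨ distrib (u a) (u′ a) (v a) (v′ a) ⟩
      single a ∎
      where
      open ℚₚ.≤-Reasoning
      u+u′-nonNeg : ℚ.NonNegative (u a + u′ a)
      u+u′-nonNeg = ℚₚ.nonNeg+nonNeg⇒nonNeg (u a) {{⟦⟧-nonNeg (rowIs? a m ascending)}}
        (u′ a) {{⟦⟧-nonNeg (rowIs? a (opposite m) descending)}}

-- The exact formula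

equiSum-1 : equiSum {n} (λ _ → 1ℚ) ≡ rowCount n 0
equiSum-1 {n} = trans (equiSum-cong {n} (λ a → sym (⟦fits-noLines⟧ (rowIs? a))))
  (equiSum-rows {n} noLines (lineCount-noLines n) z≤n)

module _ {Q : Array n → Fin n → Direction → Set} (Q? : ∀ a i d → Dec (Q a i d))
  (exclusive : ∀ a → Exclusive (Q a))
  (equiSum-lines : ∀ (e : Lines n) {i} → lineCount e ≡ + i → i ℕ.≤ n → equiSum (λ a → ⟦ fits? (Q? a) e ⟧) ≡ rowCount n i)
  where

  equiSum-someLine : equiSum (λ a → ⟦ someLine? (Q? a) ⟧) ≡ rowCount n 0 - equiSum (λ a → weightedCount signs (Q? a))
  equiSum-someLine = begin
    equiSum (λ a → ⟦ someLine? (Q? a) ⟧)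
      ≡⟨ equiSum-cong (λ a → trans (double-complement ⟦ someLine? (Q? a) ⟧)
           (cong (λ x → 1ℚ - x) (sym (weightedCount-signs (Q? a) (exclusive a))))) ⟩
    equiSum (λ a → 1ℚ - weightedCount signs (Q? a))
      ≡⟨ equiSum-- (λ _ → 1ℚ) (λ a → weightedCount signs (Q? a)) ⟩
    equiSum {n} (λ _ → 1ℚ) - equiSum (λ a → weightedCount signs (Q? a))
      ≡⟨ cong (_- equiSum (λ a → weightedCount signs (Q? a))) (equiSum-1 {n}) ⟩
    rowCount n 0 - equiSum (λ a → weightedCount signs (Q? a)) ∎
    where
    open ≡-Reasoning
    double-complement : ∀ x → x ≡ 1ℚ - (1ℚ - x)
    double-complement = solve-∀ ℚ-ring

  -- The term for the empty set of lines counts all equi-squares and cancels against `rowCount n 0`;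
  -- this is why the sum in the formula starts at i = 1.
  equiSum-someLine-exact : equiSum (λ a → ⟦ someLine? (Q? a) ⟧)
    ≡ - (∑[ j < n ] binomialTerm n (λ i → signs i * rowCount n i) (suc (toℕ j)))
  equiSum-someLine-exact = trans equiSum-someLine
    (trans (cong (λ x → rowCount n 0 - x) (equiSum-weightedCount Q? equiSum-lines signs))
      (cancel (rowCount n 0) (∑[ j < n ] binomialTerm n (λ i → signs i * rowCount n i) (suc (toℕ j)))))
    where
    cancel : ∀ a b → a - (1ℚ * (1ℚ * (1ℚ * a)) + b) ≡ - b
    cancel = solve-∀ ℚ-ring

neg-two-^ : ∀ i → (- fromℕ 2) ^ (i ℕ.+ 1) ≡ - (fromℕ 2 * (fromℕ 2 ^ i * signs i))
neg-two-^ zero    = refl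
neg-two-^ (suc i) = trans (cong (- fromℕ 2 *_) (neg-two-^ i)) (regroup (fromℕ 2) (fromℕ 2 ^ i) (signs i))
  where
  regroup : ∀ t a b → - t * - (t * (a * b)) ≡ - (t * (t * a * (- 1ℚ * b)))
  regroup = solve-∀ ℚ-ring

-- Origin of (-2)^(i+1): the sign -(-1)^i of inclusion-exclusion, 2^i choices of directions, and a
-- factor 2 because rows and columns contribute equally.
twice-someLine : ∀ n → (let S = ∑[ j < n ] binomialTerm n (λ i → signs i * rowCount n i) (suc (toℕ j)) in - S + - S)
  ≡ ∑[ j < n ] (let i = suc (toℕ j) in (- fromℕ 2) ^ (i ℕ.+ 1) * fromℕ (n C i) * rowCount n i)
twice-someLine n = begin
  - sum b + - sum b
    ≡⟨ double (sum b) ⟩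
  - fromℕ 2 * sum b
    ≡⟨ *-distribˡ-sum (- fromℕ 2) b ⟩
  sum (λ j → - fromℕ 2 * b j)
    ≡⟨ sum-cong-≗ {n} (λ j → sym (term (suc (toℕ j)))) ⟩
  ∑[ j < n ] (let i = suc (toℕ j) in (- fromℕ 2) ^ (i ℕ.+ 1) * fromℕ (n C i) * rowCount n i) ∎
  where
  open ≡-Reasoning
  b : Fin n → ℚ
  b j = binomialTerm n (λ i → signs i * rowCount n i) (suc (toℕ j))
  double : ∀ a → - a + - a ≡ - (1ℚ + 1ℚ) * a
  double = solve-∀ ℚ-ring
  regroup : ∀ t a b c d → - (t * (a * b)) * c * d ≡ - t * (c * (a * (b * d)))
  regroup = solve-∀ ℚ-ring
  term : ∀ i → (- fromℕ 2) ^ (i ℕ.+ 1) * fromℕ (n C i) * rowCount n i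
             ≡ - fromℕ 2 * binomialTerm n (λ i → signs i * rowCount n i) i
  term i = trans (cong (λ x → x * fromℕ (n C i) * rowCount n i) (neg-two-^ i))
    (regroup (fromℕ 2) (fromℕ 2 ^ i) (signs i) (fromℕ (n C i)) (rowCount n i))

equiSum-someRow*someCol : 2 ℕ.≤ n → equiSum {n} (λ a → someRow a * someCol a)
  ≡ fromℕ (4 ℕ.* n) * crossCount₁₁ n
    - (fromℕ (8 ℕ.* ⌊ n /2⌋) * crossCount₁₂ n - fromℕ (2 ℕ.* ⌊ n /2⌋) * crossCount₂₂ n)
equiSum-someRow*someCol {n} 2≤n = begin
  equiSum {n} (λ a → someRow a * someCol a)
    ≡⟨ equiSum-cong {n} someRow*someCol ⟩
  equiSum {n} (λ a → ∑ₗ (List.allFin n) (crossing a))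
    ≡⟨ equiSum-∑ₗ (List.allFin n) (λ m a → crossing a m) ⟩
  ∑ₗ (List.allFin n) (λ m → equiSum (λ a → crossing a m))
    ≡⟨ trans (∑ₗ-cong (List.allFin n) (equiSum-crossing 2≤n)) (∑ₗ-allFin {n} (λ m → C + - (mirrored m * D))) ⟩
  sum {n} (λ m → C + - (mirrored m * D))
    ≡⟨ trans (∑-distrib-+ {n} (λ _ → C) (λ m → - (mirrored m * D)))
         (cong₂ _+_ (sum-const n C) (trans (sum-neg {n} (λ m → mirrored m * D)) (cong -_ (sym (*-distribʳ-sum D (mirrored {n})))))) ⟩
  fromℕ n * C - sum (mirrored {n}) * D
    ≡⟨ cong (λ x → fromℕ n * C - x * D) (sum-mirrored n) ⟩
  fromℕ n * C - h * D
    ≡⟨ regroup (fromℕ n) h c₁₁ c₁₂ c₂₂ ⟩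
  fromℕ 4 * fromℕ n * c₁₁ - (fromℕ 4 * h * c₁₂ - h * c₂₂)
    ≡⟨ cong₂ (λ x y → x * c₁₁ - (y * c₁₂ - h * c₂₂)) (sym (fromℕ-* 4 n))
         (trans (sym (fromℕ-* 4 (2 ℕ.* ⌊ n /2⌋))) (cong fromℕ (sym (ℕₚ.*-assoc 4 2 ⌊ n /2⌋)))) ⟩
  fromℕ (4 ℕ.* n) * c₁₁ - (fromℕ (8 ℕ.* ⌊ n /2⌋) * c₁₂ - h * c₂₂) ∎
  where
  open ≡-Reasoning
  c₁₁ = crossCount₁₁ n
  c₁₂ = crossCount₁₂ n
  c₂₂ = crossCount₂₂ n
  C = c₁₁ + c₁₁ + (c₁₁ + c₁₁)
  D = c₁₂ + c₁₂ + (c₁₂ + c₁₂) - c₂₂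
  h = fromℕ (2 ℕ.* ⌊ n /2⌋)
  regroup : ∀ a h x y z → a * (x + x + (x + x)) - h * (y + y + (y + y) - z)
    ≡ (1ℚ + 1ℚ + 1ℚ + 1ℚ) * a * x - ((1ℚ + 1ℚ + 1ℚ + 1ℚ) * h * y - h * z)
  regroup = solve-∀ ℚ-ring

∣Σ∣-formula : ∀ n → 2 ℕ.≤ n → fromℕ (∣Σ∣ n) ≡
  (∑[ j < n ] (let i = suc (toℕ j) in (- fromℕ 2) ^ (i ℕ.+ 1) * fromℕ (n C i) * rowCount n i))
  - fromℕ (4 ℕ.* n) * fromℕ ((n ℕ.* n ℕ.+ 1 ℕ.∸ 2 ℕ.* n) !)
      * (1/ (+ n ℤ.- + 1) ! * 1/ (+ n ℤ.- + 2) ! ^ (n ℕ.∸ 1))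
  + fromℕ (8 ℕ.* ⌊ n /2⌋) * fromℕ ((n ℕ.* n ℕ.+ 2 ℕ.∸ 3 ℕ.* n) !)
      * (1/ (+ n ℤ.- + 2) ! ^ 2 * 1/ (+ n ℤ.- + 3) ! ^ (n ℕ.∸ 2))
  - fromℕ (2 ℕ.* ⌊ n /2⌋) * fromℕ ((n ℕ.* n ℕ.+ 4 ℕ.∸ 4 ℕ.* n) !)
      * (1/ (+ n ℤ.- + 2) ! ^ 2 * 1/ (+ n ℤ.- + 4) ! ^ (n ℕ.∸ 2))
∣Σ∣-formula n 2≤n = begin
  fromℕ (∣Σ∣ n)
    ≡⟨ ∣Σ∣≡ n ⟩
  equiSum {n} someRow + equiSum {n} someCol - equiSum {n} (λ a → someRow a * someCol a)
    ≡⟨ cong₂ (λ x y → x - y)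
         (trans (cong₂ _+_ (equiSum-someLine-exact rowIs? (rows-exclusive 2≤n) equiSum-rows)
                           (equiSum-someLine-exact colIs? (cols-exclusive 2≤n) equiSum-cols))
           (twice-someLine n))
         (equiSum-someRow*someCol 2≤n) ⟩
  S - (a * (f₁ * g₁) - (b * (f₂ * g₂) - c * (f₃ * g₃)))
    ≡⟨ regroup S (a * (f₁ * g₁)) (b * (f₂ * g₂)) (c * (f₃ * g₃)) ⟩
  S - a * (f₁ * g₁) + b * (f₂ * g₂) - c * (f₃ * g₃)
    ≡⟨ cong₂ _-_ (cong₂ _+_ (cong (λ x → S - x) (sym (ℚₚ.*-assoc a f₁ g₁))) (sym (ℚₚ.*-assoc b f₂ g₂)))
                 (sym (ℚₚ.*-assoc c f₃ g₃)) ⟩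
  S - a * f₁ * g₁ + b * f₂ * g₂ - c * f₃ * g₃ ∎
  where
  open ≡-Reasoning
  S a b c f₁ f₂ f₃ g₁ g₂ g₃ : ℚ
  S = ∑[ j < n ] (let i = suc (toℕ j) in (- fromℕ 2) ^ (i ℕ.+ 1) * fromℕ (n C i) * rowCount n i)
  a = fromℕ (4 ℕ.* n)
  b = fromℕ (8 ℕ.* ⌊ n /2⌋)
  c = fromℕ (2 ℕ.* ⌊ n /2⌋)
  f₁ = fromℕ ((n ℕ.* n ℕ.+ 1 ℕ.∸ 2 ℕ.* n) !)
  f₂ = fromℕ ((n ℕ.* n ℕ.+ 2 ℕ.∸ 3 ℕ.* n) !)
  f₃ = fromℕ ((n ℕ.* n ℕ.+ 4 ℕ.∸ 4 ℕ.* n) !)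
  g₁ = 1/ (+ n ℤ.- + 1) ! * 1/ (+ n ℤ.- + 2) ! ^ (n ℕ.∸ 1)
  g₂ = 1/ (+ n ℤ.- + 2) ! ^ 2 * 1/ (+ n ℤ.- + 3) ! ^ (n ℕ.∸ 2)
  g₃ = 1/ (+ n ℤ.- + 2) ! ^ 2 * 1/ (+ n ℤ.- + 4) ! ^ (n ℕ.∸ 2)
  regroup : ∀ s x y z → s - (x - (y - z)) ≡ s - x + y - z
  regroup = solve-∀ ℚ-ring

-- Asymptotics

fromℕ-nonNeg : ∀ m → ℚ.NonNegative (fromℕ m)
fromℕ-nonNeg m = ℚₚ.normalize-nonNeg m 1

fromℕ-mono : ∀ {a b} → a ℕ.≤ b → fromℕ a ℚ.≤ fromℕ b
fromℕ-mono {a} {b} a≤b = subst₂ ℚ._≤_ (ℚₚ.+-identityʳ (fromℕ a))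
  (trans (sym (fromℕ-+ a (b ℕ.∸ a))) (cong fromℕ (ℕₚ.m+[n∸m]≡n a≤b)))
  (ℚₚ.+-monoʳ-≤ (fromℕ a) (ℚₚ.nonNegative⁻¹ (fromℕ (b ℕ.∸ a)) {{fromℕ-nonNeg (b ℕ.∸ a)}}))

fromℕ-^ : ∀ a j → fromℕ (a ℕ.^ j) ≡ fromℕ a ^ j
fromℕ-^ a zero    = refl
fromℕ-^ a (suc j) = trans (fromℕ-* a (a ℕ.^ j)) (cong (fromℕ a *_) (fromℕ-^ a j))

^-distribʳ-* : ∀ a b j → (a * b) ^ j ≡ a ^ j * b ^ j
^-distribʳ-* a b zero    = refl
^-distribʳ-* a b (suc j) = trans (cong (a * b *_) (^-distribʳ-* a b j)) (interchange a b (a ^ j) (b ^ j))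
  where
  interchange : ∀ a b c d → a * b * (c * d) ≡ a * c * (b * d)
  interchange = solve-∀ ℚ-ring

^-pos : ∀ a .{{_ : ℚ.Positive a}} j → ℚ.Positive (a ^ j)
^-pos a zero    = _
^-pos a (suc j) = ℚₚ.pos*pos⇒pos a (a ^ j) {{^-pos a j}}

fromℕ-pos : ∀ m .{{_ : ℕ.NonZero m}} → ℚ.Positive (fromℕ m)
fromℕ-pos m = ℚₚ.normalize-pos m 1

recip-factorial-pos : ∀ k → ℚ.Positive (1/ (+ k) !)
recip-factorial-pos k = ℚₚ.normalize-pos 1 (k !) {{k ℕₚ.!≢0}}

-- Growth of factorials

factorial-growth : ∀ {b} m j → b ℕ.≤ m → b ℕ.^ j ℕ.* m ! ℕ.≤ (m ℕ.+ j) !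
factorial-growth {b} m zero    b≤m = ℕₚ.≤-reflexive (trans (ℕₚ.*-identityˡ (m !)) (cong _! (sym (ℕₚ.+-identityʳ m))))
factorial-growth {b} m (suc j) b≤m = begin
  b ℕ.* b ℕ.^ j ℕ.* m !             ≡⟨ ℕₚ.*-assoc b (b ℕ.^ j) (m !) ⟩
  b ℕ.* (b ℕ.^ j ℕ.* m !)           ≤⟨ ℕₚ.*-mono-≤ (ℕₚ.m≤n⇒m≤1+n (ℕₚ.m≤n⇒m≤n+o j b≤m)) (factorial-growth m j b≤m) ⟩
  suc (m ℕ.+ j) ℕ.* (m ℕ.+ j) !     ≡⟨ cong _! (ℕₚ.+-suc m j) ⟨
  (m ℕ.+ suc j) !                   ∎
  where open ℕₚ.≤-Reasoning

-- The k factors by which the two factorials differ all exceed k², so their product is at least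
-- k^(2k), and 2k ≥ k + 1.
square-factorial-growth : ∀ k → .{{_ : ℕ.NonZero k}} → k ℕ.^ suc k ℕ.* (k ℕ.* k) ! ℕ.≤ (k ℕ.* k ℕ.+ k) !
square-factorial-growth k = begin
  k ℕ.^ suc k ℕ.* (k ℕ.* k) !       ≤⟨ ℕₚ.*-monoˡ-≤ ((k ℕ.* k) !) (ℕₚ.^-monoʳ-≤ k (ℕₚ.+-monoˡ-≤ k (ℕ.>-nonZero⁻¹ k))) ⟩
  k ℕ.^ (k ℕ.+ k) ℕ.* (k ℕ.* k) !   ≡⟨ cong (ℕ._* (k ℕ.* k) !) k^[k+k]≡ ⟩
  (k ℕ.* k) ℕ.^ k ℕ.* (k ℕ.* k) !   ≤⟨ factorial-growth (k ℕ.* k) k ℕₚ.≤-refl ⟩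
  (k ℕ.* k ℕ.+ k) !                 ∎
  where
  open ℕₚ.≤-Reasoning
  k^[k+k]≡ : k ℕ.^ (k ℕ.+ k) ≡ (k ℕ.* k) ℕ.^ k
  k^[k+k]≡ = trans (cong (λ x → k ℕ.^ (k ℕ.+ x)) (sym (ℕₚ.+-identityʳ k)))
    (trans (sym (ℕₚ.^-*-assoc k 2 k)) (cong (λ x → (k ℕ.* x) ℕ.^ k) (ℕₚ.*-identityʳ k)))

2*nC2 : ∀ m → 2 ℕ.* (suc m C 2) ≡ suc m ℕ.* m
2*nC2 zero    = refl
2*nC2 (suc m) = begin
  2 ℕ.* (suc (suc m) C 2)               ≡⟨ cong (2 ℕ.*_) (nCk+nC[k+1]≡[n+1]C[k+1] (suc m) 1) ⟨
  2 ℕ.* (suc m C 1 ℕ.+ suc m C 2)       ≡⟨ cong (λ x → 2 ℕ.* (x ℕ.+ suc m C 2)) (nC1≡n (suc m)) ⟩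
  2 ℕ.* (suc m ℕ.+ suc m C 2)           ≡⟨ ℕₚ.*-distribˡ-+ 2 (suc m) (suc m C 2) ⟩
  2 ℕ.* suc m ℕ.+ 2 ℕ.* (suc m C 2)     ≡⟨ cong (2 ℕ.* suc m ℕ.+_) (2*nC2 m) ⟩
  2 ℕ.* suc m ℕ.+ suc m ℕ.* m           ≡⟨ factor m ⟩
  suc (suc m) ℕ.* suc m                 ∎
  where
  open ≡-Reasoning
  factor : ∀ m → 2 ℕ.* suc m ℕ.+ suc m ℕ.* m ≡ suc (suc m) ℕ.* suc m
  factor = ℕ-Solver.solve-∀

m≡n+o⇒m∸n≡o : ∀ {a} b c → a ≡ b ℕ.+ c → a ℕ.∸ b ≡ c
m≡n+o⇒m∸n≡o b c refl = ℕₚ.m+n∸m≡n b c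

signs<-beyond : ∀ l i → signs< l (l ℕ.+ i) ≡ 0ℚ
signs<-beyond zero    i = refl
signs<-beyond (suc l) i = cong -_ (signs<-beyond l i)

-- With n = `N` and k = `K` = n - 1, the factorials to be compared are those of n² - n = k² + k,
-- (n-1)² = k² and n² - 2n = k² - 1.
module Bounds (j : ℕ) where

  N K : ℕ
  N = suc (suc j)
  K = suc j

  private
    r = 1/ (+ K) !
    ιK = fromℕ K

    recip-pred : 1/ (+ j) ! ≡ ιK * r
    recip-pred = recip-factorial-pred (+ K)

    r^n-nonNeg : ℚ.NonNegative (r ^ N)
    r^n-nonNeg = ℚₚ.pos⇒nonNeg (r ^ N) {{^-pos r {{recip-factorial-pos K}} N}}

    -- After scaling by k² and by k respectively, `rowCount N 2` and `crossCount₁₁ N` take the same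
    -- value `fromℕ M * r ^ N`, so one inequality bounds both corrections.
    M : ℕ
    M = K ℕ.^ N ℕ.* (K ℕ.* K) !

    rowCount₁≡ : rowCount N 1 ≡ fromℕ ((K ℕ.* K ℕ.+ K) !) * r ^ N
    rowCount₁≡ = cong (λ x → fromℕ (x !) * r ^ N) (m≡n+o⇒m∸n≡o (1 ℕ.* N) (K ℕ.* K ℕ.+ K) (identity j))
      where
      identity : ∀ j → suc (suc j) ℕ.* suc (suc j) ≡ 1 ℕ.* suc (suc j) ℕ.+ (suc j ℕ.* suc j ℕ.+ suc j)
      identity = ℕ-Solver.solve-∀

    rowCount₂≡ : ιK * ιK * rowCount N 2 ≡ fromℕ M * r ^ N
    rowCount₂≡ = begin
      ιK * ιK * (fromℕ ((N ℕ.* N ℕ.∸ 2 ℕ.* N) !) * 1/ (+ j) ! ^ N)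
        ≡⟨ cong₂ (λ x y → ιK * ιK * (fromℕ (x !) * y)) (m≡n+o⇒m∸n≡o (2 ℕ.* N) (j ℕ.* N) (identity₁ j))
             (trans (cong (_^ N) recip-pred) (^-distribʳ-* ιK r N)) ⟩
      ιK * ιK * (fromℕ ((j ℕ.* N) !) * (ιK ^ N * r ^ N))
        ≡⟨ regroup ιK (fromℕ ((j ℕ.* N) !)) (ιK ^ N) (r ^ N) ⟩
      ιK ^ N * (ιK * ιK * fromℕ ((j ℕ.* N) !)) * r ^ N
        ≡⟨ cong (λ x → ιK ^ N * x * r ^ N) (trans (cong (_* fromℕ ((j ℕ.* N) !)) (sym (fromℕ-* K K)))
             (trans (sym (fromℕ-* (K ℕ.* K) ((j ℕ.* N) !))) (cong fromℕ square-factorial))) ⟩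
      ιK ^ N * fromℕ ((K ℕ.* K) !) * r ^ N
        ≡⟨ cong (_* r ^ N) (trans (cong (_* fromℕ ((K ℕ.* K) !)) (sym (fromℕ-^ K N)))
             (sym (fromℕ-* (K ℕ.^ N) ((K ℕ.* K) !)))) ⟩
      fromℕ M * r ^ N ∎
      where
      open ≡-Reasoning
      identity₁ : ∀ j → suc (suc j) ℕ.* suc (suc j) ≡ 2 ℕ.* suc (suc j) ℕ.+ j ℕ.* suc (suc j)
      identity₁ = ℕ-Solver.solve-∀
      identity₂ : ∀ j → suc j ℕ.* suc j ≡ suc (j ℕ.* suc (suc j))
      identity₂ = ℕ-Solver.solve-∀
      -- `j * N` is one less than `K * K`, so the factor `K * K` just completes the factorial.
      square-factorial : K ℕ.* K ℕ.* (j ℕ.* N) ! ≡ (K ℕ.* K) !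
      square-factorial = trans (cong (ℕ._* (j ℕ.* N) !) (identity₂ j)) (cong _! (sym (identity₂ j)))
      regroup : ∀ a b c d → a * a * (b * (c * d)) ≡ c * (a * a * b) * d
      regroup = solve-∀ ℚ-ring

    crossCount₁₁≡ : ιK * crossCount₁₁ N ≡ fromℕ M * r ^ N
    crossCount₁₁≡ = begin
      ιK * (fromℕ ((N ℕ.* N ℕ.+ 1 ℕ.∸ 2 ℕ.* N) !) * (r * 1/ (+ j) ! ^ K))
        ≡⟨ cong₂ (λ x y → ιK * (fromℕ (x !) * (r * y))) (m≡n+o⇒m∸n≡o (2 ℕ.* N) (K ℕ.* K) (identity j))
             (trans (cong (_^ K) recip-pred) (^-distribʳ-* ιK r K)) ⟩
      ιK * (fromℕ ((K ℕ.* K) !) * (r * (ιK ^ K * r ^ K)))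
        ≡⟨ regroup ιK (fromℕ ((K ℕ.* K) !)) r (ιK ^ K) (r ^ K) ⟩
      ιK ^ N * fromℕ ((K ℕ.* K) !) * r ^ N
        ≡⟨ cong (_* r ^ N) (trans (cong (_* fromℕ ((K ℕ.* K) !)) (sym (fromℕ-^ K N)))
             (sym (fromℕ-* (K ℕ.^ N) ((K ℕ.* K) !)))) ⟩
      fromℕ M * r ^ N ∎
      where
      open ≡-Reasoning
      identity : ∀ j → suc (suc j) ℕ.* suc (suc j) ℕ.+ 1 ≡ 2 ℕ.* suc (suc j) ℕ.+ suc j ℕ.* suc j
      identity = ℕ-Solver.solve-∀
      regroup : ∀ a b c d e → a * (b * (c * (d * e))) ≡ a * d * b * (c * e)
      regroup = solve-∀ ℚ-ring

    B≤ : fromℕ M * r ^ N ℚ.≤ rowCount N 1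
    B≤ = subst (fromℕ M * r ^ N ℚ.≤_) (sym rowCount₁≡)
      (ℚₚ.*-monoʳ-≤-nonNeg (r ^ N) {{r^n-nonNeg}} (fromℕ-mono (square-factorial-growth K)))

  rowCount₂-bound : ιK * ιK * rowCount N 2 ℚ.≤ rowCount N 1
  rowCount₂-bound = subst (ℚ._≤ rowCount N 1) (sym rowCount₂≡) B≤

  crossCount₁₁-bound : ιK * crossCount₁₁ N ℚ.≤ rowCount N 1
  crossCount₁₁-bound = subst (ℚ._≤ rowCount N 1) (sym crossCount₁₁≡) B≤

  rowCount₁-pos : ℚ.Positive (rowCount N 1)
  rowCount₁-pos = ℚₚ.pos*pos⇒pos (fromℕ ((N ℕ.* N ℕ.∸ 1 ℕ.* N) !))
    {{fromℕ-pos ((N ℕ.* N ℕ.∸ 1 ℕ.* N) !) {{(N ℕ.* N ℕ.∸ 1 ℕ.* N) ℕₚ.!≢0}}}}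
    (r ^ N) {{^-pos r {{recip-factorial-pos K}} N}}

  private
    ιN = fromℕ N
    c₁ = rowCount N 1
    c₂ = rowCount N 2
    c₁₁ = crossCount₁₁ N

    2≤n : 2 ℕ.≤ N
    2≤n = s≤s (s≤s z≤n)

  module _ {Q : Array N → Fin N → Direction → Set} (Q? : ∀ a i d → Dec (Q a i d))
    (exclusive : ∀ a → Exclusive (Q a))
    (equiSum-lines : ∀ (e : Lines N) {i} → lineCount e ≡ + i → i ℕ.≤ N → equiSum (λ a → ⟦ fits? (Q? a) e ⟧) ≡ rowCount N i)
    where

    private
      someLine : ℚ
      someLine = equiSum (λ a → ⟦ someLine? (Q? a) ⟧)

      tail-zero : ∀ m l → ∑[ i < m ] binomialTerm N (λ i → signs< l i * rowCount N i) (l ℕ.+ toℕ i) ≡ 0ℚ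
      tail-zero m l = sum-zero {m} (λ i → vanish (l ℕ.+ toℕ i) (signs<-beyond l (toℕ i)))
        where
        zeros : ∀ a b c → a * (b * (0ℚ * c)) ≡ 0ℚ
        zeros = solve-∀ ℚ-ring
        vanish : ∀ i → signs< l i ≡ 0ℚ → binomialTerm N (λ i → signs< l i * rowCount N i) i ≡ 0ℚ
        vanish i eq = trans (cong (λ x → fromℕ (N C i) * (fromℕ 2 ^ i * (x * rowCount N i))) eq)
          (zeros (fromℕ (N C i)) (fromℕ 2 ^ i) (rowCount N i))

    -- Passing to the complement reverses the Bonferroni bound: a lower bound for the squares
    -- without a line, cut off after single lines, gives the union bound over the 2n possible lines.
    someLine-upper : someLine ℚ.≤ fromℕ 2 * ιN * c₁
    someLine-upper = begin
      someLine
        ≡⟨ equiSum-someLine Q? exclusive equiSum-lines ⟩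
      rowCount N 0 - equiSum (λ a → weightedCount signs (Q? a))
        ≤⟨ ℚₚ.+-monoʳ-≤ (rowCount N 0) (ℚₚ.neg-antimono-≤ (equiSum-mono (λ a → bonferroni-2 (Q? a) (exclusive a)))) ⟩
      rowCount N 0 - equiSum (λ a → weightedCount (signs< 2) (Q? a))
        ≡⟨ cong (λ x → rowCount N 0 - x) (equiSum-weightedCount Q? equiSum-lines (signs< 2)) ⟩
      rowCount N 0 - (1ℚ * (1ℚ * (1ℚ * rowCount N 0)) + (fromℕ (N C 1) * (fromℕ 2 ^ 1 * (- 1ℚ * c₁)) + tail))
        ≡⟨ cong₂ (λ x y → rowCount N 0 - (1ℚ * (1ℚ * (1ℚ * rowCount N 0)) + (x * (fromℕ 2 ^ 1 * (- 1ℚ * c₁)) + y)))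
             (cong fromℕ (nC1≡n N)) (tail-zero K 2) ⟩
      rowCount N 0 - (1ℚ * (1ℚ * (1ℚ * rowCount N 0)) + (ιN * (fromℕ 2 ^ 1 * (- 1ℚ * c₁)) + 0ℚ))
        ≡⟨ simplify (rowCount N 0) ιN (fromℕ 2) c₁ ⟩
      fromℕ 2 * ιN * c₁ ∎
      where
      open ℚₚ.≤-Reasoning
      tail = ∑[ i < K ] binomialTerm N (λ i → signs< 2 i * rowCount N i) (2 ℕ.+ toℕ i)
      simplify : ∀ a b t c → a - (1ℚ * (1ℚ * (1ℚ * a)) + (b * (t * 1ℚ * (- 1ℚ * c)) + 0ℚ)) ≡ t * b * c
      simplify = solve-∀ ℚ-ring

    -- The cutoff after pairs of lines. The number of pairs with directions is 4 C(n,2) = 2n(n-1).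
    someLine-lower : fromℕ 2 * ιN * c₁ - fromℕ 2 * ιN * ιK * c₂ ℚ.≤ someLine
    someLine-lower = begin
      fromℕ 2 * ιN * c₁ - fromℕ 2 * ιN * ιK * c₂
        ≡⟨ cong (λ x → fromℕ 2 * ιN * c₁ - x) nC2≡ ⟨
      fromℕ 2 * ιN * c₁ - fromℕ 2 * fromℕ 2 * fromℕ (N C 2) * c₂
        ≡⟨ simplify (rowCount N 0) ιN (fromℕ 2) c₁ (fromℕ (N C 2)) c₂ ⟨
      rowCount N 0 - (1ℚ * (1ℚ * (1ℚ * rowCount N 0)) + (ιN * (fromℕ 2 ^ 1 * (- 1ℚ * c₁))
                      + (fromℕ (N C 2) * (fromℕ 2 ^ 2 * (1ℚ * c₂)) + 0ℚ)))
        ≡⟨ cong₂ (λ x y → rowCount N 0 - (1ℚ * (1ℚ * (1ℚ * rowCount N 0)) + (x * (fromℕ 2 ^ 1 * (- 1ℚ * c₁))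
                      + (fromℕ (N C 2) * (fromℕ 2 ^ 2 * (1ℚ * c₂)) + y))))
             (cong fromℕ (nC1≡n N)) (tail-zero j 3) ⟨
      rowCount N 0 - (1ℚ * (1ℚ * (1ℚ * rowCount N 0)) + (fromℕ (N C 1) * (fromℕ 2 ^ 1 * (- 1ℚ * c₁))
                      + (fromℕ (N C 2) * (fromℕ 2 ^ 2 * (1ℚ * c₂)) + tail)))
        ≡⟨ cong (λ x → rowCount N 0 - x) (equiSum-weightedCount Q? equiSum-lines (signs< 3)) ⟨
      rowCount N 0 - equiSum (λ a → weightedCount (signs< 3) (Q? a))
        ≤⟨ ℚₚ.+-monoʳ-≤ (rowCount N 0) (ℚₚ.neg-antimono-≤ (equiSum-mono (λ a → bonferroni-3 (Q? a) (exclusive a)))) ⟩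
      rowCount N 0 - equiSum (λ a → weightedCount signs (Q? a))
        ≡⟨ equiSum-someLine Q? exclusive equiSum-lines ⟨
      someLine ∎
      where
      open ℚₚ.≤-Reasoning
      tail = ∑[ i < j ] binomialTerm N (λ i → signs< 3 i * rowCount N i) (3 ℕ.+ toℕ i)
      simplify : ∀ a b t c d e → a - (1ℚ * (1ℚ * (1ℚ * a)) + (b * (t * 1ℚ * (- 1ℚ * c)) + (d * (t * (t * 1ℚ) * (1ℚ * e)) + 0ℚ)))
        ≡ t * b * c - t * t * d * e
      simplify = solve-∀ ℚ-ring
      nC2≡ : fromℕ 2 * fromℕ 2 * fromℕ (N C 2) * c₂ ≡ fromℕ 2 * ιN * ιK * c₂
      nC2≡ = cong (_* c₂) (trans (ℚₚ.*-assoc (fromℕ 2) (fromℕ 2) (fromℕ (N C 2)))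
        (trans (cong (fromℕ 2 *_) (trans (sym (fromℕ-* 2 (N C 2))) (trans (cong fromℕ (2*nC2 K)) (fromℕ-* N K))))
          (sym (ℚₚ.*-assoc (fromℕ 2) ιN ιK))))

∑ₗ-allFin-const : ∀ n c → ∑ₗ (List.allFin n) (λ _ → c) ≡ fromℕ n * c
∑ₗ-allFin-const n c = trans (∑ₗ-allFin {n} (λ _ → c)) (sum-const n c)

someRow*someCol-nonNeg : 0ℚ ℚ.≤ equiSum {n} (λ a → someRow a * someCol a)
someRow*someCol-nonNeg {n} = subst (ℚ._≤ equiSum {n} (λ a → someRow a * someCol a)) (equiSum-0 {n})
  (equiSum-mono {n} (λ a → ℚₚ.nonNegative⁻¹ (someRow a * someCol a)
    {{ℚₚ.nonNeg*nonNeg⇒nonNeg (someRow a) {{⟦⟧-nonNeg (someLine? (rowIs? a))}}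
                              (someCol a) {{⟦⟧-nonNeg (someLine? (colIs? a))}}}}))

someRow*someCol-bound : ∀ {n} → 2 ℕ.≤ n → equiSum {n} (λ a → someRow a * someCol a) ℚ.≤ fromℕ 4 * fromℕ n * crossCount₁₁ n
someRow*someCol-bound {n} 2≤n = begin
  equiSum {n} (λ a → someRow a * someCol a)
    ≡⟨ trans (equiSum-cong {n} someRow*someCol) (equiSum-∑ₗ (List.allFin n) (λ m a → crossing a m)) ⟩
  ∑ₗ (List.allFin n) (λ m → equiSum (λ a → crossing a m))
    ≤⟨ ∑ₗ-mono (List.allFin n) (equiSum-crossing≤ 2≤n) ⟩
  ∑ₗ (List.allFin n) (λ _ → c + c + (c + c))
    ≡⟨ trans (∑ₗ-allFin-const n (c + c + (c + c))) (regroup (fromℕ n) c) ⟩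
  fromℕ 4 * fromℕ n * c ∎
  where
  open ℚₚ.≤-Reasoning
  c = crossCount₁₁ n
  regroup : ∀ a c → a * (c + c + (c + c)) ≡ (1ℚ + 1ℚ + 1ℚ + 1ℚ) * a * c
  regroup = solve-∀ ℚ-ring

module Estimate (j : ℕ) where

  open Bounds j

  private
    ιN ιK c₁ c₂ c₁₁ X Y Z : ℚ
    ιN  = fromℕ N
    ιK  = fromℕ K
    c₁  = rowCount N 1
    c₂  = rowCount N 2
    c₁₁ = crossCount₁₁ N
    X   = equiSum {N} someRow
    Y   = equiSum {N} someCol
    Z   = equiSum {N} (λ a → someRow a * someCol a)

    2≤N : 2 ℕ.≤ N
    2≤N = s≤s (s≤s z≤n)

    ιK-nonNeg : ℚ.NonNegative ιK
    ιK-nonNeg = fromℕ-nonNeg K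

    4ιN-nonNeg : ℚ.NonNegative (fromℕ 4 * ιN)
    4ιN-nonNeg = subst ℚ.NonNegative (fromℕ-* 4 N) (fromℕ-nonNeg (4 ℕ.* N))

  mainTerm : ℚ
  mainTerm = fromℕ 4 * ιN * c₁

  mainTerm-pos : ℚ.Positive mainTerm
  mainTerm-pos = ℚₚ.pos*pos⇒pos (fromℕ 4 * ιN) {{subst ℚ.Positive (fromℕ-* 4 N) (fromℕ-pos (4 ℕ.* N))}} c₁ {{rowCount₁-pos}}

  ∣Σ∣-upper : fromℕ (∣Σ∣ N) ℚ.≤ mainTerm
  ∣Σ∣-upper = begin
    fromℕ (∣Σ∣ N)     ≡⟨ ∣Σ∣≡ N ⟩
    X + Y - Z         ≤⟨ ℚₚ.+-mono-≤ (ℚₚ.+-mono-≤ (someLine-upper rowIs? (rows-exclusive 2≤N) equiSum-rows)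
                                                    (someLine-upper colIs? (cols-exclusive 2≤N) equiSum-cols))
                                       (ℚₚ.neg-antimono-≤ (someRow*someCol-nonNeg {N})) ⟩
    fromℕ 2 * ιN * c₁ + fromℕ 2 * ιN * c₁ - 0ℚ  ≡⟨ regroup ιN c₁ ⟩
    mainTerm          ∎
    where
    open ℚₚ.≤-Reasoning
    regroup : ∀ a c → (1ℚ + 1ℚ) * a * c + (1ℚ + 1ℚ) * a * c - 0ℚ ≡ (1ℚ + 1ℚ + 1ℚ + 1ℚ) * a * c
    regroup = solve-∀ ℚ-ring

  -- The deficit is at most 4nk c₂ from pairs of parallel lines plus 4n c₁₁ from crossings.
  -- Multiplied by k, each part is at most the main term; keeping k on the left avoids a division.
  ∣Σ∣-lower : ιK * (mainTerm - fromℕ (∣Σ∣ N)) ℚ.≤ mainTerm + mainTerm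
  ∣Σ∣-lower = begin
    ιK * (mainTerm - fromℕ (∣Σ∣ N))
      ≡⟨ cong (λ x → ιK * (mainTerm - x)) (∣Σ∣≡ N) ⟩
    ιK * (mainTerm - (X + Y - Z))
      ≤⟨ ℚₚ.*-monoˡ-≤-nonNeg ιK {{ιK-nonNeg}} (ℚₚ.+-monoʳ-≤ mainTerm (ℚₚ.neg-antimono-≤
           (ℚₚ.+-mono-≤ (ℚₚ.+-mono-≤ (someLine-lower rowIs? (rows-exclusive 2≤N) equiSum-rows)
                                       (someLine-lower colIs? (cols-exclusive 2≤N) equiSum-cols))
                         (ℚₚ.neg-antimono-≤ (someRow*someCol-bound 2≤N))))) ⟩
    ιK * (mainTerm - (L + L - fromℕ 4 * ιN * c₁₁))
      ≡⟨ regroup ιK ιN c₁ c₂ c₁₁ ⟩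
    fromℕ 4 * ιN * (ιK * ιK * c₂) + fromℕ 4 * ιN * (ιK * c₁₁)
      ≤⟨ ℚₚ.+-mono-≤ (ℚₚ.*-monoˡ-≤-nonNeg (fromℕ 4 * ιN) {{4ιN-nonNeg}} rowCount₂-bound)
                      (ℚₚ.*-monoˡ-≤-nonNeg (fromℕ 4 * ιN) {{4ιN-nonNeg}} crossCount₁₁-bound) ⟩
    mainTerm + mainTerm ∎
    where
    open ℚₚ.≤-Reasoning
    L = fromℕ 2 * ιN * c₁ - fromℕ 2 * ιN * ιK * c₂
    regroup : ∀ k a x y z →
      k * ((1ℚ + 1ℚ + 1ℚ + 1ℚ) * a * x - (((1ℚ + 1ℚ) * a * x - (1ℚ + 1ℚ) * a * k * y)
        + ((1ℚ + 1ℚ) * a * x - (1ℚ + 1ℚ) * a * k * y) - (1ℚ + 1ℚ + 1ℚ + 1ℚ) * a * z))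
      ≡ (1ℚ + 1ℚ + 1ℚ + 1ℚ) * a * (k * k * y) + (1ℚ + 1ℚ + 1ℚ + 1ℚ) * a * (k * z)
    regroup = solve-∀ ℚ-ring

-- Since f ≤ g, the distance of f/g from 1 is (g - f)/g. Its product with k is at most 2, which is
-- less than kε, and k can be cancelled.
ratio-estimate : ∀ f g k ε .{{_ : ℚ.Positive g}} .{{_ : ℚ.NonNegative k}} → f ℚ.≤ g → k * (g - f) ℚ.≤ g + g →
  1ℚ + 1ℚ ℚ.< k * ε → ℚ.∣ (f ℚ.÷ g) {{ℚₚ.pos⇒nonZero g}} - 1ℚ ∣ ℚ.< ε
ratio-estimate f g k ε f≤g k*[g-f]≤2g 2<kε = subst (ℚ._< ε) (sym ∣ratio∣≡)
  (ℚₚ.*-cancelˡ-<-nonNeg k (ℚₚ.≤-<-trans kq≤2 2<kε))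
  where
  instance
    g≢0 : ℚ.NonZero g
    g≢0 = ℚₚ.pos⇒nonZero g
  g⁻¹ = ℚ.1/ g
  g⁻¹-nonNeg : ℚ.NonNegative g⁻¹
  g⁻¹-nonNeg = ℚₚ.pos⇒nonNeg g⁻¹ {{ℚₚ.1/pos⇒pos g}}
  q = (g - f) * g⁻¹
  distrib : ∀ a b c → a * c - b * c ≡ - ((b - a) * c)
  distrib = solve-∀ ℚ-ring
  ratio≡ : f * g⁻¹ - 1ℚ ≡ - q
  ratio≡ = trans (cong (λ x → f * g⁻¹ - x) (sym (ℚₚ.*-inverseʳ g))) (distrib f g g⁻¹)
  q-nonNeg : 0ℚ ℚ.≤ q
  q-nonNeg = subst (ℚ._≤ q) (ℚₚ.*-zeroˡ g⁻¹) (ℚₚ.*-monoʳ-≤-nonNeg g⁻¹ {{g⁻¹-nonNeg}} (p≤q⇒0≤q-p f≤g))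
  ∣ratio∣≡ : ℚ.∣ f * g⁻¹ - 1ℚ ∣ ≡ q
  ∣ratio∣≡ = trans (cong ℚ.∣_∣ ratio≡) (trans (ℚₚ.∣-p∣≡∣p∣ q) (ℚₚ.0≤p⇒∣p∣≡p q-nonNeg))
  kq≤2 : k * q ℚ.≤ 1ℚ + 1ℚ
  kq≤2 = subst₂ ℚ._≤_ (ℚₚ.*-assoc k (g - f) g⁻¹)
    (trans (ℚₚ.*-distribʳ-+ g⁻¹ g g) (cong₂ _+_ (ℚₚ.*-inverseʳ g) (ℚₚ.*-inverseʳ g)))
    (ℚₚ.*-monoʳ-≤-nonNeg g⁻¹ {{g⁻¹-nonNeg}} k*[g-f]≤2g)

-- Multiplying by the denominator leaves the numerator, a positive integer.
1≤denominator*ε : ∀ ε → 0ℚ ℚ.< ε → 1ℚ ℚ.≤ fromℕ (ℚ.↧ₙ ε) * ε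
1≤denominator*ε ε 0<ε with ℚ.positive 0<ε
1≤denominator*ε ε@(ℚ.mkℚ (+ suc p) d _) 0<ε | _ = ℚₚ.toℚᵘ-cancel-≤ (ℚᵘₚ.≤-respʳ-≃
  (ℚᵘₚ.≃-sym (ℚᵘₚ.≃-trans (ℚₚ.toℚᵘ-homo-* (fromℕ (suc d)) ε) (ℚᵘₚ.*-congʳ (ιᵘ (+ suc d)))))
  (*≤* numerators))
  where
  open ℤₚ.≤-Reasoning
  numerators : 1ℤ ℤ.* + (1 ℕ.* suc d) ℤ.≤ (+ suc d ℤ.* + suc p) ℤ.* 1ℤ
  numerators = begin
    1ℤ ℤ.* + (1 ℕ.* suc d)          ≡⟨ ℤₚ.*-identityˡ (+ (1 ℕ.* suc d)) ⟩
    + (1 ℕ.* suc d)                  ≤⟨ ℤ.+≤+ (ℕₚ.≤-trans (ℕₚ.≤-reflexive (ℕₚ.*-identityˡ (suc d))) (ℕₚ.m≤m*n (suc d) (suc p))) ⟩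
    + (suc d ℕ.* suc p)              ≡⟨ trans (ℤₚ.pos-* (suc d) (suc p)) (sym (ℤₚ.*-identityʳ (+ suc d ℤ.* + suc p))) ⟩
    (+ suc d ℤ.* + suc p) ℤ.* 1ℤ   ∎

archimedean : ∀ ε → 0ℚ ℚ.< ε → ∀ k → 3 ℕ.* ℚ.↧ₙ ε ℕ.≤ k → 1ℚ + 1ℚ ℚ.< fromℕ k * ε
archimedean ε 0<ε k 3d≤k = begin-strict
  1ℚ + 1ℚ                            <⟨ 2ℚ<3ℚ ⟩
  -- The denominator times ε may be exactly 1, so a factor 3 is taken to exceed 2 strictly.
  fromℕ 3 * 1ℚ                        ≤⟨ ℚₚ.*-monoˡ-≤-nonNeg (fromℕ 3) (1≤denominator*ε ε 0<ε) ⟩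
  fromℕ 3 * (fromℕ (ℚ.↧ₙ ε) * ε)     ≡⟨ ℚₚ.*-assoc (fromℕ 3) (fromℕ (ℚ.↧ₙ ε)) ε ⟨
  fromℕ 3 * fromℕ (ℚ.↧ₙ ε) * ε       ≡⟨ cong (_* ε) (fromℕ-* 3 (ℚ.↧ₙ ε)) ⟨
  fromℕ (3 ℕ.* ℚ.↧ₙ ε) * ε           ≤⟨ ℚₚ.*-monoʳ-≤-nonNeg ε {{ℚₚ.pos⇒nonNeg ε {{ℚ.positive 0<ε}}}} (fromℕ-mono 3d≤k) ⟩
  fromℕ k * ε                         ∎
  where
  open ℚₚ.≤-Reasoning
  2ℚ<3ℚ : 1ℚ + 1ℚ ℚ.< fromℕ 3 * 1ℚ
  2ℚ<3ℚ = ℚ.*<* {p = 1ℚ + 1ℚ} {q = fromℕ 3 * 1ℚ} (ℤ.+<+ (s≤s (s≤s (s≤s z≤n))))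

∣Σ∣-asymptotics : (λ n → fromℕ (∣Σ∣ n)) ∼
  (λ n → fromℕ (4 ℕ.* n) * fromℕ ((n ℕ.* n ℕ.∸ n) !) * 1/ (+ n ℤ.- + 1) ! ^ n)
-- The two successors bring n into the form j + 2 that `Bounds` expects; then k = j + 1 is still at
-- least three times the denominator of ε.
∣Σ∣-asymptotics ε 0<ε = suc (suc (3 ℕ.* ℚ.↧ₙ ε)) , close
  where
  main : ℕ → ℚ
  main n = fromℕ (4 ℕ.* n) * fromℕ ((n ℕ.* n ℕ.∸ n) !) * 1/ (+ n ℤ.- + 1) ! ^ n
  close : ∀ n → suc (suc (3 ℕ.* ℚ.↧ₙ ε)) ℕ.≤ n →
    Σ[ g≢0 ∈ ℚ.NonZero (main n) ] ℚ.∣ (fromℕ (∣Σ∣ n) ℚ.÷ main n) {{g≢0}} - 1ℚ ∣ ℚ.< ε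
  close (suc (suc j)) (s≤s (s≤s 3d≤j)) = ℚₚ.pos⇒nonZero (main N) {{main-pos}} ,
    ratio-estimate (fromℕ (∣Σ∣ N)) (main N) (fromℕ K) ε {{main-pos}} {{fromℕ-nonNeg K}}
      (subst (fromℕ (∣Σ∣ N) ℚ.≤_) (sym main≡) ∣Σ∣-upper)
      (subst (λ g → fromℕ K * (g - fromℕ (∣Σ∣ N)) ℚ.≤ g + g) (sym main≡) ∣Σ∣-lower)
      (archimedean ε 0<ε K (ℕₚ.m≤n⇒m≤1+n 3d≤j))
    where
    open Bounds j
    open Estimate j
    main≡ : main N ≡ mainTerm
    main≡ = trans (ℚₚ.*-assoc (fromℕ (4 ℕ.* N)) (fromℕ ((N ℕ.* N ℕ.∸ N) !)) (1/ (+ N ℤ.- + 1) ! ^ N))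
      (cong₂ (λ x y → x * (fromℕ ((N ℕ.* N ℕ.∸ y) !) * 1/ (+ N ℤ.- + 1) ! ^ N)) (fromℕ-* 4 N) (sym (ℕₚ.*-identityˡ N)))
    main-pos : ℚ.Positive (main N)
    main-pos = subst ℚ.Positive (sym main≡) mainTerm-pos

theorem1p1 :
  (∀ n → 2 ℕ.≤ n →
    fromℕ (∣Σ∣ n) ≡
      (∑[ j < n ] (let i = suc (toℕ j) in
          (- fromℕ 2) ^ (i ℕ.+ 1) * fromℕ (n C i)
            * (fromℕ ((n ℕ.* n ℕ.∸ i ℕ.* n) !) * 1/ (+ n ℤ.- + i) ! ^ n)))
      - fromℕ (4 ℕ.* n) * fromℕ ((n ℕ.* n ℕ.+ 1 ℕ.∸ 2 ℕ.* n) !)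
          * (1/ (+ n ℤ.- + 1) ! * 1/ (+ n ℤ.- + 2) ! ^ (n ℕ.∸ 1))
      + fromℕ (8 ℕ.* ⌊ n /2⌋) * fromℕ ((n ℕ.* n ℕ.+ 2 ℕ.∸ 3 ℕ.* n) !)
          * (1/ (+ n ℤ.- + 2) ! ^ 2 * 1/ (+ n ℤ.- + 3) ! ^ (n ℕ.∸ 2))
      - fromℕ (2 ℕ.* ⌊ n /2⌋) * fromℕ ((n ℕ.* n ℕ.+ 4 ℕ.∸ 4 ℕ.* n) !)
          * (1/ (+ n ℤ.- + 2) ! ^ 2 * 1/ (+ n ℤ.- + 4) ! ^ (n ℕ.∸ 2)))
  ×
  ((λ n → fromℕ (∣Σ∣ n)) ∼
   (λ n → fromℕ (4 ℕ.* n) * fromℕ ((n ℕ.* n ℕ.∸ n) !) * 1/ (+ n ℤ.- + 1) ! ^ n))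
theorem1p1 = ∣Σ∣-formula , ∣Σ∣-asymptotics
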